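{- Let $\mathbf{k}$ be a field and $q\in\mathbf{k}$ with $q\neq 0$. For any integers $1\le k\le n$, the following identity holds in $\mathcal{H}_n$: $$\mathcal{B}_n\,\mathcal{R}_{n,k}=\Big(q^k\,\mathcal{R}_{n-1,k}+\big([n+1-k]_q+q^{n+1-k}J_n\big)\mathcal{R}_{n-1,k-1}\Big)\mathcal{B}_n .$$
   Context: The Hecke algebra $\mathcal{H}_n$ (over a field $\mathbf{k}$, parameter $q\in\mathbf{k}$) is the unital associative $\mathbf{k}$-algebra generated by $T_1,\dots,T_{n-1}$ subject to $T_i^2=(q-1)T_i+q$, $T_iT_j=T_jT_i$ for $|i-j|>1$, and $T_iT_{i+1}T_i=T_{i+1}T_iT_{i+1}$. It has a basis $(T_w)_{w\in S_n}$, where $T_w=T_{i_1}\cdots T_{i_r}$ for any reduced expression $w=s_{i_1}\cdots s_{i_r}$ with $s_i=(i,i+1)$. We regard $\mathcal{H}_{n-1}\subseteq\mathcal{H}_n$ by identifying equally named generators. Let $[k]_q=1+q+\cdots+q^{k-1}$ and $[k]!_q=[1]_q\cdots[k]_q$. For any integer $m$ set $\mathcal{B}_m=\sum_{i=1}^m T_{m-1}T_{m-2}\cdots T_i$ and $\mathcal{B}^*_m=\sum_{i=1}^m T_iT_{i+1}\cdots T_{m-1}$ (both $0$ for $m\le0$). For $n,k\ge0$: $\mathcal{B}_{n,k}=\mathcal{B}_{n-k+1}\cdots\mathcal{B}_{n-1}\mathcal{B}_n$, $\mathcal{B}^*_{n,k}=\mathcal{B}^*_n\cdots\mathcal{B}^*_{n-k+1}$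 (empty products $=1$), and $\mathcal{R}_{n,k}=\frac{1}{[k]!_q}\mathcal{B}^*_{n,k}\mathcal{B}_{n,k}$, defined for specific $q$ by specializing the corresponding element computed for indeterminate $q$ (where $\mathcal{B}^*_{n,k}\mathcal{B}_{n,k}$ has $\mathbb{Z}[q]$-coefficients divisible by $[k]!_q$). In particular $\mathcal{R}_{n-1,n}=0$. The Young–Jucys–Murphy element is $J_n=\sum_{i=1}^{n-1}q^{i-n}T_{(i,n)}$, where $(i,n)$ is the transposition. -}

module Defs where

open import Level using (Level; _⊔_) renaming (suc to lsuc)
open import Data.Nat using (ℕ; zero; suc; _∸_; _<ᵇ_; _≡ᵇ_)
  renaming (_+_ to _+ℕ_; _*_ to _*ℕ_)
open import Data.Integer as ℤ using (ℤ; +_; -[1+_])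
open import Data.Bool using (Bool; true; false; if_then_else_)
open import Data.List using (List; []; _∷_; map; foldr; upTo; reverse; length; concatMap)
open import Data.Product using (Σ)
open import Relation.Nullary using (¬_)
open import Relation.Binary.PropositionalEquality using (_≡_)
open import Algebra.Bundles using (CommutativeRing)
open import Algebra.Bundles.Raw using (RawRing)

record Field (c ℓ : Level) : Set (lsuc (c ⊔ ℓ)) where
  field
    commutativeRing : CommutativeRing c ℓ
  open CommutativeRing commutativeRing public
  field
    0≉1     : ¬ (0# ≈ 1#)
    inverse : (x : Carrier) → ¬ (x ≈ 0#) → Σ Carrier (λ y → x * y ≈ 1#)

-- Combinatorics of S_n.  A permutation w ∈ S_n of {1,…,n} is stored in
-- one-line notation, shifted to values {0,…,n-1}: the list
-- [w(1)-1, …, w(n)-1].  Composition is composition of functions, and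
-- s_i = (i,i+1) acts on the left by swapping the VALUES i-1 and i.

swapV : ℕ → ℕ → ℕ
swapV i j = if j ≡ᵇ (i ∸ 1) then i else if j ≡ᵇ i then i ∸ 1 else j

sAct : ℕ → List ℕ → List ℕ
sAct i w = map (swapV i) w

-- position of the first occurrence of a value (length of list if absent)
idx : ℕ → List ℕ → ℕ
idx a []       = zero
idx a (b ∷ bs) = if a ≡ᵇ b then zero else suc (idx a bs)

-- ℓ(s_i w) > ℓ(w)  ⇔  value i-1 occurs before value i in w
asc : ℕ → List ℕ → Bool
asc i w = idx (i ∸ 1) w <ᵇ idx i w

data MaybeN : Set where
  none : MaybeN
  some : ℕ → MaybeN

firstDescent : ℕ → List ℕ → MaybeN
firstDescent n w = go n
  where
  go : ℕ → MaybeN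
  go zero    = none
  go (suc m) with go m
  ... | some j = some j
  ... | none   = if (m ≡ᵇ zero) then none
                 else (if asc m w then none else some m)

-- a reduced word of w: w = s_{i₁} ⋯ s_{iᵣ} with r = ℓ(w); fuel n*n ≥ ℓ(w)
redWordF : ℕ → ℕ → List ℕ → List ℕ
redWordF n zero       w = []
redWordF n (suc fuel) w with firstDescent n w
... | none   = []
... | some i = i ∷ redWordF n fuel (sAct i w)

redWord : ℕ → List ℕ → List ℕ
redWord n w = redWordF n (n *ℕ n) w

insertions : ℕ → List ℕ → List (List ℕ)
insertions a []       = (a ∷ []) ∷ []
insertions a (b ∷ bs) = (a ∷ b ∷ bs) ∷ map (b ∷_) (insertions a bs)

perms : ℕ → List (List ℕ)
perms zero    = [] ∷ []
perms (suc n) = concatMap (insertions n) (perms n)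

idPerm : ℕ → List ℕ
idPerm n = upTo n

transp : ℕ → ℕ → List ℕ
transp n i = map (λ j → if j ≡ᵇ (i ∸ 1) then n ∸ 1
                        else if j ≡ᵇ (n ∸ 1) then i ∸ 1 else j) (upTo n)

_==L_ : List ℕ → List ℕ → Bool
[]       ==L []       = true
[]       ==L (_ ∷ _)  = false
(_ ∷ _)  ==L []       = false
(a ∷ as) ==L (b ∷ bs) = if a ≡ᵇ b then as ==L bs else false

ascRange : ℕ → ℕ → List ℕ
ascRange i j = map (λ t → i +ℕ t) (upTo (j ∸ i))

descRange : ℕ → ℕ → List ℕ
descRange i j = reverse (ascRange i j)

-- The Hecke algebra H_n over a (raw) commutative ring with parameter q,
-- realised on its standard basis (T_w)_{w ∈ S_n}: an element is its
-- coefficient function  w ↦ coefficient of T_w.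

module Hecke {a ℓ} (Rg : RawRing a ℓ) (q : RawRing.Carrier Rg) (n : ℕ) where
  open RawRing Rg

  H : Set a
  H = List ℕ → Carrier

  infix  4 _≈H_
  infixl 6 _⊕_
  infixl 7 _⊗_
  infixr 8 _·_

  _≈H_ : H → H → Set ℓ
  x ≈H y = ∀ (w : List ℕ) → x w ≈ y w

  0H : H
  0H w = 0#

  T[_] : List ℕ → H
  T[ v ] w = if v ==L w then 1# else 0#

  1H : H
  1H = T[ idPerm n ]

  _⊕_ : H → H → H
  (x ⊕ y) w = x w + y w

  _·_ : Carrier → H → H
  (r · x) w = r * x w

  ΣH : List H → H
  ΣH = foldr _⊕_ 0H

  -- left multiplication by the generator T_i on the standard basis:
  --   T_i T_w = T_{s_i w}                      if ℓ(s_i w) > ℓ(w)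
  --   T_i T_w = (q-1) T_w + q T_{s_i w}         if ℓ(s_i w) < ℓ(w)
  -- written out coefficientwise.
  Tl : ℕ → H → H
  Tl i x w = if asc i w then q * x (sAct i w)
             else x (sAct i w) + (q + - 1#) * x w

  Lword : List ℕ → H → H
  Lword []       x = x
  Lword (i ∷ is) x = Tl i (Lword is x)

  T : ℕ → H
  T i = Tl i 1H

  Tword : List ℕ → H
  Tword is = Lword is 1H

  -- multiplication: x y = Σ_w x_w T_w y, with T_w = T_{i₁}⋯T_{iᵣ} for the
  -- reduced word of w
  sumC : List Carrier → Carrier
  sumC = foldr _+_ 0#

  _⊗_ : H → H → H
  (x ⊗ y) u = sumC (map (λ w → x w * Lword (redWord n w) y u) (perms n))

  _^_ : Carrier → ℕ → Carrier
  r ^ zero  = 1#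
  r ^ suc m = r * (r ^ m)

  [_]q : ℕ → Carrier
  [ m ]q = sumC (map (λ j → q ^ j) (upTo m))

  B : ℕ → H
  B m = ΣH (map (λ t → Tword (descRange (suc t) m)) (upTo m))

  B* : ℕ → H
  B* m = ΣH (map (λ t → Tword (ascRange (suc t) m)) (upTo m))

  -- B_{m,k} = B_{m-k+1} ⋯ B_{m-1} B_m   (B_j = 0 for j ≤ 0)
  Bk : ℕ → ℕ → H
  Bk m zero    = 1H
  Bk zero (suc k) = Bk zero k ⊗ B zero
  Bk (suc m) (suc k) = Bk m k ⊗ B (suc m)

  B*k : ℕ → ℕ → H
  B*k m zero    = 1H
  B*k zero (suc k) = B* zero ⊗ B*k zero k
  B*k (suc m) (suc k) = B* (suc m) ⊗ B*k m k

-- Integer polynomials ℤ[q] (coefficient lists, lowest degree first)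

Poly : Set
Poly = List ℤ

addP : Poly → Poly → Poly
addP []       qs       = qs
addP (p ∷ ps) []       = p ∷ ps
addP (p ∷ ps) (r ∷ rs) = (p ℤ.+ r) ∷ addP ps rs

scaleP : ℤ → Poly → Poly
scaleP a = map (a ℤ.*_)

mulP : Poly → Poly → Poly
mulP []       qs = []
mulP (p ∷ ps) qs = addP (scaleP p qs) (+ 0 ∷ mulP ps qs)

negP : Poly → Poly
negP = map (λ z → ℤ.- z)

PolyRaw : RawRing _ _
PolyRaw = record
  { Carrier = Poly ; _≈_ = _≡_ ; _+_ = addP ; _*_ = mulP ; -_ = negP
  ; 0# = [] ; 1# = + 1 ∷ [] }

Xq : Poly
Xq = + 0 ∷ + 1 ∷ []

qintP : ℕ → Poly
qintP zero    = []
qintP (suc m) = + 1 ∷ qintP m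

qfactP : ℕ → Poly
qfactP zero    = + 1 ∷ []
qfactP (suc m) = mulP (qfactP m) (qintP (suc m))

-- long division by a monic polynomial (both highest degree first);
-- returns the quotient (highest degree first). Exact for exact divisions.
subFront : ℤ → List ℤ → List ℤ → List ℤ
subFront a []       rs       = rs
subFront a (d ∷ ds) []       = []
subFront a (d ∷ ds) (r ∷ rs) = (r ℤ.- a ℤ.* d) ∷ subFront a ds rs

ldiv : ℕ → List ℤ → List ℤ → List ℤ
ldiv zero    ds ps       = []
ldiv (suc c) ds []       = []
ldiv (suc c) ds (a ∷ rs) = a ∷ ldiv c ds (subFront a ds rs)

divMonic : Poly → Poly → Poly
divMonic p d with reverse d
... | []      = []
... | _ ∷ ds  = reverse (ldiv (length p ∸ length ds) ds (reverse p))

module HeckeField {c ℓ} (F : Field c ℓ) (q : Field.Carrier F)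
                  (q≉0 : ¬ (Field._≈_ F q (Field.0# F))) (n : ℕ) where
  open Field F
  open Hecke rawRing q n public

  fromℕ : ℕ → Carrier
  fromℕ zero    = 0#
  fromℕ (suc m) = 1# + fromℕ m

  fromℤ : ℤ → Carrier
  fromℤ (+ m)      = fromℕ m
  fromℤ -[1+ m ]   = - fromℕ (suc m)

  evalP : Poly → Carrier
  evalP []       = 0#
  evalP (a ∷ as) = fromℤ a + q * evalP as

  module Gen = Hecke PolyRaw Xq n

  -- R_{m,k} = (1/[k]!_q) B*_{m,k} B_{m,k}: computed over ℤ[q], divided by
  -- [k]!_q there, and specialised coefficientwise at q.
  R : ℕ → ℕ → H
  R m k w = evalP (divMonic ((Gen.B*k m k Gen.⊗ Gen.Bk m k) w) (qfactP k))

  q⁻¹ : Carrier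
  q⁻¹ = Σ.proj₁ (inverse q q≉0)
    where open import Data.Product as Σ using ()

  J : H
  J = ΣH (map (λ t → (q⁻¹ ^ (n ∸ suc t)) · T[ transp n (suc t) ]) (upTo (n ∸ 1)))

-- Put T_0 = B_0 = B*_0 = D_0 = 0, so that B_{m+1} = 1 + T_m B_m and
-- B*_{m+1} = 1 + B*_m T_m, and let D_{m+1} = 1 + T_m + T_m D_m T_m; then
-- D_n = [n]_q + q^n J_n.  Two exact identities, both by induction from the Hecke
-- relations, carry the proof: T_m B_m B_{m+1} = q B_m B_{m+1} and
-- B_{m+1} B*_{m+1} = D_{m+1} + B*_m T_m B_m.  Since D_{m+1} commutes with
-- T_1, …, T_{m-1}, they give by induction on k, for P_{n,k} = B*_{n,k} B_{n,k},
--   q^k B_n P_{n,k+1} = (q^{2k+1} P_{n-1,k+1} + [k+1]_q (D_n − [k]_q) P_{n-1,k}) B_n.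
-- This holds over ℤ[q], where P_{n,k} = [k]!_q r_{n,k} for an explicit r_{n,k};
-- as [k]!_q is monic it can be cancelled, and r_{n,k} is what the long division
-- in the definition of R returns.  Evaluation at q and division by q^k finish.
--
-- That ⊗ is associative follows from the right action of the generators: it
-- commutes with the left one, so a left multiplication operator is determined by
-- its value at 1.

module Submission where

open import Defs
open import Data.Nat as ℕ using (ℕ; zero; suc; _≤_; _<_; _∸_; _<ᵇ_; _≡ᵇ_; s≤s; z≤n; s≤s⁻¹)
  renaming (_+_ to _+ℕ_; _*_ to _*ℕ_)
import Data.Nat.Properties as ℕ
open import Data.Integer as ℤ using (ℤ; +_; -[1+_]; _⊖_; _◃_)
import Data.Integer.Properties as ℤ
open import Data.Integer.Tactic.RingSolver using (solve-∀)
import Data.Sign as Sign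
open import Data.Bool as Bool using (Bool; true; false; if_then_else_; _∧_; not)
open import Data.List
  using (List; []; _∷_; _++_; _∷ʳ_; map; foldr; filter; concatMap; reverse; length; upTo; applyUpTo)
open import Data.List.Properties
open import Data.List.Membership.Propositional using (_∈_; _∉_)
open import Data.List.Membership.Propositional.Properties
open import Data.List.Relation.Unary.Any using (Any; here; there)
open import Data.List.Relation.Unary.All as All using (All; []; _∷_)
import Data.List.Relation.Unary.All.Properties as All
open import Data.List.Relation.Unary.AllPairs using ([]; _∷_)
open import Data.List.Relation.Unary.Unique.Propositional using (Unique)
import Data.List.Relation.Unary.Unique.Propositional.Properties as Unique
open import Data.List.Relation.Binary.Permutation.Propositional using (_↭_; ↭-sym; ↭⇒↭ₛ)
import Data.List.Relation.Binary.Permutation.Propositional.Properties as Perm↭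
import Data.List.Relation.Binary.Permutation.Setoid.Properties as PermS
open import Data.Product using (Σ; ∃; ∃₂; _×_; _,_; proj₁; proj₂)
open import Data.Sum using (inj₁; inj₂; [_,_]′)
open import Data.Unit.Polymorphic using (⊤; tt)
open import Function using (_∘_; id)
open import Level using (_⊔_; 0ℓ)
open import Relation.Nullary using (¬_; Dec; yes; no; contradiction; ¬?)
open import Relation.Nullary.Decidable using (dec-true; dec-false)
open import Relation.Binary.Definitions using (tri<; tri≈; tri>)
import Relation.Binary.PropositionalEquality as ≡
open ≡ using (_≡_; _≢_)
open import Algebra.Bundles using (CommutativeRing; Ring)
open import Algebra.Bundles.Raw using (RawRing)
open import Algebra.Morphism.Structures using (IsRingHomomorphism)

-- Permutations in one-line notation

-- The polynomial form explains the role of D_n: J_n involves negative powers of q, while D_n makes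
-- sense over ℤ[q], and D_n - [k]_q = q^k ([n-k]_q + q^(n-k) J_n) returns the bracket of the
-- theorem, whose k is k+1 here.
--
-- The source of divisibility is the symmetry T_i B_{n,k} = q B_{n,k} for n-k < i < n. The element
-- B*_{n,k} is a sum over S_n / S_{n-k}, so each coset of S_{n-k} × S_k is met once for every
-- element of S_k; on B_{n,k} these elements contribute only the factor Σ q^ℓ = [k]!_q. Summing over
-- the coarser cosets instead gives r_{n,k}. The factor [k+1]_q of the recursion is then exactly
-- what separates [k]!_q from [k+1]!_q.
--
-- A second obstacle is the encoding. An element of `H` is a function on all lists, and `⊗` picks
-- one particular reduced word for each permutation. The ring therefore consists of the functions
-- vanishing off S_n, and its relations are reduced to statements about ascents of lists.

≡ᵇ-true : ∀ {a b} → a ≡ b → (a ≡ᵇ b) ≡ true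
≡ᵇ-true {a} {b} = dec-true (a ℕ.≟ b)

≡ᵇ-false : ∀ {a b} → a ≢ b → (a ≡ᵇ b) ≡ false
≡ᵇ-false {a} {b} = dec-false (a ℕ.≟ b)

<ᵇ-true : ∀ {a b} → a < b → (a <ᵇ b) ≡ true
<ᵇ-true {a} {b} = dec-true (a ℕ.<? b)

<ᵇ-false : ∀ {a b} → ¬ a < b → (a <ᵇ b) ≡ false
<ᵇ-false {a} {b} = dec-false (a ℕ.<? b)

<ᵇ-true⁻ : ∀ {a b} → (a <ᵇ b) ≡ true → a < b
<ᵇ-true⁻ {a} {b} e = ℕ.<ᵇ⇒< a b (≡.subst Bool.T (≡.sym e) _)

<ᵇ-false⁻ : ∀ {a b} → (a <ᵇ b) ≡ false → ¬ a < b
<ᵇ-false⁻ e a<b with () ← ≡.trans (≡.sym (<ᵇ-true a<b)) e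

-- Generators carry the index `suc i` throughout, so that `i ∸ 1` in `swapV` computes and the values
-- exchanged are i and i + 1.
data SwapView (i : ℕ) : ℕ → Set where
  lower : SwapView i i
  upper : SwapView i (suc i)
  other : ∀ {a} → a ≢ i → a ≢ suc i → SwapView i a

swapView : ∀ i a → SwapView i a
swapView i a with a ℕ.≟ i | a ℕ.≟ suc i
... | yes ≡.refl | _        = lower
... | no _     | yes ≡.refl = upper
... | no a≢i   | no a≢si  = other a≢i a≢si

swapV-lower : ∀ i → swapV (suc i) i ≡ suc i
swapV-lower i rewrite ≡ᵇ-true {i} ≡.refl = ≡.refl

swapV-upper : ∀ i → swapV (suc i) (suc i) ≡ i
swapV-upper i rewrite ≡ᵇ-false (ℕ.1+n≢n {i}) | ≡ᵇ-true {i} ≡.refl = ≡.refl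

swapV-other : ∀ i {a} → a ≢ i → a ≢ suc i → swapV (suc i) a ≡ a
swapV-other i p r rewrite ≡ᵇ-false p | ≡ᵇ-false r = ≡.refl

swapV-involutive : ∀ i a → swapV (suc i) (swapV (suc i) a) ≡ a
swapV-involutive i a with swapView i a
... | lower rewrite swapV-lower i = swapV-upper i
... | upper rewrite swapV-upper i = swapV-lower i
... | other p r rewrite swapV-other i p r = swapV-other i p r

swapV-< : ∀ {i n a} → suc i < n → a < n → swapV (suc i) a < n
swapV-< {i} {n} {a} i<n a<n with swapView i a
... | lower rewrite swapV-lower i = i<n
... | upper rewrite swapV-upper i = ℕ.<-trans (ℕ.n<1+n i) i<n
... | other p r rewrite swapV-other i p r = a<n

sAct-involutive : ∀ i w → sAct (suc i) (sAct (suc i) w) ≡ w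
sAct-involutive i w = ≡.trans (≡.sym (map-∘ w)) (≡.trans (map-cong (swapV-involutive i) w) (map-id w))

idx-here : ∀ a l → idx a (a ∷ l) ≡ 0
idx-here a l rewrite ≡ᵇ-true {a} ≡.refl = ≡.refl

idx-there : ∀ {a b} l → a ≢ b → idx a (b ∷ l) ≡ suc (idx a l)
idx-there l p rewrite ≡ᵇ-false p = ≡.refl

≡ᵇ-swapV : ∀ i a b → (a ≡ᵇ swapV (suc i) b) ≡ (swapV (suc i) a ≡ᵇ b)
≡ᵇ-swapV i a b with a ℕ.≟ swapV (suc i) b
... | yes ≡.refl = ≡.trans (≡ᵇ-true {a} ≡.refl) (≡.sym (≡ᵇ-true (swapV-involutive i b)))
... | no a≢    = ≡.trans (≡ᵇ-false a≢) (≡.sym (≡ᵇ-false {swapV (suc i) a}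
  λ e → a≢ (≡.trans (≡.sym (swapV-involutive i a)) (≡.cong (swapV (suc i)) e))))

-- For a permutation w the function `λ a → idx a w` is its inverse, and passing to inverses turns
-- left multiplication by s into right multiplication by s.
idx-sAct : ∀ i a w → idx a (sAct (suc i) w) ≡ idx (swapV (suc i) a) w
idx-sAct i a []      = ≡.refl
idx-sAct i a (b ∷ w) rewrite ≡ᵇ-swapV i a b | idx-sAct i a w = ≡.refl

idx-< : ∀ {a w} → a ∈ w → idx a w < length w
idx-< {a} {b ∷ w} a∈ with a ℕ.≟ b | a∈
... | yes ≡.refl | _        rewrite idx-here a w = s≤s z≤n
... | no a≢b   | here a≡b = contradiction a≡b a≢b
... | no a≢b   | there p  rewrite idx-there w a≢b = s≤s (idx-< p)

idx-injective : ∀ {a b w} → a ∈ w → idx a w ≡ idx b w → a ≡ b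
idx-injective {a} {b} {c ∷ w} a∈ e with a ℕ.≟ c | b ℕ.≟ c
... | yes ≡.refl | yes ≡.refl = ≡.refl
... | yes ≡.refl | no b≢c with () ← ≡.trans (≡.sym (idx-here a w)) (≡.trans e (idx-there w b≢c))
idx-injective {a} {b} {c ∷ w} a∈ e | no a≢c | yes ≡.refl
  with () ← ≡.trans (≡.sym (idx-there w a≢c)) (≡.trans e (idx-here b w))
idx-injective {a} {b} {c ∷ w} (here p)  e | no a≢c | no b≢c = contradiction p a≢c
idx-injective {a} {b} {c ∷ w} (there p) e | no a≢c | no b≢c =
  idx-injective p (ℕ.suc-injective (≡.trans (≡.sym (idx-there w a≢c)) (≡.trans e (idx-there w b≢c))))

asc-sAct : ∀ i w → asc (suc i) (sAct (suc i) w) ≡ (idx (suc i) w <ᵇ idx i w)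
asc-sAct i w rewrite idx-sAct i i w | idx-sAct i (suc i) w | swapV-lower i | swapV-upper i = ≡.refl

asc-sAct-ascent : ∀ i w → asc (suc i) w ≡ true → asc (suc i) (sAct (suc i) w) ≡ false
asc-sAct-ascent i w e = ≡.trans (asc-sAct i w) (<ᵇ-false (ℕ.<-asym (<ᵇ-true⁻ {idx i w} {idx (suc i) w} e)))

asc-lower : ∀ i l → asc (suc i) (i ∷ l) ≡ true
asc-lower i l rewrite idx-here i l | idx-there l (ℕ.1+n≢n {i}) = ≡.refl

asc-upper : ∀ i l → asc (suc i) (suc i ∷ l) ≡ false
asc-upper i l rewrite idx-here (suc i) l with idx i (suc i ∷ l)
... | zero  = ≡.refl
... | suc _ = ≡.refl

asc-other : ∀ i {a} l → a ≢ i → a ≢ suc i → asc (suc i) (a ∷ l) ≡ asc (suc i) l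
asc-other i l p r rewrite idx-there l (p ∘ ≡.sym) | idx-there l (r ∘ ≡.sym) = ≡.refl

==L-refl : ∀ v → (v ==L v) ≡ true
==L-refl []      = ≡.refl
==L-refl (a ∷ v) rewrite ≡ᵇ-true {a} ≡.refl = ==L-refl v

==L-sound : ∀ v w → (v ==L w) ≡ true → v ≡ w
==L-sound []      []      e = ≡.refl
==L-sound (a ∷ v) (b ∷ w) e with a ℕ.≟ b
... | yes ≡.refl rewrite ≡ᵇ-true {a} ≡.refl = ≡.cong (a ∷_) (==L-sound v w e)
... | no a≢b rewrite ≡ᵇ-false a≢b with () ← e

==L-≢ : ∀ {v w} → v ≢ w → (v ==L w) ≡ false
==L-≢ {v} {w} v≢w with v ==L w in e
... | false = ≡.refl
... | true  = contradiction (==L-sound v w e) v≢w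

-- Right multiplication by s_{j+1} swaps the entries in positions j and j+1.

swapP : ℕ → List ℕ → List ℕ
swapP _       []          = []
swapP zero    (a ∷ [])    = a ∷ []
swapP zero    (a ∷ b ∷ l) = b ∷ a ∷ l
swapP (suc j) (a ∷ l)     = a ∷ swapP j l

-- Past the end of the list `swapP` is the identity; the default `true` then makes the right action
-- below multiply by q, which still commutes with every left action.
ascP : ℕ → List ℕ → Bool
ascP _       []          = true
ascP zero    (a ∷ [])    = true
ascP zero    (a ∷ b ∷ l) = a <ᵇ b
ascP (suc j) (a ∷ l)     = ascP j l

swapP-involutive : ∀ j w → swapP j (swapP j w) ≡ w
swapP-involutive zero    []          = ≡.refl
swapP-involutive (suc j) []          = ≡.refl
swapP-involutive zero    (a ∷ [])    = ≡.refl
swapP-involutive zero    (a ∷ b ∷ l) = ≡.refl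
swapP-involutive (suc j) (a ∷ l)     = ≡.cong (a ∷_) (swapP-involutive j l)

length-swapP : ∀ j w → length (swapP j w) ≡ length w
length-swapP zero    []          = ≡.refl
length-swapP (suc j) []          = ≡.refl
length-swapP zero    (a ∷ [])    = ≡.refl
length-swapP zero    (a ∷ b ∷ l) = ≡.refl
length-swapP (suc j) (a ∷ l)     = ≡.cong suc (length-swapP j l)

map-swapP : ∀ (f : ℕ → ℕ) j w → map f (swapP j w) ≡ swapP j (map f w)
map-swapP f zero    []          = ≡.refl
map-swapP f (suc j) []          = ≡.refl
map-swapP f zero    (a ∷ [])    = ≡.refl
map-swapP f zero    (a ∷ b ∷ l) = ≡.refl
map-swapP f (suc j) (a ∷ l)     = ≡.cong (f a ∷_) (map-swapP f j l)

∈-swapP : ∀ j {w a} → a ∈ w → a ∈ swapP j w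
∈-swapP zero    {a ∷ []}    p                 = p
∈-swapP zero    {a ∷ b ∷ l} (here e)          = there (here e)
∈-swapP zero    {a ∷ b ∷ l} (there (here e))  = here e
∈-swapP zero    {a ∷ b ∷ l} (there (there p)) = there (there p)
∈-swapP (suc j) {a ∷ l}     (here e)          = here e
∈-swapP (suc j) {a ∷ l}     (there p)         = there (∈-swapP j p)

ascP-swapP : ∀ j w → suc j < length w → ascP j w ≡ true → ascP j (swapP j w) ≡ false
ascP-swapP zero    (a ∷ b ∷ l) _       e = <ᵇ-false (ℕ.<-asym (<ᵇ-true⁻ {a} e))
ascP-swapP zero    (a ∷ [])    (s≤s ()) e
ascP-swapP (suc j) (a ∷ l)     (s≤s p) e = ascP-swapP j l p e

-- Exchanging i and i + 1 alters the order of two distinct entries only if they are these two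
-- values; this is why the left and right ascent conditions interact so rarely.
<ᵇ-suc-left : ∀ i {b} → b ≢ suc i → (suc i <ᵇ b) ≡ (i <ᵇ b)
<ᵇ-suc-left i {b} b≢ with suc i ℕ.<? b | i ℕ.<? b
... | yes p | _     rewrite <ᵇ-true p | <ᵇ-true (ℕ.<-trans (ℕ.n<1+n i) p) = ≡.refl
... | no ¬p | yes p = contradiction (ℕ.≤∧≢⇒< p (b≢ ∘ ≡.sym)) ¬p
... | no ¬p | no ¬r rewrite <ᵇ-false ¬p | <ᵇ-false ¬r = ≡.refl

<ᵇ-suc-right : ∀ i {a} → a ≢ i → (a <ᵇ suc i) ≡ (a <ᵇ i)
<ᵇ-suc-right i {a} a≢ with a ℕ.<? suc i | a ℕ.<? i
... | _     | yes p rewrite <ᵇ-true p | <ᵇ-true (ℕ.m≤n⇒m≤1+n p) = ≡.refl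
... | yes p | no ¬p = contradiction (ℕ.≤∧≢⇒< (s≤s⁻¹ p) a≢) ¬p
... | no ¬p | no ¬r rewrite <ᵇ-false ¬p | <ᵇ-false ¬r = ≡.refl

-- s_{i+1} w = w s_{j+1} is the only case in which the two multiplications
-- affect each other's ascent condition.

data Interaction (i j : ℕ) (w : List ℕ) : Set where
  independent : asc (suc i) (swapP j w) ≡ asc (suc i) w →
                ascP j (sAct (suc i) w) ≡ ascP j w → Interaction i j w
  coincident  : i ∈ w → suc i ∈ w → sAct (suc i) w ≡ swapP j w → asc (suc i) w ≡ ascP j w →
                asc (suc i) (swapP j w) ≡ not (asc (suc i) w) →
                ascP j (sAct (suc i) w) ≡ not (ascP j w) → Interaction i j w

sAct-absent : ∀ i {l} → i ∉ l → suc i ∉ l → sAct (suc i) l ≡ l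
sAct-absent i {[]}    _ _ = ≡.refl
sAct-absent i {a ∷ l} p r = ≡.cong₂ _∷_ (swapV-other i (λ e → p (here (≡.sym e))) (λ e → r (here (≡.sym e))))
                                      (sAct-absent i (p ∘ there) (r ∘ there))

interaction : ∀ i j {w} → Unique w → Interaction i j w
interaction i j       {[]}         _ = independent ≡.refl ≡.refl
interaction i zero    {a ∷ []}     _ = independent ≡.refl ≡.refl
interaction i zero    {a ∷ b ∷ l} ((a≢b ∷ a∉l) ∷ (b∉l ∷ _)) with swapView i a | swapView i b
... | lower | lower = contradiction ≡.refl a≢b
... | upper | upper = contradiction ≡.refl a≢b
... | lower | upper
  = coincident (here ≡.refl) (there (here ≡.refl))
      (≡.cong₂ _∷_ (swapV-lower i) (≡.cong₂ _∷_ (swapV-upper i) (sAct-absent i (All.All¬⇒¬Any a∉l) (All.All¬⇒¬Any b∉l))))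
      (≡.trans (asc-lower i (suc i ∷ l)) (≡.sym (<ᵇ-true (ℕ.n<1+n i))))
      (≡.trans (asc-upper i (i ∷ l)) (≡.cong not (≡.sym (asc-lower i (suc i ∷ l)))))
      (≡.trans (≡.cong₂ _<ᵇ_ (swapV-lower i) (swapV-upper i))
             (≡.trans (<ᵇ-false (ℕ.<-asym (ℕ.n<1+n i))) (≡.cong not (≡.sym (<ᵇ-true (ℕ.n<1+n i))))))
... | upper | lower
  = coincident (there (here ≡.refl)) (here ≡.refl)
      (≡.cong₂ _∷_ (swapV-upper i) (≡.cong₂ _∷_ (swapV-lower i) (sAct-absent i (All.All¬⇒¬Any b∉l) (All.All¬⇒¬Any a∉l))))
      (≡.trans (asc-upper i (i ∷ l)) (≡.sym (<ᵇ-false (ℕ.<-asym (ℕ.n<1+n i)))))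
      (≡.trans (asc-lower i (suc i ∷ l)) (≡.cong not (≡.sym (asc-upper i (i ∷ l)))))
      (≡.trans (≡.cong₂ _<ᵇ_ (swapV-upper i) (swapV-lower i))
             (≡.trans (<ᵇ-true (ℕ.n<1+n i)) (≡.cong not (≡.sym (<ᵇ-false (ℕ.<-asym (ℕ.n<1+n i)))))))
... | lower | other p r = independent
      (≡.trans (asc-other i (i ∷ l) p r) (≡.trans (asc-lower i l) (≡.sym (asc-lower i (b ∷ l)))))
      (≡.trans (≡.cong₂ _<ᵇ_ (swapV-lower i) (swapV-other i p r)) (<ᵇ-suc-left i r))
... | upper | other p r = independent
      (≡.trans (asc-other i (suc i ∷ l) p r) (≡.trans (asc-upper i l) (≡.sym (asc-upper i (b ∷ l)))))
      (≡.trans (≡.cong₂ _<ᵇ_ (swapV-upper i) (swapV-other i p r)) (≡.sym (<ᵇ-suc-left i r)))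
... | other p r | lower = independent
      (≡.trans (asc-lower i (a ∷ l)) (≡.sym (≡.trans (asc-other i (i ∷ l) p r) (asc-lower i l))))
      (≡.trans (≡.cong₂ _<ᵇ_ (swapV-other i p r) (swapV-lower i)) (<ᵇ-suc-right i p))
... | other p r | upper = independent
      (≡.trans (asc-upper i (a ∷ l)) (≡.sym (≡.trans (asc-other i (suc i ∷ l) p r) (asc-upper i l))))
      (≡.trans (≡.cong₂ _<ᵇ_ (swapV-other i p r) (swapV-upper i)) (≡.sym (<ᵇ-suc-right i p)))
... | other p r | other p′ r′ = independent
      (≡.trans (≡.trans (asc-other i (a ∷ l) p′ r′) (asc-other i l p r))
             (≡.sym (≡.trans (asc-other i (b ∷ l) p r) (asc-other i l p′ r′))))
      (≡.cong₂ _<ᵇ_ (swapV-other i p r) (swapV-other i p′ r′))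
interaction i (suc j) {a ∷ l} (a∉l ∷ u) with interaction i j u
-- The membership fields serve this step: by uniqueness the head differs from both values, so `sAct`
-- fixes it and the left ascent condition ignores it.
... | coincident i∈ si∈ e₁ e₂ e₃ e₄ = coincident (there i∈) (there si∈)
      (≡.cong₂ _∷_ (swapV-other i a≢i a≢si) e₁)
      (≡.trans (asc-other i l a≢i a≢si) e₂)
      (≡.trans (asc-other i (swapP j l) a≢i a≢si) (≡.trans e₃ (≡.cong not (≡.sym (asc-other i l a≢i a≢si)))))
      e₄
  where
  a≢i : a ≢ i
  a≢i ≡.refl = All.All¬⇒¬Any a∉l i∈
  a≢si : a ≢ suc i
  a≢si ≡.refl = All.All¬⇒¬Any a∉l si∈
... | independent e₁ e₂ with swapView i a
...   | lower = independent (≡.trans (asc-lower i (swapP j l)) (≡.sym (asc-lower i l))) e₂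
...   | upper = independent (≡.trans (asc-upper i (swapP j l)) (≡.sym (asc-upper i l))) e₂
...   | other p r = independent (≡.trans (asc-other i (swapP j l) p r) (≡.trans e₁ (≡.sym (asc-other i l p r)))) e₂

-- The enumeration of S_n

record Perm (n : ℕ) (w : List ℕ) : Set where
  constructor mkPerm
  field
    length≡ : length w ≡ n
    covers  : ∀ {a} → a < n → a ∈ w
open Perm public

∈-insertions⁻ : ∀ {w} a u → w ∈ insertions a u → ∃₂ λ xs ys → u ≡ xs ++ ys × w ≡ xs ++ a ∷ ys
∈-insertions⁻ a []      (here ≡.refl) = [] , [] , ≡.refl , ≡.refl
∈-insertions⁻ a (b ∷ u) (here ≡.refl) = [] , b ∷ u , ≡.refl , ≡.refl
∈-insertions⁻ a (b ∷ u) (there p) with ∈-map⁻ (b ∷_) p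
... | w′ , w′∈ , ≡.refl with ∈-insertions⁻ a u w′∈
...   | xs , ys , ≡.refl , ≡.refl = b ∷ xs , ys , ≡.refl , ≡.refl

∈-insertions⁺ : ∀ a xs ys → xs ++ a ∷ ys ∈ insertions a (xs ++ ys)
∈-insertions⁺ a []       []      = here ≡.refl
∈-insertions⁺ a []       (_ ∷ _) = here ≡.refl
∈-insertions⁺ a (x ∷ xs) ys      = there (∈-map⁺ (x ∷_) (∈-insertions⁺ a xs ys))

∈-perms⁻ : ∀ n {w} → w ∈ perms (suc n) →
           ∃₂ λ xs ys → xs ++ ys ∈ perms n × w ≡ xs ++ n ∷ ys
∈-perms⁻ n w∈ with find′ (∈-concatMap⁻ (insertions n) {xs = perms n} w∈)
  where
  find′ : ∀ {w us} → Any (λ u → w ∈ insertions n u) us → ∃ λ u → u ∈ us × w ∈ insertions n u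
  find′ (here p)  = _ , here ≡.refl , p
  find′ (there p) with find′ p
  ... | u , u∈ , w∈u = u , there u∈ , w∈u
... | u , u∈ , w∈u with ∈-insertions⁻ n u w∈u
...   | xs , ys , ≡.refl , ≡.refl = xs , ys , u∈ , ≡.refl

∈-perms⁺ : ∀ n xs ys → xs ++ ys ∈ perms n → xs ++ n ∷ ys ∈ perms (suc n)
∈-perms⁺ n xs ys p = ∈-concatMap⁺ (insertions n) (lose′ p)
  where
  lose′ : ∀ {us} → xs ++ ys ∈ us → Any (λ u → xs ++ n ∷ ys ∈ insertions n u) us
  lose′ (here ≡.refl) = here (∈-insertions⁺ n xs ys)
  lose′ (there q)   = there (lose′ q)

length-insert : ∀ (xs : List ℕ) a ys → length (xs ++ a ∷ ys) ≡ suc (length (xs ++ ys))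
length-insert []       a ys = ≡.refl
length-insert (x ∷ xs) a ys = ≡.cong suc (length-insert xs a ys)

∈-insert⁺ : ∀ (xs : List ℕ) {a b ys} → b ∈ xs ++ ys → b ∈ xs ++ a ∷ ys
∈-insert⁺ xs b∈ = [ ∈-++⁺ˡ , ∈-++⁺ʳ xs ∘ there ]′ (∈-++⁻ xs b∈)

∈-insert⁻ : ∀ (xs : List ℕ) {a b ys} → b ≢ a → b ∈ xs ++ a ∷ ys → b ∈ xs ++ ys
∈-insert⁻ xs b≢a b∈ with ∈-++⁻ xs b∈
... | inj₁ p         = ∈-++⁺ˡ p
... | inj₂ (here e)  = contradiction e b≢a
... | inj₂ (there p) = ∈-++⁺ʳ xs p

∈perms⇒Perm : ∀ n {w} → w ∈ perms n → Perm n w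
∈perms⇒Perm zero    (here ≡.refl) = mkPerm ≡.refl λ ()
∈perms⇒Perm (suc n) w∈ with ∈-perms⁻ n w∈
... | xs , ys , u∈ , ≡.refl = mkPerm (≡.trans (length-insert xs n ys) (≡.cong suc (length≡ IH))) cov
  where
  IH = ∈perms⇒Perm n u∈
  cov : ∀ {a} → a < suc n → a ∈ xs ++ n ∷ ys
  cov a<sn with ℕ.m≤n⇒m<n∨m≡n (s≤s⁻¹ a<sn)
  ... | inj₁ a<n  = ∈-insert⁺ xs (covers IH a<n)
  ... | inj₂ ≡.refl = ∈-insert xs

-- `Perm` is a pigeonhole form of being a permutation, chosen because it is visibly stable under
-- `sAct` and `swapP`. Deleting an occurrence of the largest value leaves a shorter list still
-- covering the smaller ones; distinctness and boundedness of the entries are then read off from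
-- `perms`.
Perm⇒∈perms : ∀ n {w} → Perm n w → w ∈ perms n
Perm⇒∈perms zero    {[]} _ = here ≡.refl
Perm⇒∈perms (suc n) {w} p with ∈-∃++ (covers p (ℕ.n<1+n n))
... | xs , ys , ≡.refl = ∈-perms⁺ n xs ys (Perm⇒∈perms n (mkPerm
        (ℕ.suc-injective (≡.trans (≡.sym (length-insert xs n ys)) (length≡ p)))
        (λ a<n → ∈-insert⁻ xs (ℕ.<⇒≢ a<n) (covers p (ℕ.m≤n⇒m≤1+n a<n)))))

perms-bounded : ∀ n {w} → w ∈ perms n → All (_< n) w
perms-bounded zero    (here ≡.refl) = []
perms-bounded (suc n) w∈ with ∈-perms⁻ n w∈
... | xs , ys , u∈ , ≡.refl with All.++⁻ xs (All.map ℕ.m≤n⇒m≤1+n (perms-bounded n u∈))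
...   | pxs , pys = All.++⁺ pxs (ℕ.n<1+n n ∷ pys)

∉-perms : ∀ n {w} → w ∈ perms n → n ∉ w
∉-perms n w∈ n∈w = ℕ.<-irrefl ≡.refl (All.lookup (perms-bounded n w∈) n∈w)

perms-entries-unique : ∀ n {w} → w ∈ perms n → Unique w
perms-entries-unique zero    (here ≡.refl) = []
perms-entries-unique (suc n) w∈ with ∈-perms⁻ n w∈
... | xs , ys , u∈ , ≡.refl = Perm↭-unique (↭-sym (Perm↭.shift n xs ys))
        (All.¬Any⇒All¬ _ (∉-perms n u∈) ∷ perms-entries-unique n u∈)
  where
  Perm↭-unique : ∀ {us vs : List ℕ} → us ↭ vs → Unique us → Unique vs
  Perm↭-unique p = PermS.Unique-resp-↭ (≡.setoid ℕ) (↭⇒↭ₛ p)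

differs? : ∀ a b → Dec (b ≢ a)
differs? a b = ¬? (b ℕ.≟ a)

remove : ℕ → List ℕ → List ℕ
remove a = filter (differs? a)

remove-absent : ∀ a {u} → a ∉ u → remove a u ≡ u
remove-absent a a∉ = filter-all (differs? a) (All.map (λ p e → p (≡.sym e)) (All.¬Any⇒All¬ _ a∉))

-- Deletion being a left inverse of insertion, the blocks that `concatMap` joins in `perms` are
-- disjoint.
remove-insertion : ∀ a {u w} → a ∉ u → w ∈ insertions a u → remove a w ≡ u
remove-insertion a {u} a∉ w∈ with ∈-insertions⁻ a u w∈
... | xs , ys , ≡.refl , ≡.refl = ≡.trans (filter-++ (differs? a) xs (a ∷ ys))
  (≡.trans (≡.cong (remove a xs ++_) (filter-reject (differs? a) (λ p → p ≡.refl)))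
  (≡.trans (≡.sym (filter-++ (differs? a) xs ys)) (remove-absent a a∉)))

insertions-unique : ∀ a {u} → a ∉ u → Unique (insertions a u)
insertions-unique a {[]}    _  = [] ∷ []
insertions-unique a {b ∷ u} a∉ =
  All.¬Any⇒All¬ _ (λ p → a∉ (here (head≡ p)))
  ∷ Unique.map⁺ (λ { ≡.refl → ≡.refl }) (insertions-unique a (a∉ ∘ there))
  where
  head≡ : a ∷ b ∷ u ∈ map (b ∷_) (insertions a u) → a ≡ b
  head≡ p with ∈-map⁻ (b ∷_) p
  ... | _ , _ , ≡.refl = ≡.refl

concatMap-insertions-unique : ∀ a {us} → Unique us → All (a ∉_) us → Unique (concatMap (insertions a) us)
concatMap-insertions-unique a []           []           = []
concatMap-insertions-unique a {u ∷ us} (u∉us ∷ uniq) (a∉u ∷ a∉us) =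
  Unique.++⁺ (insertions-unique a a∉u) (concatMap-insertions-unique a uniq a∉us)
    λ (w∈u , w∈us) → disjoint w∈u u∉us a∉us (∈-concatMap⁻ (insertions a) {xs = us} w∈us)
  where
  disjoint : ∀ {w vs} → w ∈ insertions a u → All (u ≢_) vs → All (a ∉_) vs →
             ¬ Any (λ v → w ∈ insertions a v) vs
  disjoint w∈u (u≢v ∷ _) (a∉v ∷ _) (here w∈v)  =
    u≢v (≡.trans (≡.sym (remove-insertion a a∉u w∈u)) (remove-insertion a a∉v w∈v))
  disjoint w∈u (_ ∷ ne)  (_ ∷ a∉) (there p)    = disjoint w∈u ne a∉ p

-- Ensures that a sum over `perms n` meets each basis element once, so that an element is recovered
-- from its coefficients.
perms-unique : ∀ n → Unique (perms n)
perms-unique zero    = [] ∷ []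
perms-unique (suc n) = concatMap-insertions-unique n (perms-unique n) (All.tabulate (∉-perms n))

Perm-unique : ∀ {n w} → Perm n w → Unique w
Perm-unique {n} p = perms-entries-unique n (Perm⇒∈perms n p)

Perm-upTo : ∀ n → Perm n (upTo n)
Perm-upTo n = mkPerm (length-upTo n) ∈-upTo⁺

Perm-sAct : ∀ {n i w} → suc i < n → Perm n w → Perm n (sAct (suc i) w)
Perm-sAct {n} {i} {w} i<n p = mkPerm (≡.trans (length-map _ w) (length≡ p))
  λ {a} a<n → ≡.subst (_∈ sAct (suc i) w) (swapV-involutive i a) (∈-map⁺ _ (covers p (swapV-< i<n a<n)))

Perm-swapP : ∀ {n} j {w} → Perm n w → Perm n (swapP j w)
Perm-swapP j {w} p = mkPerm (≡.trans (length-swapP j w) (length≡ p)) (∈-swapP j ∘ covers p)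

Perm-sAct⁻ : ∀ {n i w} → suc i < n → Perm n (sAct (suc i) w) → Perm n w
Perm-sAct⁻ {n} {i} {w} i<n p = ≡.subst (Perm n) (sAct-involutive i w) (Perm-sAct i<n p)

Perm-swapP⁻ : ∀ {n} j {w} → Perm n (swapP j w) → Perm n w
Perm-swapP⁻ {n} j {w} p = ≡.subst (Perm n) (swapP-involutive j w) (Perm-swapP j p)

perm? : ∀ n w → Dec (Perm n w)
perm? n w with w ∈? perms n
  where open import Data.List.Membership.DecPropositional (≡-dec ℕ._≟_) using (_∈?_)
... | yes p = yes (∈perms⇒Perm n p)
... | no ¬p = no (¬p ∘ Perm⇒∈perms n)

-- Reaching every permutation from the identity through right ascents

data AscendsTo (n : ℕ) : List ℕ → Set where
  start : AscendsTo n (upTo n)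
  step  : ∀ {w} j → AscendsTo n w → suc j < n → ascP j w ≡ true → AscendsTo n (swapP j w)

AscendsTo-Perm : ∀ {n w} → AscendsTo n w → Perm n w
AscendsTo-Perm {n} start = Perm-upTo n
AscendsTo-Perm (step j r _ _) = Perm-swapP j (AscendsTo-Perm r)

swapP-++ : ∀ j w {v} → suc j < length w → swapP j (w ++ v) ≡ swapP j w ++ v
swapP-++ zero    (a ∷ [])    (s≤s ())
swapP-++ zero    (a ∷ b ∷ l) _       = ≡.refl
swapP-++ (suc j) (a ∷ l)     (s≤s p) = ≡.cong (a ∷_) (swapP-++ j l p)

ascP-++ : ∀ j w {v} → suc j < length w → ascP j (w ++ v) ≡ ascP j w
ascP-++ zero    (a ∷ [])    (s≤s ())
ascP-++ zero    (a ∷ b ∷ l) _       = ≡.refl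
ascP-++ (suc j) (a ∷ l)     (s≤s p) = ascP-++ j l p

swapP-middle : ∀ xs {a b zs} → swapP (length xs) (xs ++ a ∷ b ∷ zs) ≡ xs ++ b ∷ a ∷ zs
swapP-middle []       = ≡.refl
swapP-middle (x ∷ xs) = ≡.cong (x ∷_) (swapP-middle xs)

ascP-middle : ∀ xs {a b zs} → ascP (length xs) (xs ++ a ∷ b ∷ zs) ≡ (a <ᵇ b)
ascP-middle []       = ≡.refl
ascP-middle (x ∷ xs) = ascP-middle xs

AscendsTo-∷ʳ : ∀ {n w} → AscendsTo n w → AscendsTo (suc n) (w ∷ʳ n)
AscendsTo-∷ʳ {n} start = ≡.subst (AscendsTo (suc n)) (≡.sym (upTo-∷ʳ n)) start
AscendsTo-∷ʳ {n} (step {w} j r j<n e) =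
  ≡.subst (AscendsTo (suc n)) (swapP-++ j w j<) (step j (AscendsTo-∷ʳ r) (ℕ.m≤n⇒m≤1+n j<n) (≡.trans (ascP-++ j w j<) e))
  where
  j< : suc j < length w
  j< = ≡.subst (suc j <_) (≡.sym (length≡ (AscendsTo-Perm r))) j<n

-- An entry larger than all of `ys` moves left through them by adjacent exchanges, each of which is
-- an ascent before it is made. With a the largest value this climbs from S_n through the cosets in
-- S_{n+1}.
AscendsTo-bubble : ∀ {m a} xs ys {zs} → All (_< a) ys → AscendsTo m (xs ++ ys ++ a ∷ zs) → AscendsTo m (xs ++ a ∷ ys ++ zs)
AscendsTo-bubble xs []       []         r = r
AscendsTo-bubble {m} {a} xs (y ∷ ys) {zs} (y<a ∷ ys<a) r =
  ≡.subst (AscendsTo m) (swapP-middle xs)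
    (step (length xs) r′ in-range (≡.trans (ascP-middle xs) (<ᵇ-true y<a)))
  where
  r′ : AscendsTo m (xs ++ y ∷ a ∷ ys ++ zs)
  r′ = ≡.subst (AscendsTo m) (++-assoc xs (y ∷ []) _)
         (AscendsTo-bubble (xs ∷ʳ y) ys ys<a (≡.subst (AscendsTo m) (≡.sym (++-assoc xs (y ∷ []) _)) r))
  in-range : suc (length xs) < m
  in-range = ≡.subst (suc (length xs) <_) (≡.trans (≡.sym (length-++ xs)) (length≡ (AscendsTo-Perm r′)))
    (≡.subst (suc (length xs) <_) (≡.sym (≡.trans (ℕ.+-suc (length xs) _) (≡.cong suc (ℕ.+-suc (length xs) _))))
      (s≤s (s≤s (ℕ.m≤m+n (length xs) _))))

perms-AscendsTo : ∀ n {w} → w ∈ perms n → AscendsTo n w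
perms-AscendsTo zero    (here ≡.refl) = start
perms-AscendsTo (suc n) w∈ with ∈-perms⁻ n w∈
... | xs , ys , u∈ , ≡.refl =
  ≡.subst (AscendsTo (suc n)) (≡.cong (λ zs → xs ++ n ∷ zs) (++-identityʳ ys))
    (AscendsTo-bubble xs ys (All.++⁻ʳ xs (perms-bounded n u∈))
      (≡.subst (AscendsTo (suc n)) (++-assoc xs ys (n ∷ [])) (AscendsTo-∷ʳ (perms-AscendsTo n u∈))))

-- Reduced words and the inversion count

data Reduced (n : ℕ) : List ℕ → List ℕ → Set where
  []   : Reduced n [] (upTo n)
  cons : ∀ {i is w} → suc i < n → asc (suc i) w ≡ true → Reduced n is w →
         Reduced n (suc i ∷ is) (sAct (suc i) w)

below : ℕ → List ℕ → ℕ
below x []      = 0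
below x (y ∷ l) = if y <ᵇ x then suc (below x l) else below x l

inversions : List ℕ → ℕ
inversions []      = 0
inversions (x ∷ l) = below x l +ℕ inversions l

below-swapP : ∀ x j l → below x (swapP j l) ≡ below x l
below-swapP x zero    []          = ≡.refl
below-swapP x (suc j) []          = ≡.refl
below-swapP x zero    (a ∷ [])    = ≡.refl
below-swapP x zero    (a ∷ b ∷ l) with a <ᵇ x | b <ᵇ x
... | true  | true  = ≡.refl
... | true  | false = ≡.refl
... | false | true  = ≡.refl
... | false | false = ≡.refl
below-swapP x (suc j) (a ∷ l) rewrite below-swapP x j l = ≡.refl

-- An adjacent exchange does not change which entries stand to the right of any third entry, so the
-- inversion between the two exchanged entries is the only one lost.
inversions-swapP : ∀ (f : ℕ → ℕ) n i → suc i < n → f (suc i) < f i →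
                   suc (inversions (swapP i (applyUpTo f n))) ≡ inversions (applyUpTo f n)
inversions-swapP f (suc zero)    zero (s≤s ()) _
inversions-swapP f (suc (suc n)) zero _ d
  rewrite <ᵇ-true d | <ᵇ-false (ℕ.<-asym d) =
  ≡.cong suc (+-exchange (below (f 1) l) (below (f 0) l) (inversions l))
  where
  l = applyUpTo (λ x → f (suc (suc x))) n
  +-exchange : ∀ a b c → a +ℕ (b +ℕ c) ≡ b +ℕ (a +ℕ c)
  +-exchange a b c = ≡.trans (≡.sym (ℕ.+-assoc a b c)) (≡.trans (≡.cong (_+ℕ c) (ℕ.+-comm a b)) (ℕ.+-assoc b a c))
inversions-swapP f (suc n) (suc i) (s≤s i<n) d
  rewrite below-swapP (f 0) i (applyUpTo (f ∘ suc) n) =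
  ≡.trans (≡.sym (ℕ.+-suc _ _)) (≡.cong (below (f 0) (applyUpTo (f ∘ suc) n) +ℕ_) (inversions-swapP (f ∘ suc) n i i<n d))

below≤ : ∀ x l → below x l ≤ length l
below≤ x []      = z≤n
below≤ x (y ∷ l) with y <ᵇ x
... | true  = s≤s (below≤ x l)
... | false = ℕ.m≤n⇒m≤1+n (below≤ x l)

-- The crude bound is chosen to match the fuel `n *ℕ n` of `redWord`.
inversions≤ : ∀ l → inversions l ≤ length l *ℕ length l
inversions≤ []      = z≤n
inversions≤ (x ∷ l) = ℕ.+-mono-≤ (ℕ.m≤n⇒m≤1+n (below≤ x l))
  (ℕ.≤-trans (inversions≤ l) (ℕ.*-monoʳ-≤ (length l) (ℕ.n≤1+n _)))

swapV-suc : ∀ i x → swapV (suc (suc i)) (suc x) ≡ suc (swapV (suc i) x)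
swapV-suc i x with swapView i x
... | lower rewrite swapV-lower i | swapV-lower (suc i) = ≡.refl
... | upper rewrite swapV-upper i | swapV-upper (suc i) = ≡.refl
... | other p r rewrite swapV-other i p r = swapV-other (suc i) (p ∘ ℕ.suc-injective) (r ∘ ℕ.suc-injective)

applyUpTo-cong : ∀ {A : Set} {f g : ℕ → A} n → (∀ a → a < n → f a ≡ g a) → applyUpTo f n ≡ applyUpTo g n
applyUpTo-cong zero    _ = ≡.refl
applyUpTo-cong (suc n) e = ≡.cong₂ _∷_ (e 0 (s≤s z≤n)) (applyUpTo-cong n (λ a a<n → e (suc a) (s≤s a<n)))

applyUpTo-swapV : ∀ (f : ℕ → ℕ) n i → suc i < n → applyUpTo (f ∘ swapV (suc i)) n ≡ swapP i (applyUpTo f n)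
applyUpTo-swapV f (suc zero)    zero (s≤s ())
applyUpTo-swapV f (suc (suc n)) zero    _ = ≡.refl
applyUpTo-swapV f (suc n)       (suc i) (s≤s i<n) = ≡.cong (f 0 ∷_)
  (≡.trans (applyUpTo-cong n (λ x _ → ≡.cong f (swapV-suc i x))) (applyUpTo-swapV (f ∘ suc) n i i<n))

-- The number of inversions of w⁻¹, given as the list of positions of 0,…,n-1 in w.
invCount : ℕ → List ℕ → ℕ
invCount n w = inversions (applyUpTo (λ a → idx a w) n)

invCount-sAct : ∀ n i w → suc i < n → idx (suc i) w < idx i w → suc (invCount n (sAct (suc i) w)) ≡ invCount n w
invCount-sAct n i w i<n d =
  ≡.trans (≡.cong (suc ∘ inversions) (≡.trans (applyUpTo-cong n (λ a _ → idx-sAct i a w))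
                                        (applyUpTo-swapV (λ a → idx a w) n i i<n)))
        (inversions-swapP (λ a → idx a w) n i i<n d)

invCount≤ : ∀ n w → invCount n w ≤ n *ℕ n
invCount≤ n w = ≡.subst (λ m → invCount n w ≤ m *ℕ m) (length-applyUpTo (λ a → idx a w) n) (inversions≤ (applyUpTo (λ a → idx a w) n))

increasing-bounded⇒id : ∀ n (p : ℕ → ℕ) → (∀ i → suc i < n → p i < p (suc i)) → (∀ a → a < n → p a < n) →
                        ∀ a → a < n → p a ≡ a
increasing-bounded⇒id n p inc bnd a a<n = ℕ.≤-antisym below-diagonal (above a a<n)
  where
  above : ∀ a → a < n → a ≤ p a
  above zero    _   = z≤n
  above (suc a) a<n = ℕ.≤-<-trans (above a (ℕ.<-trans (ℕ.n<1+n a) a<n)) (inc a a<n)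
  -- The d values of p after a increase strictly above p a and must still fit below n.
  room : ∀ d a → suc a +ℕ d ≡ n → p a +ℕ d < n
  room zero    a e = ≡.subst (_< n) (≡.sym (ℕ.+-identityʳ (p a))) (bnd a (≡.subst (a <_) (≡.trans (≡.sym (ℕ.+-identityʳ (suc a))) e) (ℕ.n<1+n a)))
  room (suc d) a e = ℕ.≤-<-trans
    (≡.subst (_≤ p (suc a) +ℕ d) (≡.sym (ℕ.+-suc (p a) d)) (ℕ.+-monoˡ-≤ d (inc a (≡.subst (suc a <_) e (ℕ.m<m+n (suc a) (s≤s z≤n))))))
    (room d (suc a) (≡.trans (≡.cong suc (≡.sym (ℕ.+-suc a d))) e))
  below-diagonal : p a ≤ a
  below-diagonal = s≤s⁻¹ (ℕ.+-cancelʳ-≤ (n ∸ suc a) (suc (p a)) (suc a)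
    (≡.subst (p a +ℕ (n ∸ suc a) <_) (≡.sym (ℕ.m+[n∸m]≡n a<n)) (room (n ∸ suc a) a (ℕ.m+[n∸m]≡n a<n))))

-- Stated for a general f in place of the identity so that the tail falls under the same statement
-- with `f ∘ suc`.
idx-id⇒applyUpTo : ∀ (f : ℕ → ℕ) w → (∀ a → a < length w → idx (f a) w ≡ a) → w ≡ applyUpTo f (length w)
idx-id⇒applyUpTo f []      _ = ≡.refl
idx-id⇒applyUpTo f (b ∷ w) h with f 0 ℕ.≟ b | h 0 (s≤s z≤n)
... | no f0≢b  | h₀ with () ← ≡.trans (≡.sym (idx-there w f0≢b)) h₀
... | yes ≡.refl | h₀ = ≡.cong (f 0 ∷_) (idx-id⇒applyUpTo (f ∘ suc) w rest)
  where
  rest : ∀ a → a < length w → idx (f (suc a)) w ≡ a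
  rest a a< with f (suc a) ℕ.≟ b | h (suc a) (s≤s a<)
  ... | yes e | h′ with () ← ≡.trans (≡.sym (≡.subst (λ c → idx c (b ∷ w) ≡ 0) (≡.sym e) (idx-here b w))) h′
  ... | no ne | h′ = ℕ.suc-injective (≡.trans (≡.sym (idx-there w ne)) h′)

data FirstDescentSpec (w : List ℕ) (m : ℕ) : MaybeN → Set where
  noDescent : (∀ i → suc i < m → asc (suc i) w ≡ true) → FirstDescentSpec w m none
  descentAt : ∀ i → suc i < m → asc (suc i) w ≡ false → FirstDescentSpec w m (some (suc i))

-- Reads the result of the anonymous loop in `firstDescent` off the type of its specification, which
-- gives `with` a term to abstract.
value : ∀ {w m r} → FirstDescentSpec w m r → MaybeN
value {r = r} _ = r

castSpec : ∀ {w m n r} → m ≡ n → FirstDescentSpec w m r → FirstDescentSpec w n r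
castSpec ≡.refl s = s

-- The loop inside firstDescent has no name outside Defs.  The underscore in the
-- type of go-spec stands for it and is solved from the goal of firstDescent-spec,
-- where the outer argument is generalised to n.
firstDescent-spec : ∀ n w → FirstDescentSpec w n (firstDescent n w)
go-spec : ∀ n w m → FirstDescentSpec w (suc m) _

firstDescent-spec zero    w = noDescent λ i ()
firstDescent-spec (suc m) w with suc m in eq
... | n = castSpec eq (go-spec n w m)

go-spec n w zero = noDescent λ { _ (s≤s ()) }
go-spec n w (suc m) with value (go-spec n w m) | go-spec n w m
... | some _ | descentAt i i<m d = descentAt i (ℕ.m≤n⇒m≤1+n i<m) d
... | none | noDescent a with asc (suc m) w in eq
... | false = descentAt m ℕ.≤-refl eq
... | true  = noDescent λ i i<m → [ a i , (λ e → ≡.subst (λ j → asc j w ≡ true) (≡.sym e) eq) ]′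
                                 (ℕ.m≤n⇒m<n∨m≡n (s≤s⁻¹ i<m))

noDescent⇒upTo : ∀ {n w} → Perm n w → (∀ i → suc i < n → asc (suc i) w ≡ true) → w ≡ upTo n
noDescent⇒upTo {n} {w} p a = ≡.trans
  (idx-id⇒applyUpTo id w λ b b< → increasing-bounded⇒id n (λ c → idx c w)
    (λ i i<n → <ᵇ-true⁻ (a i i<n))
    (λ c c<n → ≡.subst (idx c w <_) (length≡ p) (idx-< (covers p c<n)))
    b (≡.subst (b <_) (length≡ p) b<))
  (≡.cong upTo (length≡ p))

descent⇒< : ∀ {n i w} → Perm n w → suc i < n → asc (suc i) w ≡ false → idx (suc i) w < idx i w
descent⇒< {i = i} p i<n e = ℕ.≤∧≢⇒< (ℕ.≮⇒≥ (<ᵇ-false⁻ e)) λ eq → ℕ.1+n≢n (idx-injective (covers p i<n) eq)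

descent⇒ascent : ∀ {n i w} → Perm n w → suc i < n → asc (suc i) w ≡ false → asc (suc i) (sAct (suc i) w) ≡ true
descent⇒ascent {i = i} {w} p i<n e = ≡.trans (asc-sAct i w) (<ᵇ-true (descent⇒< p i<n e))

-- Each letter taken lowers `invCount` by one, so fuel bounding it cannot run out while a descent
-- remains; a permutation without descents is the identity.
redWordF-reduced : ∀ n fuel w → Perm n w → invCount n w ≤ fuel → Reduced n (redWordF n fuel w) w
redWordF-reduced n zero w p inv≤ with firstDescent n w | firstDescent-spec n w
... | none   | noDescent a = ≡.subst (Reduced n []) (≡.sym (noDescent⇒upTo p a)) []
... | some _ | descentAt i i<n d
  with () ← ≡.subst (_≤ 0) (≡.sym (invCount-sAct n i w i<n (descent⇒< p i<n d))) inv≤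
redWordF-reduced n (suc fuel) w p inv≤ with firstDescent n w | firstDescent-spec n w
... | none   | noDescent a = ≡.subst (Reduced n []) (≡.sym (noDescent⇒upTo p a)) []
... | some _ | descentAt i i<n d =
  ≡.subst (Reduced n (suc i ∷ redWordF n fuel (sAct (suc i) w))) (sAct-involutive i w)
    (cons i<n (descent⇒ascent p i<n d)
      (redWordF-reduced n fuel (sAct (suc i) w) (Perm-sAct i<n p)
        (s≤s⁻¹ (≡.subst (_≤ suc fuel) (≡.sym (invCount-sAct n i w i<n (descent⇒< p i<n d))) inv≤))))

redWord-reduced : ∀ {n w} → Perm n w → Reduced n (redWord n w) w
redWord-reduced {n} {w} p = redWordF-reduced n (n *ℕ n) w p (invCount≤ n w)

-- The palindrome s_{a+D+1} ⋯ s_{a+2} s_{a+1} s_{a+2} ⋯ s_{a+D+1} of the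
-- transposition (a+1, a+D+2) is down a D ++ up (suc a) D.

up : ℕ → ℕ → List ℕ
up i zero    = i ∷ []
up i (suc d) = i ∷ up (suc i) d

down : ℕ → ℕ → List ℕ
down a zero    = []
down a (suc d) = suc (suc a +ℕ d) ∷ down a d

up-∷ʳ : ∀ i d → up i (suc d) ≡ up i d ∷ʳ (i +ℕ suc d)
up-∷ʳ i zero    = ≡.cong (λ j → i ∷ j ∷ []) (≡.sym (ℕ.+-comm i 1))
up-∷ʳ i (suc d) = ≡.cong (i ∷_) (≡.trans (up-∷ʳ (suc i) d) (≡.cong (up (suc i) d ∷ʳ_) (≡.sym (ℕ.+-suc i (suc d)))))

-- The Hecke algebra as a ring

idx-applyUpTo : ∀ (f : ℕ → ℕ) n {a} → (∀ {b c} → f b ≡ f c → b ≡ c) → a < n → idx (f a) (applyUpTo f n) ≡ a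
idx-applyUpTo f (suc n) {zero}  inj _ = idx-here (f 0) (applyUpTo (f ∘ suc) n)
idx-applyUpTo f (suc n) {suc a} inj (s≤s a<n) = ≡.trans
  (idx-there (applyUpTo (f ∘ suc) n) (λ e → ℕ.1+n≢0 (inj e)))
  (≡.cong suc (idx-applyUpTo (f ∘ suc) n (ℕ.suc-injective ∘ inj) a<n))

idx-upTo : ∀ {n a} → a < n → idx a (upTo n) ≡ a
idx-upTo {n} = idx-applyUpTo id n id

swapV-braid : ∀ i v → swapV (suc i) (swapV (suc (suc i)) (swapV (suc i) v))
                    ≡ swapV (suc (suc i)) (swapV (suc i) (swapV (suc (suc i)) v))
swapV-braid i v with swapView i v
... | lower rewrite swapV-lower i | swapV-lower (suc i) | swapV-other (suc i) (ℕ.1+n≢n {i} ∘ ≡.sym) (ℕ.<⇒≢ (ℕ.m≤n⇒m≤1+n (ℕ.n<1+n i)))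
                  | swapV-lower i | swapV-lower (suc i)
                  = swapV-other i (ℕ.<⇒≢ (ℕ.m≤n⇒m≤1+n (ℕ.n<1+n i)) ∘ ≡.sym) ℕ.1+n≢n
... | upper rewrite swapV-upper i | swapV-lower (suc i) | swapV-other (suc i) (ℕ.1+n≢n {i} ∘ ≡.sym) (ℕ.<⇒≢ (ℕ.m≤n⇒m≤1+n (ℕ.n<1+n i)))
                  | swapV-other i (ℕ.<⇒≢ (ℕ.m≤n⇒m≤1+n (ℕ.n<1+n i)) ∘ ≡.sym) (ℕ.1+n≢n {suc i})
                  | swapV-upper (suc i) = swapV-lower i
... | other p r rewrite swapV-other i p r with swapView (suc i) v
...   | lower = contradiction ≡.refl r
...   | upper rewrite swapV-upper (suc i) | swapV-upper i
                  = ≡.sym (swapV-other (suc i) (ℕ.1+n≢n {i} ∘ ≡.sym) (ℕ.<⇒≢ (ℕ.m≤n⇒m≤1+n (ℕ.n<1+n i))))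
...   | other p′ r′ rewrite swapV-other (suc i) p′ r′ | swapV-other i p r = ≡.sym (swapV-other (suc i) p′ r′)

swapV-comm : ∀ {i j} → suc i < j → ∀ v → swapV (suc i) (swapV (suc j) v) ≡ swapV (suc j) (swapV (suc i) v)
swapV-comm {i} {j} i<j v with swapView i v | swapView j v
... | lower | lower = contradiction ≡.refl (ℕ.<⇒≢ (ℕ.<-trans (ℕ.n<1+n i) i<j))
... | lower | upper = contradiction ≡.refl (ℕ.<⇒≢ (ℕ.<-trans (ℕ.n<1+n _) (ℕ.<-trans (ℕ.n<1+n _) i<j)))
... | upper | lower = contradiction ≡.refl (ℕ.<⇒≢ i<j)
... | upper | upper = contradiction ≡.refl (ℕ.<⇒≢ (ℕ.<-trans (ℕ.n<1+n _) i<j))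
... | lower | other p r rewrite swapV-other j p r | swapV-lower i
    = ≡.sym (swapV-other j (ℕ.<⇒≢ i<j) (ℕ.<⇒≢ (ℕ.m≤n⇒m≤1+n i<j)))
... | upper | other p r rewrite swapV-other j p r | swapV-upper i
    = ≡.sym (swapV-other j (ℕ.<⇒≢ (ℕ.<-trans (ℕ.n<1+n i) i<j)) (ℕ.<⇒≢ (ℕ.m≤n⇒m≤1+n (ℕ.<-trans (ℕ.n<1+n i) i<j))))
... | other p r | lower rewrite swapV-other i p r | swapV-lower j
    = swapV-other i (ℕ.<⇒≢ (ℕ.m≤n⇒m≤1+n (ℕ.<-trans (ℕ.n<1+n i) i<j)) ∘ ≡.sym) (ℕ.<⇒≢ (ℕ.m≤n⇒m≤1+n i<j) ∘ ≡.sym)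
... | other p r | upper rewrite swapV-other i p r | swapV-upper j
    = swapV-other i (ℕ.<⇒≢ (ℕ.<-trans (ℕ.n<1+n i) i<j) ∘ ≡.sym) (ℕ.<⇒≢ i<j ∘ ≡.sym)
... | other p r | other p′ r′ rewrite swapV-other j p′ r′ | swapV-other i p r = ≡.sym (swapV-other j p′ r′)

-- slot is a is the position of a in s_{i₁} ⋯ s_{iᵣ}, for is = i₁ ⋯ iᵣ.
slot : List ℕ → ℕ → ℕ
slot []       a = a
slot (i ∷ is) a = slot is (swapV i a)

idx-slot : ∀ {n is w a} → Reduced n is w → a < n → idx a w ≡ slot is a
idx-slot []                          a<n = idx-upTo a<n
idx-slot {a = a} (cons {i} {is} {w} i<n up r) a<n = ≡.trans (idx-sAct i a w) (idx-slot r (swapV-< i<n a<n))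

-- Replaces the ascent test on the list w by a comparison of two slots, which can be computed in
-- closed form for an explicit word even when n is a variable.
extend : ∀ {n is w a b} i → suc i < n → Reduced n is w → slot is i ≡ a → slot is (suc i) ≡ b → a < b →
         Reduced n (suc i ∷ is) (sAct (suc i) w)
extend {n} i i<n r ≡.refl ≡.refl a<b = cons i<n
  (<ᵇ-true (≡.subst₂ _<_ (≡.sym (idx-slot r (ℕ.<-trans (ℕ.n<1+n i) i<n))) (≡.sym (idx-slot r i<n)) a<b)) r

module HeckeRing {c ℓ} (R : CommutativeRing c ℓ) (q : CommutativeRing.Carrier R) (n : ℕ) where
  open CommutativeRing R hiding (ring; zero)
  open Hecke rawRing q n
  open import Relation.Binary.Reasoning.Setoid setoid
  open import Algebra.Properties.CommutativeSemigroup +-commutativeSemigroup using (interchange)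
  open import Algebra.Properties.CommutativeSemigroup *-commutativeSemigroup
    using () renaming (x∙yz≈y∙xz to *-exchange)

  -- `⊗` sums over permutations only, so a value off S_n would be lost under multiplication by 1;
  -- the functions vanishing there are the actual elements of the algebra.
  Supported : H → Set ℓ
  Supported x = ∀ w → ¬ Perm n w → x w ≈ 0#

  Tr : ℕ → H → H
  Tr j x w = if ascP j w then q * x (swapP j w) else x (swapP j w) + (q + - 1#) * x w

  -- Both Tl and Tr are of the form w ↦ twist (is w an ascent?) (x (w moved)) (x w).
  twist : Bool → Carrier → Carrier → Carrier
  twist b u v = if b then q * u else u + (q + - 1#) * v

  twist-cong : ∀ b {u u′ v v′} → u ≈ u′ → v ≈ v′ → twist b u v ≈ twist b u′ v′
  twist-cong true  p r = *-congˡ p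
  twist-cong false p r = +-cong p (*-congˡ r)

  twist-0 : ∀ b {u v} → u ≈ 0# → v ≈ 0# → twist b u v ≈ 0#
  twist-0 true  p r = trans (*-congˡ p) (zeroʳ q)
  twist-0 false p r = trans (+-cong p (trans (*-congˡ r) (zeroʳ _))) (+-identityˡ 0#)

  twist-+ : ∀ b u u′ v v′ → twist b (u + u′) (v + v′) ≈ twist b u v + twist b u′ v′
  twist-+ true  u u′ v v′ = distribˡ q u u′
  twist-+ false u u′ v v′ = trans (+-congˡ (distribˡ _ v v′)) (interchange u u′ _ _)

  twist-* : ∀ b r u v → twist b (r * u) (r * v) ≈ r * twist b u v
  twist-* true  r u v = *-exchange q r u
  twist-* false r u v = trans (+-congˡ (*-exchange _ r v)) (sym (distribˡ r u _))

  -- The last four arguments are the coefficients at the corners s w t, s w, w t, w of a square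
  -- whose two directions are left and right multiplication by s and t.
  twist-comm : ∀ a b s t u v → twist a (twist b s t) (twist b u v) ≈ twist b (twist a s u) (twist a t v)
  twist-comm true  true  s t u v = refl
  twist-comm true  false s t u v = trans (distribˡ q s _) (+-congˡ (*-exchange q _ t))
  twist-comm false true  s t u v = sym (trans (distribˡ q s _) (+-congˡ (*-exchange q _ u)))
  twist-comm false false s t u v = begin
    (s + p * t) + p * (u + p * v)         ≈⟨ +-congˡ (distribˡ p u _) ⟩
    (s + p * t) + (p * u + p * (p * v))   ≈⟨ interchange s _ _ _ ⟩
    (s + p * u) + (p * t + p * (p * v))   ≈⟨ +-congˡ (distribˡ p t _) ⟨
    (s + p * u) + p * (t + p * v)         ∎
    where p = q + - 1#

  -- Linear endomorphisms of H_n as a right module over itself. The right action is given by `Tr`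
  -- alone, so the notion is available before anything is known about `⊗`.
  record Equivariant (Θ : H → H) : Set (c ⊔ ℓ) where
    field
      cong       : ∀ {x y} → x ≈H y → Θ x ≈H Θ y
      ⊕-homo     : ∀ x y → Θ (x ⊕ y) ≈H Θ x ⊕ Θ y
      ·-homo     : ∀ r x → Θ (r · x) ≈H r · Θ x
      supported  : ∀ {x} → Supported x → Supported (Θ x)
      commutes   : ∀ j {x} → Supported x → Θ (Tr j x) ≈H Tr j (Θ x)
  open Equivariant

  Tr-cong : ∀ j {x y} → x ≈H y → Tr j x ≈H Tr j y
  Tr-cong j p w = twist-cong (ascP j w) (p (swapP j w)) (p w)

  Tr-supported : ∀ j {x} → Supported x → Supported (Tr j x)
  Tr-supported j p w ¬w = twist-0 (ascP j w) (p _ (¬w ∘ Perm-swapP⁻ j)) (p w ¬w)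

  Tl-supported : ∀ {i x} → suc i < n → Supported x → Supported (Tl (suc i) x)
  Tl-supported {i} i<n p w ¬w = twist-0 (asc (suc i) w) (p _ (¬w ∘ Perm-sAct⁻ i<n)) (p w ¬w)

  Tl-cong : ∀ i {x y} → x ≈H y → Tl i x ≈H Tl i y
  Tl-cong i p w = twist-cong (asc i w) (p (sAct i w)) (p w)

  Tl-commutes-Tr : ∀ {i} j {x} → suc i < n → Supported x → Tl (suc i) (Tr j x) ≈H Tr j (Tl (suc i) x)
  Tl-commutes-Tr {i} j {x} i<n supp w with perm? n w
  ... | no ¬w = trans (Tl-supported i<n (Tr-supported j supp) w ¬w) (sym (Tr-supported j (Tl-supported i<n supp) w ¬w))
  ... | yes p with interaction i j (Perm-unique p)
  ...   | independent e₁ e₂ rewrite e₁ | e₂ | map-swapP (swapV (suc i)) j w =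
          twist-comm (asc (suc i) w) (ascP j w) _ _ _ _
  -- Here s_{i+1} w = w s_{j+1} and the two ascent conditions agree, so both composites read the
  -- same coefficients with the same cases and become identical.
  ...   | coincident _ _ e₁ e₂ e₃ e₄ rewrite e₃ | e₄ | e₂ | e₁
          | swapP-involutive j w | ≡.trans (≡.cong (sAct (suc i)) (≡.sym e₁)) (sAct-involutive i w) = refl

  equivariant-id : Equivariant id
  equivariant-id .cong p = p
  equivariant-id .⊕-homo x y w = refl
  equivariant-id .·-homo r x w = refl
  equivariant-id .supported p = p
  equivariant-id .commutes j _ w = refl

  equivariant-Tl : ∀ {i} → suc i < n → Equivariant (Tl (suc i))
  equivariant-Tl {i} i<n .cong p = Tl-cong (suc i) p
  equivariant-Tl {i} i<n .⊕-homo x y w = twist-+ (asc (suc i) w) _ _ _ _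
  equivariant-Tl {i} i<n .·-homo r x w = twist-* (asc (suc i) w) r _ _
  equivariant-Tl {i} i<n .supported = Tl-supported i<n
  equivariant-Tl {i} i<n .commutes j = Tl-commutes-Tr j i<n

  equivariant-∘ : ∀ {Θ Φ} → Equivariant Θ → Equivariant Φ → Equivariant (Θ ∘ Φ)
  equivariant-∘ a b .cong p = a .cong (b .cong p)
  equivariant-∘ a b .⊕-homo x y w = trans (a .cong (b .⊕-homo x y) w) (a .⊕-homo _ _ w)
  equivariant-∘ a b .·-homo r x w = trans (a .cong (b .·-homo r x) w) (a .·-homo r _ w)
  equivariant-∘ a b .supported = a .supported ∘ b .supported
  equivariant-∘ a b .commutes j p w = trans (a .cong (b .commutes j p) w) (a .commutes j (b .supported p) w)

  equivariant-0 : Equivariant (λ _ → 0H)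
  equivariant-0 .cong p w = refl
  equivariant-0 .⊕-homo x y w = sym (+-identityˡ 0#)
  equivariant-0 .·-homo r x w = sym (zeroʳ r)
  equivariant-0 .supported _ w _ = refl
  equivariant-0 .commutes j _ w = sym (twist-0 (ascP j w) refl refl)

  equivariant-⊕ : ∀ {Θ Φ} → Equivariant Θ → Equivariant Φ → Equivariant (λ x → Θ x ⊕ Φ x)
  equivariant-⊕ a b .cong p w = +-cong (a .cong p w) (b .cong p w)
  equivariant-⊕ a b .⊕-homo x y w = trans (+-cong (a .⊕-homo x y w) (b .⊕-homo x y w)) (interchange _ _ _ _)
  equivariant-⊕ a b .·-homo r x w = trans (+-cong (a .·-homo r x w) (b .·-homo r x w)) (sym (distribˡ r _ _))
  equivariant-⊕ a b .supported p w ¬w = trans (+-cong (a .supported p w ¬w) (b .supported p w ¬w)) (+-identityˡ 0#)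
  equivariant-⊕ a b .commutes j p w =
    trans (+-cong (a .commutes j p w) (b .commutes j p w)) (sym (twist-+ (ascP j w) _ _ _ _))

  equivariant-· : ∀ r {Θ} → Equivariant Θ → Equivariant (λ x → r · Θ x)
  equivariant-· r a .cong p w = *-congˡ (a .cong p w)
  equivariant-· r a .⊕-homo x y w = trans (*-congˡ (a .⊕-homo x y w)) (distribˡ r _ _)
  equivariant-· r a .·-homo s x w = trans (*-congˡ (a .·-homo s x w)) (*-exchange r s _)
  equivariant-· r a .supported p w ¬w = trans (*-congˡ (a .supported p w ¬w)) (zeroʳ r)
  equivariant-· r a .commutes j p w = trans (*-congˡ (a .commutes j p w)) (sym (twist-* (ascP j w) r _ _))

  reduced-equivariant : ∀ {is w} → Reduced n is w → Equivariant (Lword is)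
  reduced-equivariant []             = equivariant-id
  reduced-equivariant (cons i<n _ r) = equivariant-∘ (equivariant-Tl i<n) (reduced-equivariant r)

  leftMult-equivariant : ∀ (x : H) {ws} → All (Perm n) ws →
    Equivariant (λ y u → sumC (map (λ w → x w * Lword (redWord n w) y u) ws))
  leftMult-equivariant x []       = equivariant-0
  leftMult-equivariant x {w ∷ ws} (p ∷ ps) =
    equivariant-⊕ (equivariant-· (x w) (reduced-equivariant (redWord-reduced p))) (leftMult-equivariant x ps)

  perms-Perm : All (Perm n) (perms n)
  perms-Perm = All.tabulate (∈perms⇒Perm n)

  ⊗-equivariant : ∀ x → Equivariant (x ⊗_)
  ⊗-equivariant x = leftMult-equivariant x perms-Perm

  T-same : ∀ w → T[ w ] w ≡ 1#
  T-same w rewrite ==L-refl w = ≡.refl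

  T-≢ : ∀ {v w} → v ≢ w → T[ v ] w ≡ 0#
  T-≢ ne rewrite ==L-≢ ne = ≡.refl

  T-supported : ∀ {v} → Perm n v → Supported T[ v ]
  T-supported {v} p w ¬w = reflexive (T-≢ {v} {w} λ { ≡.refl → ¬w p })

  1H-supported : Supported 1H
  1H-supported = T-supported (Perm-upTo n)

  -- Compared at one list at a time: at w, an ascent, only the zero coefficient at s w is read; at s
  -- w, a descent, the coefficient 1 at w is picked up; elsewhere both coefficients read are 0.
  Tl-ascent : ∀ i w → asc (suc i) w ≡ true → Tl (suc i) T[ w ] ≈H T[ sAct (suc i) w ]
  Tl-ascent i w up v with ≡-dec ℕ._≟_ v w | ≡-dec ℕ._≟_ v (sAct (suc i) w)
  ... | yes ≡.refl | _ rewrite up = begin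
      q * T[ w ] (sAct (suc i) w)   ≈⟨ *-congˡ (reflexive (T-≢ {w} w≢sw)) ⟩
      q * 0#                        ≈⟨ zeroʳ q ⟩
      0#                            ≡⟨ T-≢ (w≢sw ∘ ≡.sym) ⟨
      T[ sAct (suc i) w ] w         ∎
    where
    w≢sw : w ≢ sAct (suc i) w
    w≢sw e with () ← ≡.trans (≡.sym up) (≡.trans (≡.cong (asc (suc i)) e) (asc-sAct-ascent i w up))
  ... | no v≢w | yes ≡.refl rewrite asc-sAct-ascent i w up | sAct-involutive i w = begin
      T[ w ] w + (q + - 1#) * T[ w ] (sAct (suc i) w)  ≈⟨ +-cong (reflexive (T-same w))
                                                           (trans (*-congˡ (reflexive (T-≢ {w} (v≢w ∘ ≡.sym)))) (zeroʳ _)) ⟩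
      1# + 0#                                          ≈⟨ +-identityʳ 1# ⟩
      1#                                               ≡⟨ T-same (sAct (suc i) w) ⟨
      T[ sAct (suc i) w ] (sAct (suc i) w)             ∎
  ... | no v≢w | no v≢sw = trans
      (twist-0 (asc (suc i) v)
        (reflexive (T-≢ {w} λ e → v≢sw (≡.trans (≡.sym (sAct-involutive i v)) (≡.cong (sAct (suc i)) (≡.sym e)))))
        (reflexive (T-≢ {w} (v≢w ∘ ≡.sym))))
      (reflexive (≡.sym (T-≢ (v≢sw ∘ ≡.sym))))

  Tr-ascent : ∀ j w → suc j < length w → ascP j w ≡ true → Tr j T[ w ] ≈H T[ swapP j w ]
  Tr-ascent j w j< up v with ≡-dec ℕ._≟_ v w | ≡-dec ℕ._≟_ v (swapP j w)
  ... | yes ≡.refl | _ rewrite up = begin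
      q * T[ w ] (swapP j w)   ≈⟨ *-congˡ (reflexive (T-≢ {w} w≢sw)) ⟩
      q * 0#                        ≈⟨ zeroʳ q ⟩
      0#                            ≡⟨ T-≢ (w≢sw ∘ ≡.sym) ⟨
      T[ swapP j w ] w         ∎
    where
    w≢sw : w ≢ swapP j w
    w≢sw e with () ← ≡.trans (≡.sym up) (≡.trans (≡.cong (ascP j) e) (ascP-swapP j w j< up))
  ... | no v≢w | yes ≡.refl rewrite ascP-swapP j w j< up | swapP-involutive j w = begin
      T[ w ] w + (q + - 1#) * T[ w ] (swapP j w)       ≈⟨ +-cong (reflexive (T-same w))
                                                           (trans (*-congˡ (reflexive (T-≢ {w} (v≢w ∘ ≡.sym)))) (zeroʳ _)) ⟩
      1# + 0#                                          ≈⟨ +-identityʳ 1# ⟩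
      1#                                               ≡⟨ T-same (swapP j w) ⟨
      T[ swapP j w ] (swapP j w)             ∎
  ... | no v≢w | no v≢sw = trans
      (twist-0 (ascP j v)
        (reflexive (T-≢ {w} λ e → v≢sw (≡.trans (≡.sym (swapP-involutive j v)) (≡.cong (swapP j) (≡.sym e)))))
        (reflexive (T-≢ {w} (v≢w ∘ ≡.sym))))
      (reflexive (≡.sym (T-≢ (v≢sw ∘ ≡.sym))))

  -- Takes the place of Matsumoto's theorem: the product along any reduced word is the basis element
  -- itself, hence does not depend on the word.
  Tword-reduced : ∀ {is w} → Reduced n is w → Tword is ≈H T[ w ]
  Tword-reduced []              w = refl
  Tword-reduced (cons {i} {w = v} i<n up r) w = trans (Tl-cong (suc i) (Tword-reduced r) w) (Tl-ascent i v up w)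

  sumC-cong : ∀ {f g : List ℕ → Carrier} ws → (∀ w → f w ≈ g w) → sumC (map f ws) ≈ sumC (map g ws)
  sumC-cong []       e = refl
  sumC-cong (w ∷ ws) e = +-cong (e w) (sumC-cong ws e)

  sumC-+ : ∀ (f g : List ℕ → Carrier) ws → sumC (map (λ w → f w + g w) ws) ≈ sumC (map f ws) + sumC (map g ws)
  sumC-+ f g []       = sym (+-identityˡ 0#)
  sumC-+ f g (w ∷ ws) = trans (+-congˡ (sumC-+ f g ws)) (interchange _ _ _ _)

  sumC-* : ∀ r (f : List ℕ → Carrier) ws → sumC (map (λ w → r * f w) ws) ≈ r * sumC (map f ws)
  sumC-* r f []       = sym (zeroʳ r)
  sumC-* r f (w ∷ ws) = trans (+-congˡ (sumC-* r f ws)) (sym (distribˡ r _ _))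

  sumC-absent : ∀ (f : H) {v ws} → v ∉ ws → sumC (map (λ w → f w * T[ w ] v) ws) ≈ 0#
  sumC-absent f {v} {[]}     _  = refl
  sumC-absent f {v} {w ∷ ws} v∉ = trans (+-cong
      (trans (*-congˡ (reflexive (T-≢ {w} {v} λ e → v∉ (here (≡.sym e))))) (zeroʳ _))
      (sumC-absent f (v∉ ∘ there))) (+-identityˡ 0#)

  sumC-present : ∀ (f : H) {v ws} → Unique ws → v ∈ ws → sumC (map (λ w → f w * T[ w ] v) ws) ≈ f v
  sumC-present f {v} (v∉ ∷ _) (here ≡.refl) = trans (+-cong
      (trans (*-congˡ (reflexive (T-same v))) (*-identityʳ _))
      (sumC-absent f (All.All¬⇒¬Any v∉))) (+-identityʳ _)
  sumC-present f {v} {w ∷ ws} (w∉ ∷ u) (there p) = trans (+-cong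
      (trans (*-congˡ (reflexive (T-≢ {w} {v} λ { ≡.refl → All.All¬⇒¬Any w∉ p }))) (zeroʳ _))
      (sumC-present f u p)) (+-identityˡ _)

  expansion : H → List (List ℕ) → H
  expansion y ws v = sumC (map (λ w → y w * T[ w ] v) ws)

  expand : ∀ {y} → Supported y → expansion y (perms n) ≈H y
  expand {y} supp v with perm? n v
  ... | yes p = sumC-present y (perms-unique n) (Perm⇒∈perms n p)
  ... | no ¬p = trans (sumC-absent y {v} (¬p ∘ ∈perms⇒Perm n)) (sym (supp v ¬p))

  -- Along an ascent the next basis element is `Tr j` of the previous one, and `Tr j` can be pulled
  -- out of both operators.
  AscendsTo-determined : ∀ {Θ Φ} → Equivariant Θ → Equivariant Φ → Θ 1H ≈H Φ 1H →
                         ∀ {w} → AscendsTo n w → Θ T[ w ] ≈H Φ T[ w ]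
  AscendsTo-determined a b e start = e
  AscendsTo-determined {Θ} {Φ} a b e (step {w} j r j<n up) v = begin
      Θ T[ swapP j w ] v   ≈⟨ a .cong (Tr-ascent j w j< up) v ⟨
      Θ (Tr j T[ w ]) v    ≈⟨ a .commutes j supp v ⟩
      Tr j (Θ T[ w ]) v    ≈⟨ Tr-cong j (AscendsTo-determined a b e r) v ⟩
      Tr j (Φ T[ w ]) v    ≈⟨ b .commutes j supp v ⟨
      Φ (Tr j T[ w ]) v    ≈⟨ b .cong (Tr-ascent j w j< up) v ⟩
      Φ T[ swapP j w ] v   ∎
    where
    supp = T-supported (AscendsTo-Perm r)
    j< : suc j < length w
    j< = ≡.subst (suc j <_) (≡.sym (length≡ (AscendsTo-Perm r))) j<n

  0-homo : ∀ {Θ} → Equivariant Θ → Θ 0H ≈H 0H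
  0-homo {Θ} a w = begin
    Θ 0H w          ≈⟨ a .cong (λ _ → sym (zeroˡ 0#)) w ⟩
    Θ (0# · 0H) w   ≈⟨ a .·-homo 0# 0H w ⟩
    0# * Θ 0H w     ≈⟨ zeroˡ _ ⟩
    0#              ∎

  -- H_n is generated by 1 under right multiplication, which commutes with all
  -- equivariant operators.
  determined : ∀ {Θ Φ} → Equivariant Θ → Equivariant Φ → Θ 1H ≈H Φ 1H →
               ∀ {y} → Supported y → Θ y ≈H Φ y
  determined {Θ} {Φ} a b e {y} supp v = begin
      Θ y v                        ≈⟨ a .cong (expand supp) v ⟨
      Θ (expansion y (perms n)) v  ≈⟨ on-expansion perms-Perm v ⟩
      Φ (expansion y (perms n)) v  ≈⟨ b .cong (expand supp) v ⟩
      Φ y v                        ∎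
    where
    on-expansion : ∀ {ws} → All (Perm n) ws → Θ (expansion y ws) ≈H Φ (expansion y ws)
    on-expansion []       u = trans (0-homo a u) (sym (0-homo b u))
    on-expansion {w ∷ ws} (p ∷ ps) u = begin
      Θ ((y w · T[ w ]) ⊕ expansion y ws) u         ≈⟨ a .⊕-homo _ _ u ⟩
      Θ (y w · T[ w ]) u + Θ (expansion y ws) u     ≈⟨ +-cong (a .·-homo _ _ u) (on-expansion ps u) ⟩
      y w * Θ T[ w ] u + Φ (expansion y ws) u       ≈⟨ +-congʳ (*-congˡ (AscendsTo-determined a b e (perms-AscendsTo n (Perm⇒∈perms n p)) u)) ⟩
      y w * Φ T[ w ] u + Φ (expansion y ws) u       ≈⟨ +-congʳ (b .·-homo _ _ u) ⟨
      Φ (y w · T[ w ]) u + Φ (expansion y ws) u     ≈⟨ b .⊕-homo _ _ u ⟨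
      Φ ((y w · T[ w ]) ⊕ expansion y ws) u         ∎

  sumC-cong-All : ∀ {f g : List ℕ → Carrier} {ws} → All (λ w → f w ≈ g w) ws → sumC (map f ws) ≈ sumC (map g ws)
  sumC-cong-All []       = refl
  sumC-cong-All (e ∷ es) = +-cong e (sumC-cong-All es)

  ⊗-identityʳ : ∀ {x} → Supported x → x ⊗ 1H ≈H x
  ⊗-identityʳ {x} supp u = trans
    (sumC-cong-All (All.map (λ {w} p → *-congˡ {x w} (Tword-reduced (redWord-reduced p) u)) perms-Perm))
    (expand supp u)

  ⊗-determined : ∀ {x Θ} → Supported x → Equivariant Θ → Θ 1H ≈H x → ∀ {y} → Supported y → x ⊗ y ≈H Θ y
  ⊗-determined {x} supp a e = determined (⊗-equivariant x) a (λ w → trans (⊗-identityʳ supp w) (sym (e w)))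

  ⊗-identityˡ : ∀ {y} → Supported y → 1H ⊗ y ≈H y
  ⊗-identityˡ = ⊗-determined 1H-supported equivariant-id (λ w → refl)

  ⊗-supported : ∀ x {y} → Supported y → Supported (x ⊗ y)
  ⊗-supported x = ⊗-equivariant x .supported

  ⊗-assoc : ∀ x {y z} → Supported y → Supported z → (x ⊗ y) ⊗ z ≈H x ⊗ (y ⊗ z)
  ⊗-assoc x {y} sy = ⊗-determined (⊗-supported x sy)
    (equivariant-∘ (⊗-equivariant x) (⊗-equivariant y)) (⊗-equivariant x .cong (⊗-identityʳ sy))

  ⊗-cong : ∀ {x x′ y y′} → x ≈H x′ → y ≈H y′ → x ⊗ y ≈H x′ ⊗ y′
  ⊗-cong {x} {x′} ex ey u = trans (⊗-equivariant x .cong ey u) (sumC-cong (perms n) (λ w → *-congʳ (ex w)))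

  ⊗-distribʳ : ∀ x y z → (y ⊕ z) ⊗ x ≈H (y ⊗ x) ⊕ (z ⊗ x)
  ⊗-distribʳ x y z u = trans (sumC-cong (perms n) (λ w → distribʳ _ (y w) (z w))) (sumC-+ _ _ (perms n))

  ·-⊗ : ∀ r x y → (r · x) ⊗ y ≈H r · (x ⊗ y)
  ·-⊗ r x y u = trans (sumC-cong (perms n) (λ w → *-assoc r (x w) _)) (sumC-* r _ (perms n))

  ⊗-· : ∀ r x y → x ⊗ (r · y) ≈H r · (x ⊗ y)
  ⊗-· r x y = ⊗-equivariant x .·-homo r y

  Tl-⊗ : ∀ {i y} → suc i < n → Supported y → T (suc i) ⊗ y ≈H Tl (suc i) y
  Tl-⊗ i<n = ⊗-determined (Tl-supported i<n 1H-supported) (equivariant-Tl i<n) (λ w → refl)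

  -- The ring of supported functions and its generators

  Element : Set (c ⊔ ℓ)
  Element = Σ H Supported

  ring : Ring (c ⊔ ℓ) ℓ
  ring = record
    { Carrier = Element
    ; _≈_ = λ x y → proj₁ x ≈H proj₁ y
    ; _+_ = λ (x , p) (y , r) → x ⊕ y , λ w ¬w → trans (+-cong (p w ¬w) (r w ¬w)) (+-identityˡ 0#)
    ; _*_ = λ (x , p) (y , r) → x ⊗ y , ⊗-supported x r
    ; -_  = λ (x , p) → (λ w → - x w) , λ w ¬w → trans (-‿cong (p w ¬w)) -0#≈0#
    ; 0#  = 0H , λ _ _ → refl
    ; 1#  = 1H , 1H-supported
    ; isRing = record
      { +-isAbelianGroup = record
        { isGroup = record
          { isMonoid = record
            { isSemigroup = record
              { isMagma = record
                { isEquivalence = record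
                  { refl = λ w → refl ; sym = λ e w → sym (e w) ; trans = λ e f w → trans (e w) (f w) }
                ; ∙-cong = λ e f w → +-cong (e w) (f w) }
              ; assoc = λ x y z w → +-assoc _ _ _ }
            ; identity = (λ x w → +-identityˡ _) , λ x w → +-identityʳ _ }
          ; inverse = (λ x w → -‿inverseˡ _) , λ x w → -‿inverseʳ _
          ; ⁻¹-cong = λ e w → -‿cong (e w) }
        ; comm = λ x y w → +-comm _ _ }
      ; *-cong = ⊗-cong
      ; *-assoc = λ (x , _) (y , p) (z , r) → ⊗-assoc x p r
      ; *-identity = (λ (x , p) → ⊗-identityˡ p) , (λ (x , p) → ⊗-identityʳ p)
      ; distrib = (λ (x , _) (y , _) (z , _) → ⊗-equivariant x .⊕-homo y z)
                , (λ (x , _) (y , _) (z , _) → ⊗-distribʳ x y z) } }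
    where open import Algebra.Properties.Ring (CommutativeRing.ring R) using (-0#≈0#)

  module E = Ring ring

  scalar : Carrier → Element
  scalar r = (r · 1H) , λ w ¬w → trans (*-congˡ (1H-supported w ¬w)) (zeroʳ r)

  scalar-* : ∀ r (x : Element) → scalar r E.* x E.≈ (r · proj₁ x , λ w ¬w → trans (*-congˡ (proj₂ x w ¬w)) (zeroʳ r))
  scalar-* r (x , p) w = trans (·-⊗ r 1H x w) (*-congˡ (⊗-identityˡ p w))

  scalar-central : ∀ r x → scalar r E.* x E.≈ x E.* scalar r
  scalar-central r (x , p) w = trans (scalar-* r (x , p) w)
    (trans (*-congˡ (sym (⊗-identityʳ p w))) (sym (⊗-· r x 1H w)))

  -- The value 0 at index 0 is the convention T_0 = 0, with which B_1 = 1 + T_0 B_0 needs no case of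
  -- its own; the value 0 from n on makes the family total.
  gen : ℕ → Element
  gen zero    = E.0#
  gen (suc i) with suc i ℕ.<? n
  ... | yes i<n = T (suc i) , Tl-supported i<n 1H-supported
  ... | no  _   = E.0#

  gen-T : ∀ {i} → suc i < n → proj₁ (gen (suc i)) ≡ T (suc i)
  gen-T {i} i<n with suc i ℕ.<? n
  ... | yes _  = ≡.refl
  ... | no ¬p = contradiction i<n ¬p

  gen-* : ∀ {i} → suc i < n → ∀ x → proj₁ (gen (suc i) E.* x) ≈H Tl (suc i) (proj₁ x)
  gen-* {i} i<n (x , p) rewrite gen-T i<n = Tl-⊗ i<n p

  twist-quadratic : ∀ a u v → twist a (twist (not a) v u) (twist a u v) ≈ (q + - 1#) * twist a u v + q * v
  twist-quadratic true  u v = trans (distribˡ q v _) (trans (+-comm _ _) (+-congʳ (*-exchange q _ u)))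
  twist-quadratic false u v = +-comm _ _

  asc-sAct-not : ∀ {i w} → suc i < n → Perm n w → asc (suc i) (sAct (suc i) w) ≡ not (asc (suc i) w)
  asc-sAct-not {i} {w} i<n p with asc (suc i) w in e
  ... | true  = asc-sAct-ascent i w e
  ... | false = descent⇒ascent p i<n e

  gen-quadratic : ∀ {i} → suc i < n →
    gen (suc i) E.* gen (suc i) E.≈ (scalar q E.+ E.- E.1#) E.* gen (suc i) E.+ scalar q
  gen-quadratic {i} i<n w = begin
      proj₁ (gen (suc i) E.* gen (suc i)) w                      ≈⟨ gen-* i<n (gen (suc i)) w ⟩
      Tl (suc i) (proj₁ (gen (suc i))) w                         ≡⟨ ≡.cong (λ x → Tl (suc i) x w) (gen-T i<n) ⟩
      Tl (suc i) (T (suc i)) w                                   ≈⟨ square w ⟩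
      (q + - 1#) * T (suc i) w + q * 1H w                        ≈⟨ +-congʳ scaled ⟩
      proj₁ ((scalar q E.+ E.- E.1#) E.* gen (suc i) E.+ scalar q) w  ∎
    where
    square : Tl (suc i) (T (suc i)) ≈H ((q + - 1#) · T (suc i)) ⊕ (q · 1H)
    square v with perm? n v
    ... | yes p rewrite asc-sAct-not i<n p | sAct-involutive i v = twist-quadratic (asc (suc i) v) _ _
    ... | no ¬p = trans (Tl-supported i<n (Tl-supported i<n 1H-supported) v ¬p)
        (sym (trans (+-cong (trans (*-congˡ (Tl-supported i<n 1H-supported v ¬p)) (zeroʳ _))
                            (trans (*-congˡ (1H-supported v ¬p)) (zeroʳ _))) (+-identityˡ 0#)))
    scaled : (q + - 1#) * T (suc i) w ≈ proj₁ ((scalar q E.+ E.- E.1#) E.* gen (suc i)) w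
    scaled = begin
      (q + - 1#) * T (suc i) w   ≡⟨ ≡.cong (λ x → (q + - 1#) * x w) (gen-T i<n) ⟨
      (q + - 1#) * proj₁ (gen (suc i)) w ≈⟨ scalar-* (q + - 1#) (gen (suc i)) w ⟨
      proj₁ (scalar (q + - 1#) E.* gen (suc i)) w ≈⟨ ⊗-cong {y = proj₁ (gen (suc i))} scalar-q-1 (λ _ → refl) w ⟩
      proj₁ ((scalar q E.+ E.- E.1#) E.* gen (suc i)) w ∎
      where
      open import Algebra.Properties.Ring (CommutativeRing.ring R) using (-1*x≈-x)
      scalar-q-1 : scalar (q + - 1#) E.≈ scalar q E.+ E.- E.1#
      scalar-q-1 v = trans (distribʳ _ q _) (+-congˡ (-1*x≈-x _))

  genWord : List ℕ → Element
  genWord = foldr (λ i x → gen i E.* x) E.1#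

  genWord-reduced : ∀ {is w} → Reduced n is w → proj₁ (genWord is) ≈H T[ w ]
  genWord-reduced []                  w = refl
  genWord-reduced (cons {i} {is} {v} i<n up r) w = trans (gen-* i<n (genWord is) w)
    (trans (Tl-cong (suc i) (genWord-reduced r) w) (Tl-ascent i v up w))

  reduced-unique : ∀ {is js w v} → Reduced n is w → Reduced n js v → w ≡ v → genWord is E.≈ genWord js
  reduced-unique r s ≡.refl w = trans (genWord-reduced r w) (sym (genWord-reduced s w))

  -- Both sides are products along reduced words of one permutation, hence the same basis element;
  -- what remains is the braid relation between the swaps of values.
  gen-braid : ∀ {i} → suc (suc i) < n →
    gen (suc i) E.* (gen (suc (suc i)) E.* gen (suc i)) E.≈
    gen (suc (suc i)) E.* (gen (suc i) E.* gen (suc (suc i)))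
  gen-braid {i} 2+i<n w = trans (unit (suc i) (suc (suc i)) (suc i) w)
    (trans (reduced-unique left right same w) (sym (unit (suc (suc i)) (suc i) (suc (suc i)) w)))
    where
    unit : ∀ a b c → gen a E.* (gen b E.* gen c) E.≈ genWord (a ∷ b ∷ c ∷ [])
    unit a b c = ⊗-equivariant (proj₁ (gen a)) .cong (⊗-equivariant (proj₁ (gen b)) .cong
      (λ v → sym (⊗-identityʳ (proj₂ (gen c)) v)))
    i<n : suc i < n
    i<n = ℕ.<-trans (ℕ.n<1+n _) 2+i<n
    i≢1+i : i ≢ suc i
    i≢1+i = ℕ.1+n≢n ∘ ≡.sym
    i≢2+i : i ≢ suc (suc i)
    i≢2+i = ℕ.<⇒≢ (ℕ.m≤n⇒m≤1+n (ℕ.n<1+n i))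
    fix-2+i : swapV (suc i) (suc (suc i)) ≡ suc (suc i)
    fix-2+i = swapV-other i (i≢2+i ∘ ≡.sym) ℕ.1+n≢n
    fix-i : swapV (suc (suc i)) i ≡ i
    fix-i = swapV-other (suc i) i≢1+i i≢2+i
    left = extend i i<n
             (extend (suc i) 2+i<n (extend i i<n [] ≡.refl ≡.refl (ℕ.n<1+n i))
               (swapV-upper i) fix-2+i (ℕ.m≤n⇒m≤1+n (ℕ.n<1+n i)))
             (≡.trans (≡.cong (swapV (suc i)) fix-i) (swapV-lower i))
             (≡.trans (≡.cong (swapV (suc i)) (swapV-lower (suc i))) fix-2+i) (ℕ.n<1+n (suc i))
    right = extend (suc i) 2+i<n
              (extend i i<n (extend (suc i) 2+i<n [] ≡.refl ≡.refl (ℕ.n<1+n (suc i)))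
                fix-i (swapV-lower (suc i)) (ℕ.m≤n⇒m≤1+n (ℕ.n<1+n i)))
              (≡.trans (≡.cong (swapV (suc (suc i))) (swapV-upper i)) fix-i)
              (≡.trans (≡.cong (swapV (suc (suc i))) fix-2+i) (swapV-upper (suc i))) (ℕ.n<1+n i)
    fuse : ∀ (f g h : ℕ → ℕ) → map f (map g (map h (upTo n))) ≡ map (f ∘ g ∘ h) (upTo n)
    fuse f g h = ≡.trans (≡.cong (map f) (≡.sym (map-∘ (upTo n)))) (≡.sym (map-∘ (upTo n)))
    same : sAct (suc i) (sAct (suc (suc i)) (sAct (suc i) (upTo n))) ≡
           sAct (suc (suc i)) (sAct (suc i) (sAct (suc (suc i)) (upTo n)))
    same = ≡.trans (fuse _ _ _) (≡.trans (map-cong (swapV-braid i) (upTo n)) (≡.sym (fuse _ _ _)))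

  gen-comm : ∀ {i j} → suc i < j → suc j < n → gen (suc i) E.* gen (suc j) E.≈ gen (suc j) E.* gen (suc i)
  gen-comm {i} {j} i<j j<n w = trans (unit (suc i) (suc j) w)
    (trans (reduced-unique left right same w) (sym (unit (suc j) (suc i) w)))
    where
    unit : ∀ a b → gen a E.* gen b E.≈ genWord (a ∷ b ∷ [])
    unit a b = ⊗-equivariant (proj₁ (gen a)) .cong (λ v → sym (⊗-identityʳ (proj₂ (gen b)) v))
    i<j′ : i < j
    i<j′ = ℕ.<-trans (ℕ.n<1+n i) i<j
    i<n : suc i < n
    i<n = ℕ.<-trans i<j (ℕ.<-trans (ℕ.n<1+n j) j<n)
    left = extend i i<n (extend j j<n [] ≡.refl ≡.refl (ℕ.n<1+n j))
      (swapV-other j (ℕ.<⇒≢ i<j′) (ℕ.<⇒≢ (ℕ.m≤n⇒m≤1+n i<j′)))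
      (swapV-other j (ℕ.<⇒≢ i<j) (ℕ.<⇒≢ (ℕ.m≤n⇒m≤1+n i<j))) (ℕ.n<1+n i)
    right = extend j j<n (extend i i<n [] ≡.refl ≡.refl (ℕ.n<1+n i))
      (swapV-other i (ℕ.<⇒≢ i<j′ ∘ ≡.sym) (ℕ.<⇒≢ i<j ∘ ≡.sym))
      (swapV-other i (ℕ.<⇒≢ (ℕ.m≤n⇒m≤1+n i<j′) ∘ ≡.sym) (ℕ.<⇒≢ (ℕ.m≤n⇒m≤1+n i<j) ∘ ≡.sym)) (ℕ.n<1+n j)
    same : sAct (suc i) (sAct (suc j) (upTo n)) ≡ sAct (suc j) (sAct (suc i) (upTo n))
    same = ≡.trans (≡.sym (map-∘ (upTo n))) (≡.trans (map-cong (swapV-comm i<j) (upTo n)) (map-∘ (upTo n)))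

-- Certificates for identities in noncommutative rings

infixl 6 _:+_ _:-_
infixl 7 _:*_
infix  5 _≣_
infix  6 _⟪_⟫_

data Expr : Set where
  var cvar : ℕ → Expr
  :0 :1    : Expr
  _:+_ _:-_ _:*_ : Expr → Expr → Expr

data Equation : Set where
  _≣_ : Expr → Expr → Equation

-- An equation is certified by writing the difference of its sides as a sum of
-- two-sided multiples c (l − r) d of known equations; c ⟪ l ≣ r ⟫ d is one of them.
data Multiple : Set where
  _⟪_⟫_ : Expr → Equation → Expr → Multiple

-- The sorted list of the central variables and the word in the others.
Mono : Set
Mono = List ℕ × List ℕ

insertSorted : ℕ → List ℕ → List ℕ
insertSorted i []       = i ∷ []
insertSorted i (j ∷ js) = if i <ᵇ j then i ∷ j ∷ js else j ∷ insertSorted i js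

mulMono : Mono → Mono → Mono
mulMono (is , w) (js , v) = foldr insertSorted js is , w ++ v

negTerms : List (Bool × Mono) → List (Bool × Mono)
negTerms = map λ (s , m) → not s , m

mulTerm : Bool × Mono → List (Bool × Mono) → List (Bool × Mono)
mulTerm (s , m) = map λ (t , m′) → (if s then t else not t) , mulMono m m′

mulTerms : List (Bool × Mono) → List (Bool × Mono) → List (Bool × Mono)
mulTerms []       q = []
mulTerms (t ∷ p)  q = mulTerm t q ++ mulTerms p q

terms : Expr → List (Bool × Mono)
terms (var i)  = (true , [] , i ∷ []) ∷ []
terms (cvar i) = (true , i ∷ [] , []) ∷ []
terms :0       = []
terms :1       = (true , [] , []) ∷ []
terms (a :+ b) = terms a ++ terms b
terms (a :- b) = terms a ++ negTerms (terms b)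
terms (a :* b) = mulTerms (terms a) (terms b)

opposite : Bool → Bool → Bool
opposite true  b = not b
opposite false b = b

-- Like monomials are never collected: integer coefficients are repeated signed terms, and terms
-- vanish in pairs of opposite sign.
cancel : Bool × Mono → List (Bool × Mono) → List (Bool × Mono)
cancel t [] = t ∷ []
cancel (s , is , w) ((t , js , v) ∷ p) =
  if opposite s t ∧ (is ==L js) ∧ (w ==L v) then p else (t , js , v) ∷ cancel (s , is , w) p

multiples : List Multiple → Expr
multiples []                      = :0
multiples ((c ⟪ l ≣ r ⟫ d) ∷ ms) = c :* (l :- r) :* d :+ multiples ms

residue : Equation → List Multiple → List (Bool × Mono)
residue (l ≣ r) ms = foldr cancel [] (terms (l :- r :- multiples ms))

module RingCertificates {c ℓ} (A : Ring c ℓ) where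
  open Ring A
  open import Algebra.Properties.Ring A
  open import Relation.Binary.Reasoning.Setoid setoid

  Central : Set (c ⊔ ℓ)
  Central = Σ Carrier λ k → ∀ x → k * x ≈ x * k

  at : List Carrier → ℕ → Carrier
  at []       _       = 0#
  at (x ∷ _)  zero    = x
  at (_ ∷ xs) (suc i) = at xs i

  atᶜ : List Central → ℕ → Central
  atᶜ []       _       = 0# , λ x → trans (zeroˡ x) (sym (zeroʳ x))
  atᶜ (x ∷ _)  zero    = x
  atᶜ (_ ∷ xs) (suc i) = atᶜ xs i

  module _ (ks : List Central) (xs : List Carrier) where

    ⟦_⟧ : Expr → Carrier
    ⟦ var i ⟧  = at xs i
    ⟦ cvar i ⟧ = proj₁ (atᶜ ks i)
    ⟦ :0 ⟧     = 0#
    ⟦ :1 ⟧     = 1#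
    ⟦ a :+ b ⟧ = ⟦ a ⟧ + ⟦ b ⟧
    ⟦ a :- b ⟧ = ⟦ a ⟧ - ⟦ b ⟧
    ⟦ a :* b ⟧ = ⟦ a ⟧ * ⟦ b ⟧

    Holds : Multiple → Set ℓ
    Holds (_ ⟪ l ≣ r ⟫ _) = ⟦ l ⟧ ≈ ⟦ r ⟧

    AllHold : List Multiple → Set ℓ
    AllHold []       = ⊤
    AllHold (m ∷ ms) = Holds m × AllHold ms

    centrals : List ℕ → Carrier
    centrals = foldr (λ i x → ⟦ cvar i ⟧ * x) 1#

    factors : List ℕ → Carrier
    factors = foldr (λ i x → at xs i * x) 1#

    signed : Bool → Carrier → Carrier
    signed true  x = x
    signed false x = - x

    ⟦_⟧ᵗ : Bool × Mono → Carrier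
    ⟦ s , is , w ⟧ᵗ = signed s (centrals is * factors w)

    ⟦_⟧ᵖ : List (Bool × Mono) → Carrier
    ⟦_⟧ᵖ = foldr (λ t x → ⟦ t ⟧ᵗ + x) 0#

    signed-cong : ∀ s {x y} → x ≈ y → signed s x ≈ signed s y
    signed-cong true  e = e
    signed-cong false e = -‿cong e

    signed-not : ∀ s x → signed (not s) x ≈ - signed s x
    signed-not true  x = refl
    signed-not false x = sym (-‿involutive x)

    centrals-central : ∀ is x → centrals is * x ≈ x * centrals is
    centrals-central []       x = trans (*-identityˡ x) (sym (*-identityʳ x))
    centrals-central (i ∷ is) x = begin
      k * centrals is * x    ≈⟨ *-assoc k _ x ⟩
      k * (centrals is * x)  ≈⟨ *-congˡ (centrals-central is x) ⟩
      k * (x * centrals is)  ≈⟨ *-assoc k x _ ⟨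
      k * x * centrals is    ≈⟨ *-congʳ (proj₂ (atᶜ ks i) x) ⟩
      x * k * centrals is    ≈⟨ *-assoc x k _ ⟩
      x * (k * centrals is)  ∎
      where k = ⟦ cvar i ⟧

    centrals-insert : ∀ i js → centrals (insertSorted i js) ≈ ⟦ cvar i ⟧ * centrals js
    centrals-insert i []       = refl
    centrals-insert i (j ∷ js) with i <ᵇ j
    ... | true  = refl
    ... | false = begin
      kj * centrals (insertSorted i js)  ≈⟨ *-congˡ (centrals-insert i js) ⟩
      kj * (ki * centrals js)            ≈⟨ *-assoc kj ki _ ⟨
      kj * ki * centrals js              ≈⟨ *-congʳ (proj₂ (atᶜ ks j) ki) ⟩
      ki * kj * centrals js              ≈⟨ *-assoc ki kj _ ⟩
      ki * (kj * centrals js)            ∎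
      where ki = ⟦ cvar i ⟧
            kj = ⟦ cvar j ⟧

    centrals-merge : ∀ is js → centrals (foldr insertSorted js is) ≈ centrals is * centrals js
    centrals-merge []       js = sym (*-identityˡ _)
    centrals-merge (i ∷ is) js = trans (centrals-insert i (foldr insertSorted js is))
      (trans (*-congˡ (centrals-merge is js)) (sym (*-assoc _ _ _)))

    factors-++ : ∀ w v → factors (w ++ v) ≈ factors w * factors v
    factors-++ []      v = sym (*-identityˡ _)
    factors-++ (i ∷ w) v = trans (*-congˡ (factors-++ w v)) (sym (*-assoc _ _ _))

    mulMono-sound : ∀ is w js v → centrals (foldr insertSorted js is) * factors (w ++ v)
                                  ≈ (centrals is * factors w) * (centrals js * factors v)
    mulMono-sound is w js v = begin
      centrals (foldr insertSorted js is) * factors (w ++ v) ≈⟨ *-cong (centrals-merge is js) (factors-++ w v) ⟩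
      (a * b) * (x * y)   ≈⟨ *-assoc a b _ ⟩
      a * (b * (x * y))   ≈⟨ *-congˡ (*-assoc b x y) ⟨
      a * ((b * x) * y)   ≈⟨ *-congˡ (*-congʳ (centrals-central js x)) ⟩
      a * ((x * b) * y)   ≈⟨ *-congˡ (*-assoc x b y) ⟩
      a * (x * (b * y))   ≈⟨ *-assoc a x _ ⟨
      (a * x) * (b * y)   ∎
      where a = centrals is
            b = centrals js
            x = factors w
            y = factors v

    ++-sound : ∀ p r → ⟦ p ++ r ⟧ᵖ ≈ ⟦ p ⟧ᵖ + ⟦ r ⟧ᵖ
    ++-sound []      r = sym (+-identityˡ _)
    ++-sound (t ∷ p) r = trans (+-congˡ (++-sound p r)) (sym (+-assoc _ _ _))

    neg-sound : ∀ p → ⟦ negTerms p ⟧ᵖ ≈ - ⟦ p ⟧ᵖ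
    neg-sound []            = sym -0#≈0#
    neg-sound ((s , m) ∷ p) = trans (+-cong (signed-not s _) (neg-sound p)) (-‿+-comm _ _)

    mulTerm-sound : ∀ t p → ⟦ mulTerm t p ⟧ᵖ ≈ ⟦ t ⟧ᵗ * ⟦ p ⟧ᵖ
    mulTerm-sound t [] = sym (zeroʳ _)
    mulTerm-sound (s , is , w) ((t , js , v) ∷ p) = begin
      signed st _ + ⟦ mulTerm (s , is , w) p ⟧ᵖ ≈⟨ +-cong (signed-cong st (mulMono-sound is w js v)) (mulTerm-sound (s , is , w) p) ⟩
      signed st (x * y) + signed s x * ⟦ p ⟧ᵖ   ≈⟨ +-congʳ (signs s t) ⟩
      signed s x * signed t y + signed s x * ⟦ p ⟧ᵖ ≈⟨ distribˡ _ _ _ ⟨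
      signed s x * (signed t y + ⟦ p ⟧ᵖ) ∎
      where
      st = if s then t else not t
      x  = centrals is * factors w
      y  = centrals js * factors v
      signs : ∀ s t → signed (if s then t else not t) (x * y) ≈ signed s x * signed t y
      signs true  true  = refl
      signs true  false = -‿distribʳ-* x y
      signs false true  = -‿distribˡ-* x y
      signs false false = trans (sym (-‿involutive _)) (trans (-‿cong (-‿distribʳ-* x y)) (-‿distribˡ-* x (- y)))

    mulTerms-sound : ∀ p r → ⟦ mulTerms p r ⟧ᵖ ≈ ⟦ p ⟧ᵖ * ⟦ r ⟧ᵖ
    mulTerms-sound []      r = sym (zeroˡ _)
    mulTerms-sound (t ∷ p) r = trans (++-sound (mulTerm t r) (mulTerms p r))
      (trans (+-cong (mulTerm-sound t r) (mulTerms-sound p r)) (sym (distribʳ _ _ _)))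

    terms-sound : ∀ e → ⟦ terms e ⟧ᵖ ≈ ⟦ e ⟧
    terms-sound (var i)  = trans (+-identityʳ _) (trans (*-identityˡ _) (*-identityʳ _))
    terms-sound (cvar i) = trans (+-identityʳ _) (trans (*-identityʳ _) (*-identityʳ _))
    terms-sound :0       = refl
    terms-sound :1       = trans (+-identityʳ _) (*-identityˡ _)
    terms-sound (a :+ b) = trans (++-sound (terms a) (terms b)) (+-cong (terms-sound a) (terms-sound b))
    terms-sound (a :- b) = trans (++-sound (terms a) (negTerms (terms b)))
      (+-cong (terms-sound a) (trans (neg-sound (terms b)) (-‿cong (terms-sound b))))
    terms-sound (a :* b) = trans (mulTerms-sound (terms a) (terms b)) (*-cong (terms-sound a) (terms-sound b))

    opposite-sound : ∀ s t x → opposite s t ≡ true → signed s x + signed t x ≈ 0#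
    opposite-sound true  false x _ = -‿inverseʳ x
    opposite-sound false true  x _ = -‿inverseˡ x

    cancel-sound : ∀ t p → ⟦ cancel t p ⟧ᵖ ≈ ⟦ t ⟧ᵗ + ⟦ p ⟧ᵖ
    cancel-sound t [] = refl
    cancel-sound (s , is , w) ((t , js , v) ∷ p)
      with opposite s t in e₁ | is ==L js in e₂ | w ==L v in e₃
    ... | true | true | true with ==L-sound is js e₂ | ==L-sound w v e₃
    ...   | ≡.refl | ≡.refl = sym (trans (sym (+-assoc _ _ _))
              (trans (+-congʳ (opposite-sound s t _ e₁)) (+-identityˡ _)))
    cancel-sound (s , is , w) ((t , js , v) ∷ p) | false | _ | _ =
      trans (+-congˡ (cancel-sound (s , is , w) p)) (trans (sym (+-assoc _ _ _))
        (trans (+-congʳ (+-comm _ _)) (+-assoc _ _ _)))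
    cancel-sound (s , is , w) ((t , js , v) ∷ p) | true | false | _ =
      trans (+-congˡ (cancel-sound (s , is , w) p)) (trans (sym (+-assoc _ _ _))
        (trans (+-congʳ (+-comm _ _)) (+-assoc _ _ _)))
    cancel-sound (s , is , w) ((t , js , v) ∷ p) | true | true | false =
      trans (+-congˡ (cancel-sound (s , is , w) p)) (trans (sym (+-assoc _ _ _))
        (trans (+-congʳ (+-comm _ _)) (+-assoc _ _ _)))

    cancelAll-sound : ∀ p → ⟦ foldr cancel [] p ⟧ᵖ ≈ ⟦ p ⟧ᵖ
    cancelAll-sound []      = refl
    cancelAll-sound (t ∷ p) = trans (cancel-sound t (foldr cancel [] p)) (+-congˡ (cancelAll-sound p))

    multiples-zero : ∀ ms → AllHold ms → ⟦ multiples ms ⟧ ≈ 0#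
    multiples-zero []                     _        = refl
    multiples-zero ((c ⟪ l ≣ r ⟫ d) ∷ ms) (e , es) = trans (+-cong
      (trans (*-congʳ (trans (*-congˡ (trans (+-congʳ e) (-‿inverseʳ _))) (zeroʳ _))) (zeroˡ _))
      (multiples-zero ms es)) (+-identityˡ 0#)

    -- With `≡.refl` as last argument the type checker expands and cancels; the list of multiples is
    -- then the whole mathematical content of such a proof.
    certify : ∀ l r ms → AllHold ms → residue (l ≣ r) ms ≡ [] → ⟦ l ⟧ ≈ ⟦ r ⟧
    certify l r ms hold e = x∙y⁻¹≈ε⇒x≈y _ _ (begin
      ⟦ l ⟧ - ⟦ r ⟧                      ≈⟨ +-identityʳ _ ⟨
      ⟦ l ⟧ - ⟦ r ⟧ + 0#                 ≈⟨ +-congˡ (trans (-‿cong (multiples-zero ms hold)) -0#≈0#) ⟨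
      ⟦ l ⟧ - ⟦ r ⟧ - ⟦ multiples ms ⟧   ≈⟨ terms-sound (l :- r :- multiples ms) ⟨
      ⟦ all ⟧ᵖ                           ≈⟨ cancelAll-sound all ⟨
      ⟦ residue (l ≣ r) ms ⟧ᵖ            ≡⟨ ≡.cong ⟦_⟧ᵖ e ⟩
      0#                                 ∎)
      where all = terms (l :- r :- multiples ms)

-- The recursion in an abstract algebra with the Hecke relations

-- Kept abstract because it is used for two rings: the algebra over ℤ[q], where [k]!_q can be
-- cancelled, and the algebra over the field.
module HeckeTheory {c ℓ} (A : Ring c ℓ) (q : Ring.Carrier A) (T : ℕ → Ring.Carrier A) where
  open Ring A hiding (zero)
  open RingCertificates A

  B B* D : ℕ → Carrier
  B zero    = 0#
  B (suc m) = 1# + T m * B m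
  B* zero    = 0#
  B* (suc m) = 1# + B* m * T m
  D zero    = 0#
  D (suc m) = 1# + T m + T m * D m * T m

  -- `C m k` is T_m T_{m-1} ⋯ T_{m-k}, which is 0 for k ≥ m once T_0 = 0. The recursion for `X` asks
  -- which of the two increasing blocks of a coset representative ends in the largest value: the
  -- last block, or, after the cycle `C m k` has moved it there, the first. This is Pascal's rule
  -- for q-binomial coefficients.
  P X C Bk B*k : ℕ → ℕ → Carrier
  P m       zero    = 1#
  P zero    (suc k) = 0#
  P (suc m) (suc k) = B* (suc m) * P m k * B (suc m)

  C m       zero    = T m
  C zero    (suc k) = 0#
  C (suc m) (suc k) = T (suc m) * C m k

  -- X n k is the sum of T_w over the minimal coset representatives of
  -- S_n / (S_{n-k} × S_k).
  X m       zero    = 1#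
  X zero    (suc k) = 0#
  X (suc m) (suc k) = X m k + X m (suc k) * C m k

  Bk m       zero    = 1#
  Bk zero    (suc k) = Bk zero k * B zero
  Bk (suc m) (suc k) = Bk m k * B (suc m)

  B*k m       zero    = 1#
  B*k zero    (suc k) = B* zero * B*k zero k
  B*k (suc m) (suc k) = B* (suc m) * B*k m k

  qpow qint qfact : ℕ → Carrier
  qpow zero    = 1#
  qpow (suc k) = q * qpow k
  qint zero    = 0#
  qint (suc k) = 1# + q * qint k
  qfact zero    = 1#
  qfact (suc k) = qfact k * qint (suc k)

  Commute : Carrier → Carrier → Set ℓ
  Commute x y = x * y ≈ y * x

  -- `B m`, `B* m`, `D m`, `P m k`, `Bk m k` and `X m k` are polynomials in the T_i with i < m, so
  -- they commute with whatever commutes with these.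
  CommutesBelow : ℕ → Carrier → Set ℓ
  CommutesBelow m x = ∀ i → i < m → Commute x (T i)

  commute-0 : ∀ x → Commute x 0#
  commute-0 x = trans (zeroʳ x) (sym (zeroˡ x))

  commute-1 : ∀ x → Commute x 1#
  commute-1 x = trans (*-identityʳ x) (sym (*-identityˡ x))

  commute-+ : ∀ {x y z} → Commute x y → Commute x z → Commute x (y + z)
  commute-+ e f = trans (distribˡ _ _ _) (trans (+-cong e f) (sym (distribʳ _ _ _)))

  commute-* : ∀ {x y z} → Commute x y → Commute x z → Commute x (y * z)
  commute-* e f = trans (sym (*-assoc _ _ _)) (trans (*-congʳ e) (trans (*-assoc _ _ _)
                  (trans (*-congˡ f) (sym (*-assoc _ _ _)))))

  weaken : ∀ {m x} → CommutesBelow (suc m) x → CommutesBelow m x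
  weaken h i i<m = h i (ℕ.m≤n⇒m≤1+n i<m)

  commute-B : ∀ m {x} → CommutesBelow m x → Commute x (B m)
  commute-B zero    h = commute-0 _
  commute-B (suc m) h = commute-+ (commute-1 _) (commute-* (h m ℕ.≤-refl) (commute-B m (weaken h)))

  commute-B* : ∀ m {x} → CommutesBelow m x → Commute x (B* m)
  commute-B* zero    h = commute-0 _
  commute-B* (suc m) h = commute-+ (commute-1 _) (commute-* (commute-B* m (weaken h)) (h m ℕ.≤-refl))

  commute-D : ∀ m {x} → CommutesBelow m x → Commute x (D m)
  commute-D zero    h = commute-0 _
  commute-D (suc m) h = commute-+ (commute-+ (commute-1 _) (h m ℕ.≤-refl))
    (commute-* (commute-* (h m ℕ.≤-refl) (commute-D m (weaken h))) (h m ℕ.≤-refl))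

  commute-P : ∀ m k {x} → CommutesBelow m x → Commute x (P m k)
  commute-P m       zero    h = commute-1 _
  commute-P zero    (suc k) h = commute-0 _
  commute-P (suc m) (suc k) h =
    commute-* (commute-* (commute-B* (suc m) h) (commute-P m k (weaken h))) (commute-B (suc m) h)

  commute-Bk : ∀ m k {x} → CommutesBelow m x → Commute x (Bk m k)
  commute-Bk m       zero    h = commute-1 _
  commute-Bk zero    (suc k) h = commute-* (commute-Bk zero k h) (commute-0 _)
  commute-Bk (suc m) (suc k) h = commute-* (commute-Bk m k (weaken h)) (commute-B (suc m) h)

  commute-C : ∀ m k {x} → CommutesBelow (suc m) x → Commute x (C m k)
  commute-C m       zero    h = h m ℕ.≤-refl
  commute-C zero    (suc k) h = commute-0 _
  commute-C (suc m) (suc k) h = commute-* (h (suc m) ℕ.≤-refl) (commute-C m k (weaken h))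

  commute-X : ∀ m k {x} → CommutesBelow m x → Commute x (X m k)
  commute-X m       zero    h = commute-1 _
  commute-X zero    (suc k) h = commute-0 _
  commute-X (suc m) (suc k) h =
    commute-+ (commute-X m k (weaken h)) (commute-* (commute-X m (suc k) (weaken h)) (commute-C m k h))

  Σ< : (ℕ → Carrier) → ℕ → Carrier
  Σ< f zero    = 0#
  Σ< f (suc m) = Σ< f m + f m

  -- For 0 < i < n, `τ i n` is T of the transposition (i, n), built by the conjugations (i, m+1) =
  -- s_m (i, m) s_m starting from (i, i+1) = s_i.
  τ : ℕ → ℕ → Carrier
  τ i zero    = 0#
  τ i (suc m) = if i <ᵇ m then T m * τ i m * T m else T m

  τ-step : ∀ {i m} → i < m → τ i (suc m) ≡ T m * τ i m * T m
  τ-step {i} {m} i<m = ≡.cong (λ b → if b then T m * τ i m * T m else T m) (<ᵇ-true i<m)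

  τ-last : ∀ m → τ m (suc m) ≡ T m
  τ-last m = ≡.cong (λ b → if b then T m * τ m m * T m else T m) (<ᵇ-false (ℕ.<-irrefl (≡.refl {x = m})))

  word : List ℕ → Carrier
  word = foldr (λ i x → T i * x) 1#

  word-∷ʳ : ∀ is i → word (is ∷ʳ i) ≈ word is * T i
  word-∷ʳ []       i = trans (*-identityʳ (T i)) (sym (*-identityˡ (T i)))
  word-∷ʳ (j ∷ is) i = trans (*-congˡ (word-∷ʳ is i)) (sym (*-assoc _ _ _))

  τ-palindrome : ∀ a D {n} → suc (suc a +ℕ D) ≡ n → τ (suc a) n ≈ word (down a D ++ up (suc a) D)
  τ-palindrome a zero    ≡.refl rewrite ℕ.+-identityʳ a = trans (reflexive (τ-last (suc a))) (sym (*-identityʳ _))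
  τ-palindrome a (suc D) ≡.refl = begin
      τ (suc a) (suc (suc a +ℕ suc D))                         ≡⟨ τ-step (s≤s (ℕ.m<m+n a (s≤s z≤n))) ⟩
      T (suc a +ℕ suc D) * τ (suc a) (suc a +ℕ suc D) * T (suc a +ℕ suc D)
        ≡⟨ ≡.cong (λ i → T i * τ (suc a) (suc a +ℕ suc D) * T (suc a +ℕ suc D)) (ℕ.+-suc (suc a) D) ⟩
      T top * τ (suc a) (suc a +ℕ suc D) * T (suc a +ℕ suc D)  ≈⟨ *-congʳ (*-congˡ (τ-palindrome a D (≡.sym (ℕ.+-suc (suc a) D)))) ⟩
      T top * word (down a D ++ up (suc a) D) * T (suc a +ℕ suc D) ≈⟨ *-assoc _ _ _ ⟩
      T top * (word (down a D ++ up (suc a) D) * T (suc a +ℕ suc D)) ≈⟨ *-congˡ (word-∷ʳ (down a D ++ up (suc a) D) (suc a +ℕ suc D)) ⟨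
      T top * word ((down a D ++ up (suc a) D) ∷ʳ (suc a +ℕ suc D))
        ≡⟨ ≡.cong (λ is → T top * word is) (≡.trans (++-assoc (down a D) (up (suc a) D) _) (≡.cong (down a D ++_) (≡.sym (up-∷ʳ (suc a) D)))) ⟩
      word (down a (suc D) ++ up (suc a) (suc D))              ∎
    where
    open import Relation.Binary.Reasoning.Setoid setoid
    top = suc (suc a +ℕ D)

  module Relations
    (n : ℕ)
    (q-central : ∀ x → Commute q x)
    (T-zero : T 0 ≈ 0#)
    (T-quadratic : ∀ {i} → suc i < n → T (suc i) * T (suc i) ≈ (q - 1#) * T (suc i) + q)
    (T-braid : ∀ {i} → suc (suc i) < n → T (suc i) * (T (suc (suc i)) * T (suc i))
                                       ≈ T (suc (suc i)) * (T (suc i) * T (suc (suc i))))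
    (T-comm : ∀ {i j} → suc i < j → suc j < n → Commute (T (suc i)) (T (suc j)))
    where

    comm : ∀ {i j} → suc i < j → j < n → Commute (T j) (T i)
    comm {zero}  {j}     _         j<n = trans (*-congˡ T-zero) (trans (commute-0 (T j)) (*-congʳ (sym T-zero)))
    comm {suc i} {suc j} (s≤s i<j) j<n = sym (T-comm i<j j<n)

    -- At i = 0 both sides vanish; including this case lets the inductions below start from T_0 = 0.
    braid : ∀ i → suc i < n → T i * (T (suc i) * T i) ≈ T (suc i) * (T i * T (suc i))
    braid (suc i) i<n = T-braid i<n
    braid zero    i<n = certify [] (T 0 ∷ T 1 ∷ [])
      (t :* (u :* t)) (u :* (t :* u)) (:1 ⟪ t ≣ :0 ⟫ (u :* t) ∷ (:0 :- u) ⟪ t ≣ :0 ⟫ u ∷ [])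
      (T-zero , T-zero , tt) ≡.refl
      where t = var 0
            u = var 1

    commutesBelow-T : ∀ {m} → suc m < n → CommutesBelow m (T (suc m))
    commutesBelow-T m<n i i<m = comm (s≤s i<m) m<n

    qᶜ : Central
    qᶜ = q , q-central

    central-* : ∀ {k l} → (∀ x → Commute k x) → (∀ x → Commute l x) → ∀ x → Commute (k * l) x
    central-* e f x = sym (commute-* (sym (e x)) (sym (f x)))

    central-+ : ∀ {k l} → (∀ x → Commute k x) → (∀ x → Commute l x) → ∀ x → Commute (k + l) x
    central-+ e f x = sym (commute-+ (sym (e x)) (sym (f x)))

    central-1 : ∀ x → Commute 1# x
    central-1 x = sym (commute-1 x)

    qpow-central : ∀ k x → Commute (qpow k) x
    qpow-central zero    = central-1
    qpow-central (suc k) = central-* q-central (qpow-central k)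

    qint-central : ∀ k x → Commute (qint k) x
    qint-central zero    x = sym (commute-0 x)
    qint-central (suc k) = central-+ central-1 (central-* q-central (qint-central k))

    qfact-central : ∀ k x → Commute (qfact k) x
    qfact-central zero    = central-1
    qfact-central (suc k) = central-* (qfact-central k) (qint-central (suc k))

    qpowᶜ qintᶜ qfactᶜ : ℕ → Central
    qpowᶜ k  = qpow k , qpow-central k
    qintᶜ k  = qint k , qint-central k
    qfactᶜ k = qfact k , qfact-central k

    qint-suc : ∀ k → qint (suc k) ≈ qint k + qpow k
    qint-suc zero    = trans (+-congˡ (zeroʳ q)) (+-comm 1# 0#)
    qint-suc (suc k) = certify (qᶜ ∷ qintᶜ k ∷ qpowᶜ k ∷ qintᶜ (suc k) ∷ []) []
      (:1 :+ u :* s) (s :+ u :* p) (u ⟪ s ≣ i :+ p ⟫ :1 ∷ (:0 :- :1) ⟪ s ≣ :1 :+ u :* i ⟫ :1 ∷ [])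
      (qint-suc k , refl , tt) ≡.refl
      where u = cvar 0
            i = cvar 1
            p = cvar 2
            s = cvar 3

    qint-+ : ∀ k d → qint (k +ℕ d) ≈ qint k + qpow k * qint d
    qint-+ zero    d = sym (trans (+-identityˡ _) (*-identityˡ _))
    qint-+ (suc k) d = certify (qᶜ ∷ qintᶜ (k +ℕ d) ∷ qintᶜ k ∷ qpowᶜ k ∷ qintᶜ d ∷ []) []
      (:1 :+ u :* cvar 1) (:1 :+ u :* cvar 2 :+ u :* cvar 3 :* cvar 4)
      (u ⟪ cvar 1 ≣ cvar 2 :+ cvar 3 :* cvar 4 ⟫ :1 ∷ []) (qint-+ k d , tt) ≡.refl
      where u = cvar 0

    qpow-+ : ∀ k d → qpow (k +ℕ d) ≈ qpow k * qpow d
    qpow-+ zero    d = sym (*-identityˡ _)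
    qpow-+ (suc k) d = trans (*-congˡ (qpow-+ k d)) (sym (*-assoc _ _ _))

    -- For m ≥ 1, B_m B_{m+1} is in H_n the sum of T_w over the minimal representatives of the
    -- cosets S_{m-1} w in S_{m+1}. Since s_m commutes with S_{m-1}, left multiplication by s_m
    -- pairs these up, and T_m multiplies each T_w + T_{s_m w} by q. The certificate obtains this
    -- inductively, from the quadratic and braid relations.
    absorb : ∀ m → m < n → T m * (B m * B (suc m)) ≈ q * (B m * B (suc m))
    absorb zero    _   = certify (qᶜ ∷ []) (T 0 ∷ []) (t :* (:0 :* b)) (cvar 0 :* (:0 :* b)) [] tt ≡.refl
      where t = var 0
            b = :1 :+ t :* :0
    absorb (suc m) m<n = certify (qᶜ ∷ []) (T (suc m) ∷ T m ∷ B m ∷ [])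
      (t :* (x :* y)) (u :* (x :* y))
      ( (t :- u) :* s ⟪ b :* t ≣ t :* b ⟫ x
      ∷ :1 ⟪ t :* t ≣ (u :- :1) :* t :+ u ⟫ x
      ∷ :1 ⟪ t :* (s :* t) ≣ s :* (t :* s) ⟫ (b :* x)
      ∷ s :* t ⟪ s :* (b :* x) ≣ u :* (b :* x) ⟫ :1
      ∷ [])
      (sym (commute-B m (commutesBelow-T m<n)) , T-quadratic m<n , sym (braid m m<n)
      , absorb m (ℕ.<-trans (ℕ.n<1+n m) m<n) , tt) ≡.refl
      where u = cvar 0
            t = var 0
            s = var 1
            b = var 2
            x = :1 :+ s :* b
            y = :1 :+ t :* x

    -- Conjugating the previous case by t = T_{m+1} turns its D into the last summand of the next D.
    -- With s = T_m its other term becomes B*_m t s t B_m = B*_m s t s B_m, the corner of the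
    -- product (1 + B*_m s) t (1 + s B_m).
    mackey : ∀ m → m < n → B (suc m) * B* (suc m) ≈ D (suc m) + B* m * T m * B m
    mackey zero    _   = certify [] (T 0 ∷ [])
      ((:1 :+ t :* :0) :* (:1 :+ :0 :* t)) (:1 :+ t :+ t :* :0 :* t :+ :0 :* t :* :0)
      ((:0 :- :1) ⟪ t ≣ :0 ⟫ :1 ∷ []) (T-zero , tt) ≡.refl
      where t = var 0
    mackey (suc m) m<n = certify [] (T (suc m) ∷ T m ∷ B m ∷ B* m ∷ D (suc m) ∷ [])
      ((:1 :+ t :* x) :* (:1 :+ x* :* t)) (:1 :+ t :+ t :* d :* t :+ x* :* t :* x)
      ( t ⟪ x :* x* ≣ d :+ b* :* s :* b ⟫ t
      ∷ :1 ⟪ t :* b* ≣ b* :* t ⟫ (s :* b :* t)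
      ∷ b* :* t :* s ⟪ b :* t ≣ t :* b ⟫ :1
      ∷ b* ⟪ t :* (s :* t) ≣ s :* (t :* s) ⟫ b
      ∷ [])
      (mackey m (ℕ.<-trans (ℕ.n<1+n m) m<n) , commute-B* m (commutesBelow-T m<n)
      , sym (commute-B m (commutesBelow-T m<n)) , sym (braid m m<n) , tt) ≡.refl
      where t = var 0
            s = var 1
            b = var 2
            b* = var 3
            d = var 4
            x = :1 :+ s :* b
            x* = :1 :+ b* :* s

    -- The counterpart of J_n commuting with H_{n-1}. For the highest admissible generator s the
    -- inner D is no help, as s need not commute with it; unfolding D twice leaves an innermost D
    -- that commutes with t, and the braid relation carries s across the rest.
    commutesBelow-D : ∀ m → m < n → CommutesBelow m (D (suc m))
    commutesBelow-D (suc m) m<n i i<sm with ℕ.m≤n⇒m<n∨m≡n (ℕ.s≤s⁻¹ i<sm)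
    ... | inj₁ i<m = certify [] (T (suc m) ∷ T i ∷ D (suc m) ∷ [])
      ((:1 :+ t :+ t :* d :* t) :* s) (s :* (:1 :+ t :+ t :* d :* t))
      ( :1 ⟪ t :* s ≣ s :* t ⟫ :1
      ∷ t :* d ⟪ t :* s ≣ s :* t ⟫ :1
      ∷ t ⟪ d :* s ≣ s :* d ⟫ t
      ∷ :1 ⟪ t :* s ≣ s :* t ⟫ (d :* t)
      ∷ [])
      (ts , ts , commutesBelow-D m (ℕ.<-trans (ℕ.n<1+n m) m<n) i i<m , ts , tt) ≡.refl
      where t = var 0
            s = var 1
            d = var 2
            ts = comm (s≤s i<m) m<n
    commutesBelow-D (suc zero)    m<n i i<sm | inj₂ ≡.refl = certify [] (T 0 ∷ D 2 ∷ [])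
      (d :* t) (t :* d) (d ⟪ t ≣ :0 ⟫ :1 ∷ (:0 :- :1) ⟪ t ≣ :0 ⟫ d ∷ []) (T-zero , T-zero , tt) ≡.refl
      where t = var 0
            d = var 1
    commutesBelow-D (suc (suc m)) m<n i i<sm | inj₂ ≡.refl =
      certify (qᶜ ∷ []) (T (suc (suc m)) ∷ T (suc m) ∷ D (suc m) ∷ [])
      (x :* s) (s :* x)
      ( :1 ⟪ t :* t ≣ (u :- :1) :* t :+ u ⟫ s
      ∷ (:0 :- s) ⟪ t :* t ≣ (u :- :1) :* t :+ u ⟫ :1
      ∷ t ⟪ s :* (t :* s) ≣ t :* (s :* t) ⟫ :1
      ∷ :1 ⟪ t :* t ≣ (u :- :1) :* t :+ u ⟫ (s :* t)
      ∷ (:0 :- :1) ⟪ s :* (t :* s) ≣ t :* (s :* t) ⟫ t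
      ∷ (:0 :- t :* s) ⟪ t :* t ≣ (u :- :1) :* t :+ u ⟫ :1
      ∷ t :* s :* e ⟪ s :* (t :* s) ≣ t :* (s :* t) ⟫ :1
      ∷ t :* s ⟪ e :* t ≣ t :* e ⟫ (s :* t)
      ∷ (:0 :- :1) ⟪ s :* (t :* s) ≣ t :* (s :* t) ⟫ (e :* s :* t)
      ∷ [])
      (sq , sq , br , sq , br , sq , br , sym (commute-D (suc m) (commutesBelow-T m<n)) , br , tt) ≡.refl
      where u = cvar 0
            t = var 0
            s = var 1
            e = var 2
            x = :1 :+ t :+ t :* (:1 :+ s :+ s :* e :* s) :* t
            sq = T-quadratic m<n
            br = braid (suc m) m<n

    P-one : ∀ m → P m 1 ≈ B* m * B m
    P-one zero    = sym (zeroˡ 0#)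
    P-one (suc m) = *-congʳ (*-identityʳ _)

    recursion : ∀ k m → m < n →
      qpow k * (B (suc m) * P (suc m) (suc k)) ≈
      (qpow k * qpow k * q * P m (suc k) + qint (suc k) * ((D (suc m) - qint k) * P m k)) * B (suc m)
    recursion zero m m<n = certify (qᶜ ∷ [])
      (B (suc m) ∷ B* (suc m) ∷ B m ∷ B* m ∷ T m ∷ D (suc m) ∷ P m 1 ∷ [])
      (:1 :* (b :* (b* :* :1 :* b))) ((:1 :* :1 :* u :* p :+ (:1 :+ u :* :0) :* ((d :- :0) :* :1)) :* b)
      ( :1 ⟪ b :* b* ≣ d :+ a* :* t :* a ⟫ b
      ∷ a* ⟪ t :* (a :* b) ≣ u :* (a :* b) ⟫ :1
      ∷ (:0 :- u) ⟪ p ≣ a* :* a ⟫ b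
      ∷ [])
      (mackey m m<n , absorb m m<n , P-one m , tt) ≡.refl
      where u = cvar 0
            b = var 0
            b* = var 1
            a = var 2
            a* = var 3
            t = var 4
            d = var 5
            p = var 6
    recursion (suc k) zero m<n = certify (qpowᶜ (suc k) ∷ qᶜ ∷ qintᶜ (suc (suc k)) ∷ qintᶜ (suc k) ∷ [])
      (B 1 ∷ B* 1 ∷ D 1 ∷ [])
      (w :* (b :* (b* :* :0 :* b))) ((w :* w :* u :* :0 :+ i :* ((d :- j) :* :0)) :* b) [] tt ≡.refl
      where w = cvar 0
            u = cvar 1
            i = cvar 2
            j = cvar 3
            b = var 0
            b* = var 1
            d = var 2
    recursion (suc k) (suc m) m<n = certify (qᶜ ∷ qpowᶜ k ∷ qintᶜ k ∷ qintᶜ (suc k) ∷ qintᶜ (suc (suc k)) ∷ [])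
      (T (suc m) ∷ B (suc (suc m)) ∷ B* (suc (suc m)) ∷ B (suc m) ∷ B* (suc m) ∷ P m k ∷ P m (suc k)
        ∷ D (suc m) ∷ D (suc (suc m)) ∷ [])
      (u :* w :* (b :* (b* :* p :* b)))
      ((u :* w :* (u :* w) :* u :* (a* :* s :* a) :+ k₂ :* ((e :- k₁) :* p)) :* b)
      -- The summand with B* T B meets the induction hypothesis, after which T travels right past
      -- the inner P until `absorb` applies.
      ( u :* w ⟪ b :* b* ≣ e :+ a* :* t :* a ⟫ (p :* b)
      ∷ u :* a* :* t ⟪ w :* (a :* p) ≣ (w :* w :* u :* s :+ k₁ :* ((d :- k₀) :* r)) :* a ⟫ b
      ∷ u :* w :* w :* u :* a* ⟪ t :* s ≣ s :* t ⟫ (a :* b)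
      ∷ u :* w :* w :* u :* a* :* s ⟪ t :* (a :* b) ≣ u :* (a :* b) ⟫ :1
      ∷ u :* k₁ :* a* :* t ⟪ d :* r ≣ r :* d ⟫ (a :* b)
      ∷ u :* k₁ :* a* ⟪ t :* r ≣ r :* t ⟫ (d :* a :* b)
      -- `absorb` is used backwards: the scalar q becomes a T to the right of D, and T D T is the
      -- next D minus 1 + T. The new D then commutes out to the left.
      ∷ (:0 :- k₁ :* a* :* r :* t :* d) ⟪ t :* (a :* b) ≣ u :* (a :* b) ⟫ :1
      ∷ (:0 :- k₁ :* a* :* r) ⟪ e ≣ :1 :+ t :+ t :* d :* t ⟫ (a :* b)
      ∷ (:0 :- k₁ :* a*) ⟪ e :* r ≣ r :* e ⟫ (a :* b)
      ∷ (:0 :- k₁) ⟪ e :* a* ≣ a* :* e ⟫ (r :* a :* b)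
      ∷ (:0 :- k₁ :* a* :* r) ⟪ t :* (a :* b) ≣ u :* (a :* b) ⟫ :1
      ∷ (:0 :- u :* k₁ :* k₀ :* a*) ⟪ t :* r ≣ r :* t ⟫ (a :* b)
      ∷ (:0 :- u :* k₁ :* k₀ :* a* :* r) ⟪ t :* (a :* b) ≣ u :* (a :* b) ⟫ :1
      ∷ (:0 :- e) ⟪ k₂ ≣ k₁ :+ u :* w ⟫ (p :* b)
      ∷ k₁ ⟪ k₂ ≣ :1 :+ u :* k₁ ⟫ (p :* b)
      ∷ u :* k₁ ⟪ k₁ ≣ :1 :+ u :* k₀ ⟫ (p :* b)
      ∷ [])
      ( mackey (suc m) m<n , recursion k m (ℕ.<-trans (ℕ.n<1+n m) m<n)
      , commute-P m (suc k) below-T , ab , commute-P m k (commutesBelow-D m (ℕ.<-trans (ℕ.n<1+n m) m<n))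
      , tr , ab , refl , commute-P m k (weaken below-D) , commute-B* (suc m) below-D , ab , tr , ab
      , qint-suc (suc k) , refl , refl , tt) ≡.refl
      where
      u = cvar 0
      w = cvar 1
      k₀ = cvar 2
      k₁ = cvar 3
      k₂ = cvar 4
      t = var 0
      b = var 1
      b* = var 2
      a = var 3
      a* = var 4
      r = var 5
      s = var 6
      d = var 7
      e = var 8
      p = a* :* r :* a
      below-T : CommutesBelow m (T (suc m))
      below-T = commutesBelow-T m<n
      below-D : CommutesBelow (suc m) (D (suc (suc m)))
      below-D = commutesBelow-D (suc m) m<n
      ab = absorb (suc m) m<n
      tr = commute-P m k below-T

    -- Divisibility by [k]!_q through symmetry under the last k letters

    Sym : ℕ → ℕ → Carrier → Set ℓ
    Sym m k x = ∀ i → suc i < m → m ≤ i +ℕ k → T (suc i) * x ≈ q * x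

    -- `m ≤ i +ℕ k` selects the generators T_{m-k+1}, ..., T_{m-1} of the factor S_k; lowering m and
    -- k together keeps the lower end and drops the top generator.
    Sym-lower : ∀ {m k x} → Sym (suc m) (suc k) x → Sym m k x
    Sym-lower {m} {k} h i i<m m≤ = h i (ℕ.m≤n⇒m≤1+n i<m) (≡.subst (suc m ≤_) (≡.sym (ℕ.+-suc i k)) (s≤s m≤))

    -- `C m k` runs along a cycle, and conjugation by the cycle shifts indices by one. The generator
    -- passes the higher letters until it meets T_{i+2} T_{i+1}, where one braid relation shifts it,
    -- and then passes the lower letters.
    C-shift : ∀ m k i → m < n → suc i < m → m ≤ suc i +ℕ k → T (suc i) * C m k ≈ C m k * T (suc (suc i))
    C-shift m       zero    i m<n i<m m≤ = contradiction (≡.subst (m ≤_) (ℕ.+-identityʳ (suc i)) m≤) (ℕ.<⇒≱ i<m)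
    C-shift (suc m) (suc k) i m<n i<m m≤ with ℕ.m≤n⇒m<n∨m≡n (ℕ.s≤s⁻¹ i<m)
    ... | inj₁ si<m = certify [] (T (suc i) ∷ T (suc m) ∷ C m k ∷ T (suc (suc i)) ∷ [])
      (s :* (t :* x)) (t :* x :* r)
      (:1 ⟪ s :* t ≣ t :* s ⟫ x ∷ t ⟪ s :* x ≣ x :* r ⟫ :1 ∷ [])
      (sym (comm (s≤s si<m) m<n)
      , C-shift m k i (ℕ.<-trans (ℕ.n<1+n m) m<n) si<m (ℕ.s≤s⁻¹ (≡.subst (suc m ≤_) (ℕ.+-suc (suc i) k) m≤)) , tt) ≡.refl
      where s = var 0
            t = var 1
            x = var 2
            r = var 3
    C-shift (suc m) (suc zero)    i m<n i<m m≤ | inj₂ ≡.refl = trans (braid (suc i) m<n) (sym (*-assoc _ _ _))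
    C-shift (suc m) (suc (suc k)) i m<n i<m m≤ | inj₂ ≡.refl = certify []
      (T (suc i) ∷ T (suc (suc i)) ∷ C i k ∷ [])
      (s :* (t :* (s :* x))) (t :* (s :* x) :* t)
      (:1 ⟪ s :* (t :* s) ≣ t :* (s :* t) ⟫ x ∷ t :* s ⟪ t :* x ≣ x :* t ⟫ :1 ∷ [])
      (braid (suc i) m<n , commute-C i k (commutesBelow-T m<n) , tt) ≡.refl
      where s = var 0
            t = var 1
            x = var 2

    Sym-C : ∀ m k {x} → m < n → Sym (suc m) (suc k) x → Sym m (suc k) (C m k * x)
    Sym-C m k {x} m<n h i i<m m≤ = certify (qᶜ ∷ []) (T (suc i) ∷ T (suc (suc i)) ∷ C m k ∷ x ∷ [])
      (s :* (y :* z)) (u :* (y :* z))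
      (:1 ⟪ s :* y ≣ y :* t ⟫ z ∷ y ⟪ t :* z ≣ u :* z ⟫ :1 ∷ [])
      (C-shift m k i m<n i<m (≡.subst (m ≤_) (ℕ.+-suc i k) m≤) , h (suc i) (s≤s i<m) (s≤s m≤) , tt) ≡.refl
      where u = cvar 0
            s = var 0
            t = var 1
            y = var 2
            z = var 3

    -- The right-hand side counts each coset k + 1 times, up to powers of q
    -- absorbed by the symmetry of x.
    B*-X : ∀ m k {x} → m < n → Sym (suc m) (suc k) x →
           B* (suc m) * (X m k * x) ≈ qint (suc k) * (X (suc m) (suc k) * x)
    B*-X zero zero {x} _ _ = certify (qᶜ ∷ []) (T 0 ∷ x ∷ [])
      ((:1 :+ :0 :* t) :* (:1 :* z)) ((:1 :+ u :* :0) :* ((:1 :+ :0 :* t) :* z)) [] tt ≡.refl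
      where u = cvar 0
            t = var 0
            z = var 1
    B*-X zero (suc k) {x} _ _ = certify (qintᶜ (suc (suc k)) ∷ []) (T 0 ∷ x ∷ [])
      ((:1 :+ :0 :* t) :* (:0 :* z)) (cvar 0 :* ((:0 :+ :0 :* :0) :* z)) [] tt ≡.refl
      where t = var 0
            z = var 1
    B*-X (suc m) zero {x} m<n h = certify (qᶜ ∷ []) (T (suc m) ∷ B* (suc m) ∷ X (suc m) 1 ∷ x ∷ [])
      ((:1 :+ b :* t) :* (:1 :* z)) (i :* ((:1 :+ y :* t) :* z))
      (:1 ⟪ b :* (:1 :* (t :* z)) ≣ i :* (y :* (t :* z)) ⟫ :1 ∷ [])
      (B*-X m zero (ℕ.<-trans (ℕ.n<1+n m) m<n) (Sym-C (suc m) zero m<n h) , tt) ≡.refl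
      where i = :1 :+ cvar 0 :* :0
            t = var 0
            b = var 1
            y = var 2
            z = var 3
    B*-X (suc m) (suc k) {x} m<n h = certify (qᶜ ∷ qintᶜ (suc k) ∷ [])
      (T (suc m) ∷ B* (suc m) ∷ X m k ∷ X m (suc k) ∷ C m k ∷ X (suc m) (suc (suc k)) ∷ x ∷ [])
      ((:1 :+ b :* t) :* (w :* z)) ((:1 :+ u :* i) :* ((w :+ y :* (t :* d)) :* z))
      -- On the first half of X the letter T_{m+1} reaches x and becomes q, giving [k+2]_q as 1 + q
      -- [k+1]_q. On the second half it is the first letter of `C (suc m) (suc k)`, and the
      -- induction hypothesis is used for `C (suc m) (suc k) * x`.
      ( b ⟪ t :* v ≣ v :* t ⟫ z
      ∷ b :* v ⟪ t :* z ≣ u :* z ⟫ :1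
      ∷ u ⟪ b :* (v :* z) ≣ i :* (w :* z) ⟫ :1
      ∷ b ⟪ t :* v′ ≣ v′ :* t ⟫ (d :* z)
      ∷ :1 ⟪ b :* (v′ :* (t :* d :* z)) ≣ (:1 :+ u :* i) :* (y :* (t :* d :* z)) ⟫ :1
      ∷ [])
      ( commute-X m k (commutesBelow-T m<n)
      , h m ℕ.≤-refl (≡.subst (suc (suc m) ≤_) (≡.sym (≡.trans (ℕ.+-suc m (suc k)) (≡.cong suc (ℕ.+-suc m k))))
                        (s≤s (s≤s (ℕ.m≤m+n m k))))
      , B*-X m k m<n′ (Sym-lower h) , commute-X m (suc k) (commutesBelow-T m<n)
      , B*-X m (suc k) m<n′ (Sym-C (suc m) (suc k) m<n h) , tt) ≡.refl
      where
      u = cvar 0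
      i = cvar 1
      t = var 0
      b = var 1
      v = var 2
      v′ = var 3
      d = var 4
      y = var 5
      z = var 6
      w = v :+ v′ :* d
      m<n′ = ℕ.<-trans (ℕ.n<1+n m) m<n

    -- For k ≤ m a minimal representative of S_m / S_{m-k} is one of S_m / (S_{m-k} × S_k) times an
    -- element of S_k, and an element of length ℓ in S_k acts on x by q^ℓ. The product [1]_q ⋯ [k]_q
    -- accumulates factor by factor from `B*-X`.
    B*k-X : ∀ m k {x} → m ≤ n → Sym m k x → B*k m k * x ≈ qfact k * (X m k * x)
    B*k-X m       zero    _   _ = sym (*-identityˡ _)
    B*k-X zero    (suc k) {x} _ _ = certify (qfactᶜ (suc k) ∷ []) (B*k zero k ∷ x ∷ [])
      (:0 :* var 0 :* var 1) (cvar 0 :* (:0 :* var 1)) [] tt ≡.refl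
    B*k-X (suc m) (suc k) {x} m<n h = certify (qfactᶜ k ∷ qintᶜ (suc k) ∷ [])
      (B* (suc m) ∷ B*k m k ∷ X m k ∷ X (suc m) (suc k) ∷ x ∷ [])
      (b :* bk :* z) (f :* i :* (y′ :* z))
      (b ⟪ bk :* z ≣ f :* (y :* z) ⟫ :1 ∷ f ⟪ b :* (y :* z) ≣ i :* (y′ :* z) ⟫ :1 ∷ [])
      (B*k-X m k (ℕ.<⇒≤ m<n) (Sym-lower h) , B*-X m k m<n h , tt) ≡.refl
      where f = cvar 0
            i = cvar 1
            b = var 0
            bk = var 1
            y = var 2
            y′ = var 3
            z = var 4

    -- T_i commutes with the factors B_j for j < i, meets B_i B_{i+1}, and is absorbed there.
    Sym-Bk : ∀ m k → m ≤ n → Sym m k (Bk m k)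
    Sym-Bk m       zero    _   i i<m m≤ = contradiction (ℕ.m≤n⇒m≤1+n (≡.subst (m ≤_) (ℕ.+-identityʳ i) m≤)) (ℕ.<⇒≱ i<m)
    Sym-Bk (suc m) (suc k) m<n i i<m m≤ with ℕ.m≤n⇒m<n∨m≡n (ℕ.s≤s⁻¹ i<m)
    ... | inj₁ si<m = trans (sym (*-assoc _ _ _))
      (trans (*-congʳ (Sym-Bk m k (ℕ.<⇒≤ m<n) i si<m (ℕ.s≤s⁻¹ (≡.subst (suc m ≤_) (ℕ.+-suc i k) m≤))))
             (*-assoc _ _ _))
    Sym-Bk (suc m) (suc zero)    m<n i i<m m≤ | inj₂ ≡.refl =
      contradiction (≡.subst (suc (suc i) ≤_) (≡.trans (ℕ.+-suc i 0) (≡.cong suc (ℕ.+-identityʳ i))) m≤) (ℕ.<⇒≱ ℕ.≤-refl)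
    Sym-Bk (suc m) (suc (suc k)) m<n i i<m m≤ | inj₂ ≡.refl = certify (qᶜ ∷ [])
      (T (suc i) ∷ Bk i k ∷ B (suc i) ∷ B (suc (suc i)) ∷ [])
      (t :* (g :* a :* b)) (u :* (g :* a :* b))
      (:1 ⟪ t :* g ≣ g :* t ⟫ (a :* b) ∷ g ⟪ t :* (a :* b) ≣ u :* (a :* b) ⟫ :1 ∷ [])
      (commute-Bk i k (commutesBelow-T m<n) , absorb (suc i) m<n , tt) ≡.refl
      where u = cvar 0
            t = var 0
            g = var 1
            a = var 2
            b = var 3

    B*k-Bk : ∀ m k → B*k m k * Bk m k ≈ P m k
    B*k-Bk m       zero    = *-identityˡ 1#
    B*k-Bk zero    (suc k) = trans (*-congʳ (zeroˡ _)) (zeroˡ _)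
    B*k-Bk (suc m) (suc k) = trans (sym (*-assoc _ _ _)) (*-congʳ (trans (*-assoc _ _ _) (*-congˡ (B*k-Bk m k))))

    r : ℕ → ℕ → Carrier
    r m k = X m k * Bk m k

    P-divisible : ∀ m k → m ≤ n → P m k ≈ qfact k * r m k
    P-divisible m k m≤n = trans (sym (B*k-Bk m k)) (B*k-X m k m≤n (Sym-Bk m k m≤n))

    -- The factor [k+1]! stays on both sides because the abstract ring offers no cancellation; it is
    -- removed over ℤ[q] only. On the right it arises as [k]! [k+1]_q.
    recursion-r : ∀ k m → m < n →
      qfact (suc k) * (qpow k * (B (suc m) * r (suc m) (suc k))) ≈
      qfact (suc k) * ((qpow k * qpow k * q * r m (suc k) + (D (suc m) - qint k) * r m k) * B (suc m))
    recursion-r k m m<n = certify (qᶜ ∷ qpowᶜ k ∷ qintᶜ k ∷ qintᶜ (suc k) ∷ qfactᶜ k ∷ qfactᶜ (suc k) ∷ [])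
      (B (suc m) ∷ D (suc m) ∷ P (suc m) (suc k) ∷ P m (suc k) ∷ P m k
        ∷ r (suc m) (suc k) ∷ r m (suc k) ∷ r m k ∷ [])
      (f₁ :* (w :* (b :* r₂))) (f₁ :* ((w :* w :* u :* r₁ :+ (d :- k₀) :* r₀) :* b))
      ( (:0 :- w :* b) ⟪ p₂ ≣ f₁ :* r₂ ⟫ :1
      ∷ :1 ⟪ w :* (b :* p₂) ≣ (w :* w :* u :* p₁ :+ k₁ :* ((d :- k₀) :* p₀)) :* b ⟫ :1
      ∷ w :* w :* u ⟪ p₁ ≣ f₁ :* r₁ ⟫ b
      ∷ k₁ :* (d :- k₀) ⟪ p₀ ≣ f₀ :* r₀ ⟫ b
      ∷ (:0 :- :1) ⟪ f₁ ≣ f₀ :* k₁ ⟫ ((d :- k₀) :* r₀ :* b)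
      ∷ [])
      (P-divisible (suc m) (suc k) m<n , recursion k m m<n , P-divisible m (suc k) (ℕ.<⇒≤ m<n)
      , P-divisible m k (ℕ.<⇒≤ m<n) , refl , tt) ≡.refl
      where
      u = cvar 0
      w = cvar 1
      k₀ = cvar 2
      k₁ = cvar 3
      f₀ = cvar 4
      f₁ = cvar 5
      b = var 0
      d = var 1
      p₂ = var 2
      p₁ = var 3
      p₀ = var 4
      r₂ = var 5
      r₁ = var 6
      r₀ = var 7

    -- The Jucys-Murphy sum inside D

    Σ<-conjugate : ∀ {f g} t m → (∀ i → i < m → g i ≈ t * f i * t) → Σ< g m ≈ t * Σ< f m * t
    Σ<-conjugate t zero    h = sym (trans (*-congʳ (zeroʳ t)) (zeroˡ t))
    Σ<-conjugate t (suc m) h = trans (+-cong (Σ<-conjugate t m (λ i i<m → h i (ℕ.m≤n⇒m≤1+n i<m))) (h m ℕ.≤-refl))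
      (sym (trans (*-congʳ (distribˡ t _ _)) (distribʳ t _ _)))

    -- Conjugation by T_{m+1} lengthens every transposition already present. The new one, s_{m+1},
    -- receives the coefficient 1 + (q - 1)[m+1]_q = q^(m+1) from T_{m+1} and from the square of
    -- T_{m+1}, and the constant becomes 1 + q [m+1]_q.
    D-jucysMurphy : ∀ m → m < n → D (suc m) ≈ qint (suc m) + Σ< (λ i → qpow (suc i) * τ (suc i) (suc m)) m
    D-jucysMurphy zero    _   = certify (qᶜ ∷ []) (T 0 ∷ [])
      (:1 :+ t :+ t :* :0 :* t) (:1 :+ cvar 0 :* :0 :+ :0) (:1 ⟪ t ≣ :0 ⟫ :1 ∷ []) (T-zero , tt) ≡.refl
      where t = var 0
    D-jucysMurphy (suc m) m<n = certify (qᶜ ∷ qintᶜ (suc m) ∷ qpowᶜ (suc m) ∷ [])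
      (T (suc m) ∷ D (suc m) ∷ Σ< (λ i → qpow (suc i) * τ (suc i) (suc m)) m
        ∷ Σ< (λ i → qpow (suc i) * τ (suc i) (suc (suc m))) m ∷ τ (suc m) (suc (suc m)) ∷ [])
      (:1 :+ t :+ t :* d :* t) (:1 :+ u :* k :+ (s′ :+ w :* y))
      ( t ⟪ d ≣ k :+ s ⟫ t
      ∷ k ⟪ t :* t ≣ (u :- :1) :* t :+ u ⟫ :1
      ∷ (:0 :- :1) ⟪ s′ ≣ t :* s :* t ⟫ :1
      ∷ (:0 :- w) ⟪ y ≣ t ⟫ :1
      ∷ :1 ⟪ :1 :+ u :* k ≣ k :+ w ⟫ t
      ∷ [])
      ( D-jucysMurphy m (ℕ.<-trans (ℕ.n<1+n m) m<n) , T-quadratic m<n , Σ<-conjugate (T (suc m)) m conjugate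
      , reflexive (τ-last (suc m))
      , qint-suc (suc m) , tt) ≡.refl
      where
      u = cvar 0
      k = cvar 1
      w = cvar 2
      t = var 0
      d = var 1
      s = var 2
      s′ = var 3
      y = var 4
      conjugate : ∀ i → i < m → qpow (suc i) * τ (suc i) (suc (suc m))
                              ≈ T (suc m) * (qpow (suc i) * τ (suc i) (suc m)) * T (suc m)
      conjugate i i<m = trans (*-congˡ (reflexive (τ-step (s≤s i<m)))) (certify (qpowᶜ (suc i) ∷ []) (T (suc m) ∷ τ (suc i) (suc m) ∷ [])
        (cvar 0 :* (var 0 :* var 1 :* var 0)) (var 0 :* (cvar 0 :* var 1) :* var 0) [] tt ≡.refl)

-- The concrete elements of the Hecke algebra

ascRange-∷ʳ : ∀ {t m} → t < m → ascRange (suc t) (suc m) ≡ ascRange (suc t) m ∷ʳ m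
ascRange-∷ʳ {t} {m} t<m = begin
  map (suc t +ℕ_) (upTo (m ∸ t))                       ≡⟨ ≡.cong (map (suc t +ℕ_) ∘ upTo) (ℕ.+-∸-assoc 1 t<m) ⟩
  map (suc t +ℕ_) (upTo (suc d))                       ≡⟨ ≡.cong (map (suc t +ℕ_)) (upTo-∷ʳ d) ⟨
  map (suc t +ℕ_) (upTo d ∷ʳ d)                        ≡⟨ map-++ (suc t +ℕ_) (upTo d) (d ∷ []) ⟩
  ascRange (suc t) m ∷ʳ (suc t +ℕ d)                   ≡⟨ ≡.cong (ascRange (suc t) m ∷ʳ_) (ℕ.m+[n∸m]≡n t<m) ⟩
  ascRange (suc t) m ∷ʳ m                              ∎
  where open ≡.≡-Reasoning
        d = m ∸ suc t

descRange-∷ : ∀ {t m} → t < m → descRange (suc t) (suc m) ≡ m ∷ descRange (suc t) m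
descRange-∷ {t} {m} t<m = ≡.trans (≡.cong reverse (ascRange-∷ʳ t<m)) (reverse-++ (ascRange (suc t) m) (m ∷ []))

ascRange-empty : ∀ m → ascRange (suc m) (suc m) ≡ []
ascRange-empty m = ≡.cong (map (suc m +ℕ_) ∘ upTo) (ℕ.n∸n≡0 m)

data Letter (n : ℕ) : ℕ → Set where
  letter : ∀ {i} → suc i < n → Letter n (suc i)

ascRange-letters : ∀ {n} t m → m ≤ n → All (Letter n) (ascRange (suc t) m)
ascRange-letters {n} t m m≤n = All.map⁺ (All.map (λ {i} i< → letter (in-range i i<)) (All.all-upTo (m ∸ suc t)))
  where
  in-range : ∀ i → i < m ∸ suc t → suc (t +ℕ i) < n
  in-range i i< = ℕ.<-≤-trans (≡.subst (suc (t +ℕ i) <_) (ℕ.m+[n∸m]≡n t<m) (ℕ.+-monoʳ-< (suc t) i<)) m≤n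
    where
    t<m : t < m
    t<m = ℕ.<⇒≤ (ℕ.m∸n≢0⇒n<m {m} {suc t} (λ e → ℕ.n≮0 (≡.subst (i <_) e i<)))

-- The palindromic reduced word of a transposition

swapV-below : ∀ {i v} → v < i → swapV (suc i) v ≡ v
swapV-below {i} v<i = swapV-other i (ℕ.<⇒≢ v<i) (ℕ.<⇒≢ (ℕ.m≤n⇒m≤1+n v<i))

swapV-above : ∀ {i v} → suc i < v → swapV (suc i) v ≡ v
swapV-above {i} i<v = swapV-other i (ℕ.<⇒≢ (ℕ.<-trans (ℕ.n<1+n i) i<v) ∘ ≡.sym) (ℕ.<⇒≢ i<v ∘ ≡.sym)

slot-up-below : ∀ a D {v} → v < a → slot (up (suc a) D) v ≡ v
slot-up-below a zero    v<a = swapV-below v<a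
slot-up-below a (suc D) v<a = ≡.trans (≡.cong (slot (up (suc (suc a)) D)) (swapV-below v<a))
                                      (slot-up-below (suc a) D (ℕ.m≤n⇒m≤1+n v<a))

slot-up-first : ∀ a D → slot (up (suc a) D) a ≡ suc a +ℕ D
slot-up-first a zero    = ≡.trans (swapV-lower a) (≡.sym (ℕ.+-identityʳ (suc a)))
slot-up-first a (suc D) = ≡.trans (≡.cong (slot (up (suc (suc a)) D)) (swapV-lower a))
                          (≡.trans (slot-up-first (suc a) D) (≡.sym (ℕ.+-suc (suc a) D)))

slot-up-shift : ∀ a D e → e ≤ D → slot (up (suc a) D) (suc a +ℕ e) ≡ a +ℕ e
slot-up-shift a zero zero _ rewrite ℕ.+-identityʳ a = swapV-upper a
slot-up-shift a (suc D) zero _ rewrite ℕ.+-identityʳ a | swapV-upper a = slot-up-below (suc a) D (ℕ.n<1+n a)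
slot-up-shift a (suc D) (suc e) (s≤s e≤D) rewrite ℕ.+-suc a e =
  ≡.trans (≡.cong (slot (up (suc (suc a)) D)) (swapV-above (s≤s (s≤s (ℕ.m≤m+n a e))))) (slot-up-shift (suc a) D e e≤D)

reduced-up : ∀ {n} a D → suc a +ℕ D < n → ∃ (Reduced n (up (suc a) D))
reduced-up {n} a zero    a<n =
  _ , extend a (≡.subst (_< n) (ℕ.+-identityʳ (suc a)) a<n) [] ≡.refl ≡.refl (ℕ.n<1+n a)
reduced-up {n} a (suc D) a<n = _ , extend a (ℕ.≤-<-trans (ℕ.m≤m+n (suc a) (suc D)) a<n)
  (proj₂ (reduced-up (suc a) D (≡.subst (_< n) (ℕ.+-suc (suc a) D) a<n)))
  (slot-up-below (suc a) D (ℕ.n<1+n a)) (slot-up-first (suc a) D)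
  (ℕ.≤-trans (ℕ.n≤1+n (suc a)) (ℕ.m≤m+n (suc (suc a)) D))

slot-down-above : ∀ a d {v is} → suc a +ℕ d < v → slot (down a d ++ is) v ≡ slot is v
slot-down-above a zero    _   = ≡.refl
slot-down-above a (suc d) {v} {is} d<v rewrite ℕ.+-suc a d =
  ≡.trans (≡.cong (slot (down a d ++ is)) (swapV-above d<v)) (slot-down-above a d (ℕ.<-trans (ℕ.n<1+n _) d<v))

slot-down-last : ∀ a d {is} → slot (down a d ++ is) (suc a +ℕ d) ≡ slot is (suc a)
slot-down-last a zero    rewrite ℕ.+-identityʳ a = ≡.refl
slot-down-last a (suc d) {is} rewrite ℕ.+-suc a d =
  ≡.trans (≡.cong (slot (down a d ++ is)) (swapV-upper (suc a +ℕ d))) (slot-down-last a d)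

-- D is fixed while the descending half grows by one letter at a time. The two values exchanged by
-- the next letter occupy positions a and a + d + 1 in this order, so it is an ascent.
reduced-down-up : ∀ {n} a D d → suc a +ℕ D < n → d ≤ D → ∃ (Reduced n (down a d ++ up (suc a) D))
reduced-down-up a D zero    a<n _   = reduced-up a D a<n
reduced-down-up {n} a D (suc d) a<n d<D = _ , extend (suc a +ℕ d) in-range
  (proj₂ (reduced-down-up a D d a<n (ℕ.<⇒≤ d<D)))
  (≡.trans (slot-down-last a d) (≡.trans (≡.cong (slot (up (suc a) D)) (≡.sym (ℕ.+-identityʳ (suc a))))
    (≡.trans (slot-up-shift a D 0 z≤n) (ℕ.+-identityʳ a))))
  (≡.trans (slot-down-above a d (ℕ.n<1+n (suc a +ℕ d))) (≡.trans
    (≡.cong (slot (up (suc a) D)) (≡.sym (ℕ.+-suc (suc a) d))) (slot-up-shift a D (suc d) d<D)))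
  (ℕ.m<m+n a (s≤s z≤n))
  where
  in-range : suc (suc a +ℕ d) < n
  in-range = ℕ.≤-<-trans (≡.subst (_≤ suc a +ℕ D) (ℕ.+-suc (suc a) d) (ℕ.+-monoʳ-≤ (suc a) d<D)) a<n

-- The permutation of a word as a function, whereas `slot` is its inverse: `slot` decides
-- reducedness and `act` gives the one-line notation.
act : List ℕ → ℕ → ℕ
act is v = foldr swapV v is

act-up-below : ∀ a D {v} → v < a → act (up (suc a) D) v ≡ v
act-up-below a zero    v<a = swapV-below v<a
act-up-below a (suc D) v<a = ≡.trans (≡.cong (swapV (suc a)) (act-up-below (suc a) D (ℕ.m≤n⇒m≤1+n v<a))) (swapV-below v<a)

act-up-last : ∀ a D → act (up (suc a) D) (suc a +ℕ D) ≡ a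
act-up-last a zero    rewrite ℕ.+-identityʳ a = swapV-upper a
act-up-last a (suc D) rewrite ℕ.+-suc a D = ≡.trans (≡.cong (swapV (suc a)) (act-up-last (suc a) D)) (swapV-upper a)

act-up-mid : ∀ a D e → e ≤ D → act (up (suc a) D) (a +ℕ e) ≡ suc a +ℕ e
act-up-mid a zero zero _ rewrite ℕ.+-identityʳ a = swapV-lower a
act-up-mid a (suc D) zero _ rewrite ℕ.+-identityʳ a | act-up-below (suc a) D (ℕ.n<1+n a) = swapV-lower a
act-up-mid a (suc D) (suc e) (s≤s e≤D) rewrite ℕ.+-suc a e | act-up-mid (suc a) D e e≤D =
  swapV-above (s≤s (s≤s (ℕ.m≤m+n a e)))

act-down-below : ∀ a d {v} → v < suc a → act (down a d) v ≡ v
act-down-below a zero    v<a = ≡.refl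
act-down-below a (suc d) v<a = ≡.trans (≡.cong (swapV (suc (suc a +ℕ d))) (act-down-below a d v<a))
  (swapV-below (ℕ.<-≤-trans v<a (ℕ.m≤m+n (suc a) d)))

act-down-above : ∀ a d {v} → suc a +ℕ d < v → act (down a d) v ≡ v
act-down-above a zero    _   = ≡.refl
act-down-above a (suc d) d<v rewrite ℕ.+-suc a d =
  ≡.trans (≡.cong (swapV (suc (suc a +ℕ d))) (act-down-above a d (ℕ.<-trans (ℕ.n<1+n _) d<v))) (swapV-above d<v)

act-down-first : ∀ a d → act (down a d) (suc a) ≡ suc a +ℕ d
act-down-first a zero    = ≡.sym (ℕ.+-identityʳ (suc a))
act-down-first a (suc d) = ≡.trans (≡.cong (swapV (suc (suc a +ℕ d))) (act-down-first a d))
  (≡.trans (swapV-lower (suc a +ℕ d)) (≡.sym (ℕ.+-suc (suc a) d)))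

act-down-mid : ∀ a d e → e < d → act (down a d) (suc (suc a +ℕ e)) ≡ suc a +ℕ e
act-down-mid a (suc d) e e<sd with ℕ.m≤n⇒m<n∨m≡n (ℕ.s≤s⁻¹ e<sd)
... | inj₁ e<d  = ≡.trans (≡.cong (swapV (suc (suc a +ℕ d))) (act-down-mid a d e e<d))
                          (swapV-below (ℕ.+-monoʳ-< (suc a) e<d))
... | inj₂ ≡.refl = ≡.trans (≡.cong (swapV (suc (suc a +ℕ d))) (act-down-above a d (ℕ.n<1+n _))) (swapV-upper (suc a +ℕ d))

act-++ : ∀ is js v → act (is ++ js) v ≡ act is (act js v)
act-++ is js v = foldr-++ swapV v is js

exchange : ℕ → ℕ → ℕ → ℕ
exchange a m j = if j ≡ᵇ a then m else if j ≡ᵇ m then a else j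

act-palindrome : ∀ a D v → v ≤ suc a +ℕ D → act (down a D ++ up (suc a) D) v ≡ exchange a (suc a +ℕ D) v
act-palindrome a D v v≤m rewrite act-++ (down a D) (up (suc a) D) v with ℕ.<-cmp v a
... | tri< v<a _ _ rewrite ≡ᵇ-false (ℕ.<⇒≢ v<a) | ≡ᵇ-false (ℕ.<⇒≢ (ℕ.<-≤-trans v<a (ℕ.≤-trans (ℕ.n≤1+n a) (ℕ.m≤m+n (suc a) D))))
      | act-up-below a D v<a = act-down-below a D (ℕ.m≤n⇒m≤1+n v<a)
... | tri≈ _ ≡.refl _ rewrite ≡ᵇ-true {a} ≡.refl = ≡.trans (≡.cong (act (down a D))
        (≡.trans (≡.cong (act (up (suc a) D)) (≡.sym (ℕ.+-identityʳ a))) (≡.trans (act-up-mid a D 0 z≤n) (ℕ.+-identityʳ (suc a)))))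
        (act-down-first a D)
... | tri> _ v≢a a<v with ℕ.m≤n⇒m<n∨m≡n v≤m
...   | inj₂ ≡.refl rewrite ≡ᵇ-false v≢a | ≡ᵇ-true {a +ℕ D} ≡.refl | act-up-last a D = act-down-below a D (ℕ.n<1+n a)
...   | inj₁ v<m with ℕ.m≤n⇒∃[o]m+o≡n a<v
...     | e , ≡.refl rewrite ≡ᵇ-false v≢a | ≡ᵇ-false (ℕ.<⇒≢ (ℕ.s<s⁻¹ v<m)) =
  ≡.trans (≡.cong (act (down a D) ∘ act (up (suc a) D)) (≡.sym (ℕ.+-suc a e)))
  (≡.trans (≡.cong (act (down a D)) (≡.trans (act-up-mid a D (suc e) e<D) (ℕ.+-suc (suc a) e)))
           (act-down-mid a D e e<D))
  where
  e<D : e < D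
  e<D = ℕ.+-cancelˡ-< (suc a) e D v<m

map-cong-All : ∀ {f g : ℕ → ℕ} {ws} → All (λ v → f v ≡ g v) ws → map f ws ≡ map g ws
map-cong-All []       = ≡.refl
map-cong-All (e ∷ es) = ≡.cong₂ _∷_ e (map-cong-All es)

reduced-action : ∀ {n is w} → Reduced n is w → w ≡ map (act is) (upTo n)
reduced-action []                      = ≡.sym (map-id _)
reduced-action (cons {i} {is} i<n _ r) = ≡.trans (≡.cong (sAct (suc i)) (reduced-action r)) (≡.sym (map-∘ _))

palindrome-transp : ∀ {n a D w} → suc (suc a +ℕ D) ≡ n → Reduced n (down a D ++ up (suc a) D) w →
                    w ≡ transp n (suc a)
palindrome-transp {a = a} {D} ≡.refl r = ≡.trans (reduced-action r) (map-cong-All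
  (All.map (λ v< → act-palindrome a D _ (ℕ.s≤s⁻¹ v<)) (All.all-upTo (suc (suc a +ℕ D)))))

module Concrete {c ℓ} (R : CommutativeRing c ℓ) (q : CommutativeRing.Carrier R) (n : ℕ) where
  open CommutativeRing R hiding (ring; zero)
  private module H = Hecke rawRing q n
  open H using (_⊕_; _⊗_; _≈H_; ΣH; Tl; Tword; T[_]; Lword)
  open HeckeRing R q n
  open HeckeTheory ring (scalar q) gen
  open Relations n (scalar-central q) (λ _ → refl) gen-quadratic gen-braid gen-comm

  ΣH-cong-All : ∀ {f g : ℕ → H.H} {ts} → All (λ t → f t ≈H g t) ts → ΣH (map f ts) ≈H ΣH (map g ts)
  ΣH-cong-All []       w = refl
  ΣH-cong-All (e ∷ es) w = +-cong (e w) (ΣH-cong-All es w)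

  ΣH-∷ʳ : ∀ (f : ℕ → H.H) ts t → ΣH (map f (ts ∷ʳ t)) ≈H ΣH (map f ts) ⊕ f t
  ΣH-∷ʳ f []       t w = trans (+-identityʳ _) (sym (+-identityˡ _))
  ΣH-∷ʳ f (s ∷ ts) t w = trans (+-congˡ (ΣH-∷ʳ f ts t w)) (sym (+-assoc _ _ _))

  ΣH-upTo : ∀ (f : ℕ → H.H) m → ΣH (map f (upTo (suc m))) ≈H ΣH (map f (upTo m)) ⊕ f m
  ΣH-upTo f m w = trans (reflexive (≡.cong (λ ts → ΣH (map f ts) w) (≡.sym (upTo-∷ʳ m)))) (ΣH-∷ʳ f (upTo m) m w)

  equivariant-ΣH : ∀ {Θ} → Equivariant Θ → ∀ (f : ℕ → H.H) ts → Θ (ΣH (map f ts)) ≈H ΣH (map (Θ ∘ f) ts)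
  equivariant-ΣH a f []       = 0-homo a
  equivariant-ΣH a f (t ∷ ts) w = trans (Equivariant.⊕-homo a _ _ w) (+-congˡ (equivariant-ΣH a f ts w))

  ΣH-⊗ : ∀ (f : ℕ → H.H) ts y → ΣH (map f ts) ⊗ y ≈H ΣH (map (λ t → f t ⊗ y) ts)
  ΣH-⊗ f []       y w = trans (sumC-cong (perms n) (λ _ → zeroˡ _)) (sumC-zero (perms n))
    where
    sumC-zero : ∀ ws → H.sumC (map (λ _ → 0#) ws) ≈ 0#
    sumC-zero []       = refl
    sumC-zero (_ ∷ ws) = trans (+-identityˡ _) (sumC-zero ws)
  ΣH-⊗ f (t ∷ ts) y w = trans (⊗-distribʳ y (f t) (ΣH (map f ts)) w) (+-congˡ (ΣH-⊗ f ts y w))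

  Lword-equivariant : ∀ {is} → All (Letter n) is → Equivariant (Lword is)
  Lword-equivariant []                = equivariant-id
  Lword-equivariant (letter i<n ∷ ls) = equivariant-∘ (equivariant-Tl i<n) (Lword-equivariant ls)

  -- `Tword` is built from left actions, so an appended letter ends up innermost; since `Lword is`
  -- is equivariant with value `Tword is` at 1, it is left multiplication by `Tword is`.
  Tword-∷ʳ : ∀ {is} → All (Letter n) is → ∀ i → suc i < n → Tword (is ∷ʳ suc i) ≈H Tword is ⊗ H.T (suc i)
  Tword-∷ʳ {is} ls i i<n w = trans (reflexive (≡.cong (λ f → f w) (foldr-++-Lword is)))
    (sym (⊗-determined (Equivariant.supported (Lword-equivariant ls) 1H-supported) (Lword-equivariant ls) (λ _ → refl)
           (Tl-supported i<n 1H-supported) w))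
    where
    foldr-++-Lword : ∀ js → Tword (js ∷ʳ suc i) ≡ Lword js (H.T (suc i))
    foldr-++-Lword []       = ≡.refl
    foldr-++-Lword (j ∷ js) = ≡.cong (Tl j) (foldr-++-Lword js)

  -- The summand t = m of B_{m+1} belongs to the empty word and is 1; every other word begins with
  -- the letter m, which factors out on the left.
  B-concrete : ∀ m → m ≤ n → H.B m ≈H proj₁ (B m)
  B-concrete zero    _   w = refl
  B-concrete (suc m) m<n w = trans (ΣH-upTo (λ t → Tword (descRange (suc t) (suc m))) m w)
    (trans (+-comm _ _) (+-cong
      (reflexive (≡.cong (λ is → Tword (reverse is) w) (ascRange-empty m)))
      (trans (ΣH-cong-All (All.map (λ {t} t<m v → reflexive (≡.cong (λ is → Tword is v) (descRange-∷ t<m))) (All.all-upTo m)) w)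
             (tail m m<n w))))
    where
    tail : ∀ m → m < n → ΣH (map (λ t → Tl m (Tword (descRange (suc t) m))) (upTo m)) ≈H proj₁ (gen m E.* B m)
    tail zero    _   = E.sym {gen 0 E.* B 0} {E.0#} (E.zeroˡ (B 0))
    tail (suc m) m<n v = sym (trans (gen-* m<n (B (suc m)) v) (trans
      (Tl-cong (suc m) (λ u → sym (B-concrete (suc m) (ℕ.<⇒≤ m<n) u)) v)
      (equivariant-ΣH (equivariant-Tl m<n) (λ t → Tword (descRange (suc t) (suc m))) (upTo (suc m)) v)))

  B*-concrete : ∀ m → m ≤ n → H.B* m ≈H proj₁ (B* m)
  B*-concrete zero    _   w = refl
  B*-concrete (suc m) m<n w = trans (ΣH-upTo (λ t → Tword (ascRange (suc t) (suc m))) m w)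
    (trans (+-comm _ _) (+-cong
      (reflexive (≡.cong (λ is → Tword is w) (ascRange-empty m)))
      (trans (ΣH-cong-All (All.map (λ {t} t<m v → reflexive (≡.cong (λ is → Tword is v) (ascRange-∷ʳ t<m))) (All.all-upTo m)) w)
             (tail m m<n w))))
    where
    tail : ∀ m → m < n → ΣH (map (λ t → Tword (ascRange (suc t) m ∷ʳ m)) (upTo m)) ≈H proj₁ (B* m E.* gen m)
    tail zero    _   = E.sym {B* 0 E.* gen 0} {E.0#} (E.zeroʳ (B* 0))
    tail (suc m) m<n v = trans
      (ΣH-cong-All (All.map (λ {t} _ → Tword-∷ʳ (ascRange-letters t (suc m) (ℕ.<⇒≤ m<n)) m m<n) (All.all-upTo (suc m))) v)
      (trans (sym (ΣH-⊗ (λ t → Tword (ascRange (suc t) (suc m))) (upTo (suc m)) (H.T (suc m)) v))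
      (⊗-cong (B*-concrete (suc m) (ℕ.<⇒≤ m<n)) (λ u → reflexive (≡.cong (λ x → x u) (≡.sym (gen-T m<n)))) v))

  Bk-concrete : ∀ m k → m ≤ n → H.Bk m k ≈H proj₁ (Bk m k)
  Bk-concrete m       zero    _   w = refl
  Bk-concrete zero    (suc k) _     = ⊗-cong (Bk-concrete zero k z≤n) (B-concrete zero z≤n)
  Bk-concrete (suc m) (suc k) m<n   = ⊗-cong (Bk-concrete m k (ℕ.<⇒≤ m<n)) (B-concrete (suc m) m<n)

  B*k-concrete : ∀ m k → m ≤ n → H.B*k m k ≈H proj₁ (B*k m k)
  B*k-concrete m       zero    _   w = refl
  B*k-concrete zero    (suc k) _     = ⊗-cong (B*-concrete zero z≤n) (B*k-concrete zero k z≤n)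
  B*k-concrete (suc m) (suc k) m<n   = ⊗-cong (B*-concrete (suc m) m<n) (B*k-concrete m k (ℕ.<⇒≤ m<n))

  P-concrete : ∀ m k → m ≤ n → H.B*k m k ⊗ H.Bk m k ≈H proj₁ (P m k)
  P-concrete m k m≤n w = trans (⊗-cong (B*k-concrete m k m≤n) (Bk-concrete m k m≤n) w) (B*k-Bk m k w)

  τ-transp : ∀ a D → suc (suc a +ℕ D) ≡ n → proj₁ (τ (suc a) n) ≈H T[ transp n (suc a) ]
  τ-transp a D e w = trans (τ-palindrome a D e w) (trans (genWord-reduced (proj₂ palindrome) w)
      (reflexive (≡.cong (λ u → T[ u ] w) (palindrome-transp e (proj₂ palindrome)))))
    where
    palindrome : ∃ (Reduced n (down a D ++ up (suc a) D))
    palindrome = reduced-down-up a D D (≡.subst (suc a +ℕ D <_) e (ℕ.n<1+n (suc a +ℕ D))) ℕ.≤-refl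

-- Integer polynomials

module Polynomials where

  coeff : Poly → ℕ → ℤ
  coeff []      _       = + 0
  coeff (a ∷ _) zero    = a
  coeff (_ ∷ p) (suc i) = coeff p i

  infix 4 _≈P_
  -- Products and differences of lists may carry trailing zeros, so the ring laws hold only up to
  -- this equality and not up to the `≡` of `PolyRaw`.
  _≈P_ : Poly → Poly → Set
  p ≈P r = ∀ i → coeff p i ≡ coeff r i

  coeff-add : ∀ p r i → coeff (addP p r) i ≡ coeff p i ℤ.+ coeff r i
  coeff-add []      r       i       = ≡.sym (ℤ.+-identityˡ _)
  coeff-add (a ∷ p) []      i       = ≡.sym (ℤ.+-identityʳ _)
  coeff-add (a ∷ p) (b ∷ r) zero    = ≡.refl
  coeff-add (a ∷ p) (b ∷ r) (suc i) = coeff-add p r i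

  coeff-map : ∀ (f : ℤ → ℤ) → f (+ 0) ≡ + 0 → ∀ p i → coeff (map f p) i ≡ f (coeff p i)
  coeff-map f f0 []      i       = ≡.sym f0
  coeff-map f f0 (a ∷ p) zero    = ≡.refl
  coeff-map f f0 (a ∷ p) (suc i) = coeff-map f f0 p i

  coeff-scale : ∀ a p i → coeff (scaleP a p) i ≡ a ℤ.* coeff p i
  coeff-scale a = coeff-map (a ℤ.*_) (ℤ.*-zeroʳ a)

  coeff-mul-∷ : ∀ a p r i → coeff (mulP (a ∷ p) r) i ≡ a ℤ.* coeff r i ℤ.+ coeff (+ 0 ∷ mulP p r) i
  coeff-mul-∷ a p r i = ≡.trans (coeff-add (scaleP a r) _ i) (≡.cong (ℤ._+ _) (coeff-scale a r i))

  shift-cong : ∀ {a p r} → p ≈P r → a ∷ p ≈P a ∷ r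
  shift-cong e zero    = ≡.refl
  shift-cong e (suc i) = e i

  mul-congˡ : ∀ p {r s} → r ≈P s → mulP p r ≈P mulP p s
  mul-congˡ []      e i = ≡.refl
  mul-congˡ (a ∷ p) {r} {s} e i = ≡.trans (coeff-mul-∷ a p r i)
    (≡.trans (≡.cong₂ ℤ._+_ (≡.cong (a ℤ.*_) (e i)) (shift-cong (mul-congˡ p e) i)) (≡.sym (coeff-mul-∷ a p s i)))

  mul-zeroʳ : ∀ p → mulP p [] ≈P []
  mul-zeroʳ []      i       = ≡.refl
  mul-zeroʳ (a ∷ p) zero    = ≡.refl
  mul-zeroʳ (a ∷ p) (suc i) = mul-zeroʳ p i

  mul-∷ʳ : ∀ p b r i → coeff (mulP p (b ∷ r)) i ≡ b ℤ.* coeff p i ℤ.+ coeff (+ 0 ∷ mulP p r) i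
  mul-∷ʳ []      b r zero    = ≡.sym (≡.trans (ℤ.+-identityʳ _) (ℤ.*-zeroʳ b))
  mul-∷ʳ []      b r (suc i) = ≡.sym (≡.trans (ℤ.+-identityʳ _) (ℤ.*-zeroʳ b))
  mul-∷ʳ (a ∷ p) b r zero    = ≡.cong (ℤ._+ + 0) (ℤ.*-comm a b)
  mul-∷ʳ (a ∷ p) b r (suc i) = begin
    coeff (mulP (a ∷ p) (b ∷ r)) (suc i)             ≡⟨ coeff-mul-∷ a p (b ∷ r) (suc i) ⟩
    a ℤ.* x ℤ.+ coeff (mulP p (b ∷ r)) i             ≡⟨ ≡.cong (λ t → (a ℤ.* x) ℤ.+ t) (mul-∷ʳ p b r i) ⟩
    a ℤ.* x ℤ.+ (b ℤ.* y ℤ.+ z)                      ≡⟨ swap-summands (a ℤ.* x) (b ℤ.* y) z ⟩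
    b ℤ.* y ℤ.+ (a ℤ.* x ℤ.+ z)                      ≡⟨ ≡.cong (λ t → (b ℤ.* y) ℤ.+ t) (coeff-mul-∷ a p r i) ⟨
    b ℤ.* y ℤ.+ coeff (mulP (a ∷ p) r) i             ∎
    where
    open ≡.≡-Reasoning
    x = coeff r i
    y = coeff p i
    z = coeff (+ 0 ∷ mulP p r) i
    swap-summands : ∀ u v w → u ℤ.+ (v ℤ.+ w) ≡ v ℤ.+ (u ℤ.+ w)
    swap-summands = solve-∀

  mul-comm : ∀ p r → mulP p r ≈P mulP r p
  mul-comm []      r i = ≡.sym (mul-zeroʳ r i)
  mul-comm (a ∷ p) r i = ≡.trans (coeff-mul-∷ a p r i)
    (≡.trans (≡.cong (λ t → (a ℤ.* coeff r i) ℤ.+ t) (shift-cong (mul-comm p r) i)) (≡.sym (mul-∷ʳ r a p i)))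

  coeff-shift-add : ∀ p r i → coeff (+ 0 ∷ addP p r) i ≡ coeff (+ 0 ∷ p) i ℤ.+ coeff (+ 0 ∷ r) i
  coeff-shift-add p r zero    = ≡.refl
  coeff-shift-add p r (suc i) = coeff-add p r i

  coeff-shift-scale : ∀ a p i → coeff (+ 0 ∷ scaleP a p) i ≡ a ℤ.* coeff (+ 0 ∷ p) i
  coeff-shift-scale a p zero    = ≡.sym (ℤ.*-zeroʳ a)
  coeff-shift-scale a p (suc i) = coeff-scale a p i

  mul-distribˡ : ∀ p r s → mulP p (addP r s) ≈P addP (mulP p r) (mulP p s)
  mul-distribˡ []      r s i = ≡.refl
  mul-distribˡ (a ∷ p) r s i = begin
    coeff (mulP (a ∷ p) (addP r s)) i                                 ≡⟨ coeff-mul-∷ a p (addP r s) i ⟩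
    a ℤ.* coeff (addP r s) i ℤ.+ coeff (+ 0 ∷ mulP p (addP r s)) i    ≡⟨ ≡.cong₂ (λ x y → a ℤ.* x ℤ.+ y) (coeff-add r s i)
         (≡.trans (shift-cong (mul-distribˡ p r s) i) (coeff-shift-add (mulP p r) (mulP p s) i)) ⟩
    a ℤ.* (x ℤ.+ y) ℤ.+ (u ℤ.+ v)                                     ≡⟨ rearrange a x y u v ⟩
    (a ℤ.* x ℤ.+ u) ℤ.+ (a ℤ.* y ℤ.+ v)                               ≡⟨ ≡.cong₂ ℤ._+_ (coeff-mul-∷ a p r i) (coeff-mul-∷ a p s i) ⟨
    coeff (mulP (a ∷ p) r) i ℤ.+ coeff (mulP (a ∷ p) s) i             ≡⟨ coeff-add (mulP (a ∷ p) r) _ i ⟨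
    coeff (addP (mulP (a ∷ p) r) (mulP (a ∷ p) s)) i                  ∎
    where
    open ≡.≡-Reasoning
    x = coeff r i
    y = coeff s i
    u = coeff (+ 0 ∷ mulP p r) i
    v = coeff (+ 0 ∷ mulP p s) i
    rearrange : ∀ a x y u v → a ℤ.* (x ℤ.+ y) ℤ.+ (u ℤ.+ v) ≡ (a ℤ.* x ℤ.+ u) ℤ.+ (a ℤ.* y ℤ.+ v)
    rearrange = solve-∀

  add-cong : ∀ {p p′ r r′} → p ≈P p′ → r ≈P r′ → addP p r ≈P addP p′ r′
  add-cong {p} {p′} {r} {r′} e f i = ≡.trans (coeff-add p r i) (≡.trans (≡.cong₂ ℤ._+_ (e i) (f i)) (≡.sym (coeff-add p′ r′ i)))

  mul-congʳ : ∀ {p r} s → p ≈P r → mulP p s ≈P mulP r s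
  mul-congʳ {p} {r} s e i = ≡.trans (mul-comm p s i) (≡.trans (mul-congˡ s e i) (mul-comm s r i))

  mul-distribʳ : ∀ s p r → mulP (addP p r) s ≈P addP (mulP p s) (mulP r s)
  mul-distribʳ s p r i = ≡.trans (mul-comm (addP p r) s i)
    (≡.trans (mul-distribˡ s p r i) (add-cong {mulP s p} {mulP p s} {mulP s r} {mulP r s} (mul-comm s p) (mul-comm s r) i))

  mul-scale : ∀ a p r → mulP (scaleP a p) r ≈P scaleP a (mulP p r)
  mul-scale a []      r i = ≡.refl
  mul-scale a (b ∷ p) r i = begin
    coeff (mulP (scaleP a (b ∷ p)) r) i                                ≡⟨ coeff-mul-∷ (a ℤ.* b) (scaleP a p) r i ⟩
    a ℤ.* b ℤ.* coeff r i ℤ.+ coeff (+ 0 ∷ mulP (scaleP a p) r) i      ≡⟨ ≡.cong₂ ℤ._+_ (ℤ.*-assoc a b _)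
         (≡.trans (shift-cong (mul-scale a p r) i) (coeff-shift-scale a (mulP p r) i)) ⟩
    a ℤ.* (b ℤ.* coeff r i) ℤ.+ a ℤ.* coeff (+ 0 ∷ mulP p r) i         ≡⟨ ℤ.*-distribˡ-+ a _ _ ⟨
    a ℤ.* (b ℤ.* coeff r i ℤ.+ coeff (+ 0 ∷ mulP p r) i)               ≡⟨ ≡.cong (a ℤ.*_) (coeff-mul-∷ b p r i) ⟨
    a ℤ.* coeff (mulP (b ∷ p) r) i                                     ≡⟨ coeff-scale a (mulP (b ∷ p) r) i ⟨
    coeff (scaleP a (mulP (b ∷ p) r)) i                                ∎
    where open ≡.≡-Reasoning

  mul-shift : ∀ p r → mulP (+ 0 ∷ p) r ≈P + 0 ∷ mulP p r
  mul-shift p r i = ≡.trans (coeff-mul-∷ (+ 0) p r i) (ℤ.+-identityˡ _)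

  mul-assoc : ∀ p r s → mulP (mulP p r) s ≈P mulP p (mulP r s)
  mul-assoc []      r s i = ≡.refl
  mul-assoc (a ∷ p) r s i = ≡.trans (mul-distribʳ s (scaleP a r) (+ 0 ∷ mulP p r) i)
    (add-cong {mulP (scaleP a r) s} {scaleP a (mulP r s)} (mul-scale a r s)
      (λ j → ≡.trans (mul-shift (mulP p r) s j) (shift-cong (mul-assoc p r s) j)) i)

  mul-identityˡ : ∀ p → mulP (+ 1 ∷ []) p ≈P p
  mul-identityˡ p zero    = ≡.trans (coeff-mul-∷ (+ 1) [] p 0) (≡.trans (ℤ.+-identityʳ _) (ℤ.*-identityˡ _))
  mul-identityˡ p (suc i) = ≡.trans (coeff-mul-∷ (+ 1) [] p (suc i)) (≡.trans (ℤ.+-identityʳ _) (ℤ.*-identityˡ _))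

  polyRing : CommutativeRing 0ℓ 0ℓ
  polyRing = record
    { Carrier = Poly ; _≈_ = _≈P_ ; _+_ = addP ; _*_ = mulP ; -_ = negP ; 0# = [] ; 1# = + 1 ∷ []
    ; isCommutativeRing = record
      { isRing = record
        { +-isAbelianGroup = record
          { isGroup = record
            { isMonoid = record
              { isSemigroup = record
                { isMagma = record
                  { isEquivalence = record
                    { refl = λ i → ≡.refl ; sym = λ e i → ≡.sym (e i) ; trans = λ e f i → ≡.trans (e i) (f i) }
                  ; ∙-cong = λ {p} {p′} {r} {r′} → add-cong {p} {p′} {r} {r′} }
                ; assoc = assoc }
              ; identity = (λ p i → ≡.refl) , λ p i → ≡.trans (coeff-add p [] i) (ℤ.+-identityʳ _) }
            ; inverse = inverseˡ , λ p i → ≡.trans (comm p (negP p) i) (inverseˡ p i)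
            ; ⁻¹-cong = λ {p} {r} e i → ≡.trans (coeff-neg p i) (≡.trans (≡.cong (ℤ.-_) (e i)) (≡.sym (coeff-neg r i))) }
          ; comm = comm }
        ; *-cong = λ {p} {p′} {r} {r′} e f i → ≡.trans (mul-congˡ p f i) (mul-congʳ {p} {p′} r′ e i)
        ; *-assoc = mul-assoc
        ; *-identity = mul-identityˡ , λ p i → ≡.trans (mul-comm p (+ 1 ∷ []) i) (mul-identityˡ p i)
        ; distrib = mul-distribˡ , mul-distribʳ }
      ; *-comm = mul-comm } }
    where
    coeff-neg : ∀ p i → coeff (negP p) i ≡ ℤ.- coeff p i
    coeff-neg = coeff-map (λ z → ℤ.- z) ≡.refl
    comm : ∀ p r → addP p r ≈P addP r p
    comm p r i = ≡.trans (coeff-add p r i) (≡.trans (ℤ.+-comm (coeff p i) _) (≡.sym (coeff-add r p i)))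
    inverseˡ : ∀ p → addP (negP p) p ≈P []
    inverseˡ p i = ≡.trans (coeff-add (negP p) p i) (≡.trans (≡.cong (ℤ._+ coeff p i) (coeff-neg p i)) (ℤ.+-inverseˡ (coeff p i)))
    assoc : ∀ p r s → addP (addP p r) s ≈P addP p (addP r s)
    assoc p r s i = ≡.trans (coeff-add (addP p r) s i) (≡.trans (≡.cong (ℤ._+ coeff s i) (coeff-add p r i))
      (≡.trans (ℤ.+-assoc (coeff p i) _ _) (≡.sym (≡.trans (coeff-add p (addP r s) i) (≡.cong (λ t → coeff p i ℤ.+ t) (coeff-add r s i))))))

  module PR = CommutativeRing polyRing
  open RingCertificates PR.ring

  -- Passing every atom as a central variable makes `certify` a prover for commutative identities.
  allCentral : Poly → Central
  allCentral p = p , PR.*-comm p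

  const : ℤ → Poly
  const a = a ∷ []

  const-fma : ∀ a b d → const (a ℤ.- b ℤ.* d) ≈P const a PR.- const b PR.* const d
  const-fma a b d zero    = ≡.sym (≡.cong (λ x → a ℤ.+ ℤ.- x) (ℤ.+-identityʳ _))
  const-fma a b d (suc i) = ≡.refl

  Xq-mul : ∀ p → mulP Xq p ≈P + 0 ∷ p
  Xq-mul p i = ≡.trans (mul-shift (+ 1 ∷ []) p i) (shift-cong (mul-identityˡ p) i)

  -- Long division by a monic polynomial

  pow : ℕ → Poly
  pow zero    = + 1 ∷ []
  pow (suc k) = mulP Xq (pow k)

  pow-+ : ∀ j k → pow (j +ℕ k) ≈P mulP (pow j) (pow k)
  pow-+ zero    k i = ≡.sym (mul-identityˡ (pow k) i)
  pow-+ (suc j) k i = ≡.trans (mul-congˡ Xq {pow (j +ℕ k)} {mulP (pow j) (pow k)} (pow-+ j k) i) (≡.sym (mul-assoc Xq (pow j) (pow k) i))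

  -- The polynomial of a coefficient list written highest degree first.
  fromTop : List ℤ → Poly
  fromTop []       = []
  fromTop (a ∷ as) = addP (mulP (pow (length as)) (const a)) (fromTop as)

  ∷ʳ-pow : ∀ p a → p ∷ʳ a ≈P addP (mulP (pow (length p)) (const a)) p
  ∷ʳ-pow []      a i = ≡.sym (≡.trans (coeff-add (mulP (+ 1 ∷ []) (const a)) [] i)
                       (≡.trans (ℤ.+-identityʳ _) (mul-identityˡ (const a) i)))
  ∷ʳ-pow (b ∷ p) a i = ≡.sym (≡.trans
    (add-cong {mulP (mulP Xq (pow (length p))) (const a)} {+ 0 ∷ mulP (pow (length p)) (const a)} {b ∷ p} {b ∷ p}
      (λ j → ≡.trans (mul-assoc Xq (pow (length p)) (const a) j) (Xq-mul _ j)) (λ j → ≡.refl) i)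
    (head-tail i))
    where
    head-tail : addP (+ 0 ∷ mulP (pow (length p)) (const a)) (b ∷ p) ≈P b ∷ (p ∷ʳ a)
    head-tail zero    = ℤ.+-identityˡ b
    head-tail (suc j) = ≡.sym (∷ʳ-pow p a j)

  reverse-fromTop : ∀ as → reverse as ≈P fromTop as
  reverse-fromTop []       i = ≡.refl
  reverse-fromTop (a ∷ as) i = ≡.trans (≡.cong (λ p → coeff p i) (unfold-reverse a as))
    (≡.trans (∷ʳ-pow (reverse as) a i)
      (add-cong {mulP (pow (length (reverse as))) (const a)} {mulP (pow (length as)) (const a)}
        (λ j → ≡.cong (λ n → coeff (mulP (pow n) (const a)) j) (length-reverse as)) (reverse-fromTop as) i))

  length-subFront : ∀ a ds rs {c} → length rs ≡ c +ℕ length ds → length (subFront a ds rs) ≡ length rs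
  length-subFront a []       rs       e = ≡.refl
  length-subFront a (d ∷ ds) []       {c} e = ≡.refl
  length-subFront a (d ∷ ds) (r ∷ rs) {c} e =
    ≡.cong suc (length-subFront a ds rs {c} (ℕ.suc-injective (≡.trans e (ℕ.+-suc c (length ds)))))

  subFront-fromTop : ∀ a ds rs c → length rs ≡ c +ℕ length ds →
    fromTop (subFront a ds rs) ≈P fromTop rs PR.- pow c PR.* const a PR.* fromTop ds
  subFront-fromTop a []       rs       c e = certify (allCentral (fromTop rs) ∷ allCentral (pow c) ∷ allCentral (const a) ∷ []) []
    (cvar 0) (cvar 0 :- cvar 1 :* cvar 2 :* :0) [] tt ≡.refl
  subFront-fromTop a (d ∷ ds) []       c e with () ← ≡.trans e (ℕ.+-suc c (length ds))
  subFront-fromTop a (d ∷ ds) (r ∷ rs) c e =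
    certify (allCentral (fromTop rs) ∷ allCentral (pow c) ∷ allCentral (const a) ∷ allCentral (fromTop ds)
            ∷ allCentral (pow (length rs)) ∷ allCentral (pow (length ds)) ∷ allCentral (const (r ℤ.- a ℤ.* d))
            ∷ allCentral (const r) ∷ allCentral (const d) ∷ allCentral (pow (length (subFront a ds rs)))
            ∷ allCentral (fromTop (subFront a ds rs)) ∷ []) []
      (w′ :* k :+ z) (w :* r′ :+ x :- v :* a′ :* (u :* d′ :+ y))
      ( :1 ⟪ z ≣ x :- v :* a′ :* y ⟫ :1
      ∷ :1 ⟪ w′ ≣ w ⟫ k
      ∷ w ⟪ k ≣ r′ :- a′ :* d′ ⟫ :1
      ∷ (:0 :- :1) ⟪ w ≣ v :* u ⟫ (a′ :* d′)
      ∷ [])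
      ( subFront-fromTop a ds rs c lengths , (λ i → ≡.cong (λ n → coeff (pow n) i) (length-subFront a ds rs {c} lengths))
      , const-fma r a d , (λ i → ≡.trans (≡.cong (λ n → coeff (pow n) i) lengths) (pow-+ c (length ds) i)) , tt) ≡.refl
    where
    lengths : length rs ≡ c +ℕ length ds
    lengths = ℕ.suc-injective (≡.trans e (ℕ.+-suc c (length ds)))
    x = cvar 0
    v = cvar 1
    a′ = cvar 2
    y = cvar 3
    w = cvar 4
    u = cvar 5
    k = cvar 6
    r′ = cvar 7
    d′ = cvar 8
    w′ = cvar 9
    z = cvar 10

  length-ldiv : ∀ c ds ps → length ps ≡ c +ℕ length ds → length (ldiv c ds ps) ≡ c
  length-ldiv zero    ds ps       e = ≡.refl
  length-ldiv (suc c) ds (a ∷ rs) e = ≡.cong suc (length-ldiv c ds (subFront a ds rs)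
    (≡.trans (length-subFront a ds rs {c} (ℕ.suc-injective e)) (ℕ.suc-injective e)))

  -- `ds` is the divisor without its leading 1, as `divMonic` strips it, and c counts the quotient
  -- digits still to come; when they are used up, what is left has the length of `ds`.
  ldiv-remainder : ∀ c ds ps → length ps ≡ c +ℕ length ds → ∃ λ ρ → length ρ ≡ length ds ×
    fromTop ps ≈P fromTop (ldiv c ds ps) PR.* fromTop (+ 1 ∷ ds) PR.+ fromTop ρ
  ldiv-remainder zero    ds ps       e = ps , e , λ i → ≡.refl
  ldiv-remainder (suc c) ds (a ∷ rs) e with ldiv-remainder c ds (subFront a ds rs)
    (≡.trans (length-subFront a ds rs {c} (ℕ.suc-injective e)) (ℕ.suc-injective e))
  ... | ρ , len , eq = ρ , len ,
    certify (allCentral (pow (length rs)) ∷ allCentral (const a) ∷ allCentral (fromTop rs) ∷ allCentral (pow (length Q))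
            ∷ allCentral (fromTop Q) ∷ allCentral (pow (length ds)) ∷ allCentral (fromTop ds) ∷ allCentral (fromTop ρ)
            ∷ allCentral (fromTop (subFront a ds rs)) ∷ allCentral (pow c) ∷ []) []
      (w :* a′ :+ x) ((v :* a′ :+ y) :* (u :* :1 :+ z) :+ r)
      ( :1 ⟪ s ≣ y :* (u :* :1 :+ z) :+ r ⟫ :1
      ∷ (:0 :- :1) ⟪ s ≣ x :- v′ :* a′ :* z ⟫ :1
      ∷ :1 ⟪ w ≣ v′ :* u ⟫ a′
      ∷ (:0 :- :1) ⟪ v ≣ v′ ⟫ (a′ :* (u :+ z))
      ∷ [])
      ( eq , subFront-fromTop a ds rs c (ℕ.suc-injective e)
      , (λ i → ≡.trans (≡.cong (λ n → coeff (pow n) i) (ℕ.suc-injective e)) (pow-+ c (length ds) i))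
      , (λ i → ≡.cong (λ n → coeff (pow n) i) (length-ldiv c ds (subFront a ds rs)
          (≡.trans (length-subFront a ds rs {c} (ℕ.suc-injective e)) (ℕ.suc-injective e)))) , tt) ≡.refl
    where
    Q = ldiv c ds (subFront a ds rs)
    w = cvar 0
    a′ = cvar 1
    x = cvar 2
    v = cvar 3
    y = cvar 4
    u = cvar 5
    z = cvar 6
    r = cvar 7
    s = cvar 8
    v′ = cvar 9

  coeff-beyond : ∀ p {i} → length p ≤ i → coeff p i ≡ + 0
  coeff-beyond []      _         = ≡.refl
  coeff-beyond (a ∷ p) (s≤s p≤i) = coeff-beyond p p≤i

  coeff-last : ∀ p {a} → coeff (p ∷ʳ a) (length p) ≡ a
  coeff-last []      = ≡.refl
  coeff-last (b ∷ p) = coeff-last p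

  length-∷ʳ : ∀ (p : Poly) {a} → length (p ∷ʳ a) ≡ suc (length p)
  length-∷ʳ []      = ≡.refl
  length-∷ʳ (b ∷ p) = ≡.cong suc (length-∷ʳ p)

  -- Read off from the top: the coefficient of degree deg ds of s (ds + x^m) is
  -- the constant term of s once the higher ones vanish.
  monic-multiple-small : ∀ ds s → (∀ j → length ds ≤ j → coeff (mulP s (ds ∷ʳ + 1)) j ≡ + 0) → s ≈P []
  monic-multiple-small ds []      h i = ≡.refl
  monic-multiple-small ds (a ∷ s) h = λ { zero → head≡0 ; (suc i) → tail≈0 i }
    where
    d = ds ∷ʳ + 1
    top : ∀ j → length ds ≤ j → coeff d (suc j) ≡ + 0
    top j le = coeff-beyond d (≡.subst (_≤ suc j) (≡.sym (length-∷ʳ ds)) (s≤s le))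
    tail≈0 : s ≈P []
    tail≈0 = monic-multiple-small ds s λ j le → ≡.trans (≡.sym (ℤ.+-identityˡ _))
      (≡.trans (≡.cong (ℤ._+ coeff (mulP s d) j) (≡.sym (≡.trans (≡.cong (a ℤ.*_) (top j le)) (ℤ.*-zeroʳ a))))
      (≡.trans (≡.sym (coeff-mul-∷ a s d (suc j))) (h (suc j) (ℕ.m≤n⇒m≤1+n le))))
    shifted : ∀ j → coeff (+ 0 ∷ mulP s d) j ≡ + 0
    shifted zero    = ≡.refl
    shifted (suc j) = mul-congʳ {s} {[]} d tail≈0 j
    head≡0 : a ≡ + 0
    head≡0 = begin
      a                                                      ≡⟨ ℤ.*-identityʳ a ⟨
      a ℤ.* + 1                                              ≡⟨ ≡.cong (a ℤ.*_) (coeff-last ds) ⟨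
      a ℤ.* coeff d (length ds)                              ≡⟨ ℤ.+-identityʳ _ ⟨
      a ℤ.* coeff d (length ds) ℤ.+ + 0                      ≡⟨ ≡.cong (λ t → (a ℤ.* coeff d (length ds)) ℤ.+ t) (shifted (length ds)) ⟨
      a ℤ.* coeff d (length ds) ℤ.+ coeff (+ 0 ∷ mulP s d) (length ds) ≡⟨ coeff-mul-∷ a s d (length ds) ⟨
      coeff (mulP (a ∷ s) d) (length ds)                     ≡⟨ h (length ds) ℕ.≤-refl ⟩
      + 0                                                    ∎
      where open ≡.≡-Reasoning

  difference-zero : ∀ p r → p PR.- r ≈P [] → p ≈P r
  difference-zero p r e = certify (allCentral p ∷ allCentral r ∷ []) [] (cvar 0) (cvar 1)
    (:1 ⟪ cvar 0 :- cvar 1 ≣ :0 ⟫ :1 ∷ []) (e , tt) ≡.refl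

  monic-cancel : ∀ ds p r → mulP (ds ∷ʳ + 1) p ≈P mulP (ds ∷ʳ + 1) r → p ≈P r
  monic-cancel ds p r e = difference-zero p r (monic-multiple-small ds (p PR.- r) λ j _ →
    certify (allCentral p ∷ allCentral r ∷ allCentral (ds ∷ʳ + 1) ∷ []) []
      ((cvar 0 :- cvar 1) :* cvar 2) :0 (:1 ⟪ cvar 2 :* cvar 0 ≣ cvar 2 :* cvar 1 ⟫ :1 ∷ []) (e , tt) ≡.refl j)

  divMonic-∷ʳ : ∀ p ds → divMonic p (ds ∷ʳ + 1) ≡ reverse (ldiv (length p ∸ length ds) (reverse ds) (reverse p))
  divMonic-∷ʳ p ds rewrite reverse-++ ds (+ 1 ∷ []) | length-reverse ds = ≡.refl

  remainder : ∀ p ds → ∃ λ ρ → length ρ ≤ length ds × p ≈P divMonic p (ds ∷ʳ + 1) PR.* (ds ∷ʳ + 1) PR.+ ρ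
  remainder p ds rewrite divMonic-∷ʳ p ds with length ds ℕ.≤? length p
  -- Truncated subtraction makes the quotient empty, and p is its own remainder.
  ... | no ds≰p rewrite ℕ.m≤n⇒m∸n≡0 (ℕ.<⇒≤ (ℕ.≰⇒> ds≰p)) = p , ℕ.<⇒≤ (ℕ.≰⇒> ds≰p) , λ i → ≡.refl
  ... | yes ds≤p with ldiv-remainder (length p ∸ length ds) (reverse ds) (reverse p)
        (≡.trans (length-reverse p) (≡.trans (≡.sym (ℕ.m∸n+n≡m ds≤p)) (≡.cong ((length p ∸ length ds) +ℕ_) (≡.sym (length-reverse ds)))))
  ...   | ρ , len , eq = reverse ρ , ℕ.≤-reflexive (≡.trans (length-reverse ρ) (≡.trans len (length-reverse ds))) ,
    certify (allCentral p ∷ allCentral (fromTop (reverse p)) ∷ allCentral (reverse Q) ∷ allCentral (fromTop Q)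
      ∷ allCentral (ds ∷ʳ + 1) ∷ allCentral (fromTop (+ 1 ∷ reverse ds)) ∷ allCentral (reverse ρ) ∷ allCentral (fromTop ρ) ∷ []) []
      (cvar 0) (cvar 2 :* cvar 4 :+ cvar 6)
      ( :1 ⟪ cvar 0 ≣ cvar 1 ⟫ :1
      ∷ :1 ⟪ cvar 1 ≣ cvar 3 :* cvar 5 :+ cvar 7 ⟫ :1
      ∷ (:0 :- :1) ⟪ cvar 2 ≣ cvar 3 ⟫ (cvar 4)
      ∷ (:0 :- cvar 3) ⟪ cvar 4 ≣ cvar 5 ⟫ :1
      ∷ (:0 :- :1) ⟪ cvar 6 ≣ cvar 7 ⟫ :1
      ∷ [])
      ( via-reverse p , eq , reverse-fromTop Q , divisor , reverse-fromTop ρ , tt) ≡.refl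
    where
    Q = ldiv (length p ∸ length ds) (reverse ds) (reverse p)
    via-reverse : ∀ p → p ≈P fromTop (reverse p)
    via-reverse p i = ≡.trans (≡.cong (λ r → coeff r i) (≡.sym (reverse-involutive p))) (reverse-fromTop (reverse p) i)
    divisor : ds ∷ʳ + 1 ≈P fromTop (+ 1 ∷ reverse ds)
    divisor i = ≡.trans (via-reverse (ds ∷ʳ + 1) i) (≡.cong (λ r → coeff (fromTop r) i) (reverse-++ ds (+ 1 ∷ [])))

  -- p may carry trailing zeros, so the quotient is identified by uniqueness: its difference from r,
  -- times the divisor, is a remainder too short to be a nonzero multiple.
  divMonic-exact : ∀ p ds r → p ≈P mulP (ds ∷ʳ + 1) r → divMonic p (ds ∷ʳ + 1) ≈P r
  divMonic-exact p ds r e with remainder p ds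
  ... | ρ , len , eq = λ i → ≡.sym (difference-zero r (divMonic p (ds ∷ʳ + 1)) (monic-multiple-small ds (r PR.- divMonic p (ds ∷ʳ + 1)) λ j le →
    ≡.trans (certify (allCentral r ∷ allCentral (divMonic p (ds ∷ʳ + 1)) ∷ allCentral (ds ∷ʳ + 1) ∷ allCentral p ∷ allCentral ρ ∷ []) []
      ((cvar 0 :- cvar 1) :* cvar 2) (cvar 4)
      ( :1 ⟪ cvar 3 ≣ cvar 1 :* cvar 2 :+ cvar 4 ⟫ :1 ∷ (:0 :- :1) ⟪ cvar 3 ≣ cvar 2 :* cvar 0 ⟫ :1 ∷ [])
      (eq , e , tt) ≡.refl j) (coeff-beyond ρ (ℕ.≤-trans len le))) i)

  add-∷ʳ : ∀ p r {a} → length p ≤ length r → addP p (r ∷ʳ a) ≡ addP p r ∷ʳ a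
  add-∷ʳ []      r       _         = ≡.refl
  add-∷ʳ (b ∷ p) (c ∷ r) (s≤s p≤r) = ≡.cong (b ℤ.+ c ∷_) (add-∷ʳ p r p≤r)

  length-add : ∀ p r → length p ≤ length r → length (addP p r) ≡ length r
  length-add []      r       _         = ≡.refl
  length-add (b ∷ p) (c ∷ r) (s≤s p≤r) = ≡.cong suc (length-add p r p≤r)

  -- Literal equality of lists matters, since `divMonic` takes the last entry of the divisor as its
  -- leading coefficient. The length bound keeps the scaled copy added in the next step from
  -- overrunning the final 1.
  mul-monic : ∀ p r → ∃ λ s → mulP (p ∷ʳ + 1) (r ∷ʳ + 1) ≡ s ∷ʳ + 1 × length r ≤ length s
  mul-monic [] r = one r
    where
    one : ∀ r → ∃ λ s → mulP (+ 1 ∷ []) (r ∷ʳ + 1) ≡ s ∷ʳ + 1 × length r ≤ length s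
    one []      = [] , ≡.refl , z≤n
    one (c ∷ r) with one r
    ... | s , e , le = (+ 1 ℤ.* c ℤ.+ + 0) ∷ s , ≡.cong (_ ∷_) (≡.trans (scale-only (r ∷ʳ + 1) (nonempty r)) e) , s≤s le
      where
      nonempty : ∀ r → 0 < length (r ∷ʳ + 1)
      nonempty []      = s≤s z≤n
      nonempty (_ ∷ _) = s≤s z≤n
      scale-only : ∀ t → 0 < length t → addP (scaleP (+ 1) t) [] ≡ mulP (+ 1 ∷ []) t
      scale-only (x ∷ []) _    = ≡.cong (_∷ []) (≡.sym (ℤ.+-identityʳ _))
      scale-only (x ∷ y ∷ t) _ = ≡.cong₂ _∷_ (≡.sym (ℤ.+-identityʳ _)) ≡.refl
  mul-monic (a ∷ p) r with mul-monic p r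
  ... | s , e , le = addP (scaleP a (r ∷ʳ + 1)) (+ 0 ∷ s)
      , ≡.trans (≡.cong (λ t → addP (scaleP a (r ∷ʳ + 1)) (+ 0 ∷ t)) e) (add-∷ʳ (scaleP a (r ∷ʳ + 1)) (+ 0 ∷ s) le′)
      , ℕ.≤-trans le (ℕ.≤-trans (ℕ.n≤1+n _) (ℕ.≤-reflexive (≡.sym (length-add (scaleP a (r ∷ʳ + 1)) (+ 0 ∷ s) le′))))
    where
    le′ : length (scaleP a (r ∷ʳ + 1)) ≤ suc (length s)
    le′ = ≡.subst (_≤ suc (length s)) (≡.sym (≡.trans (length-map (a ℤ.*_) (r ∷ʳ + 1)) (length-∷ʳ r))) (s≤s le)

  qint-monic : ∀ k → ∃ λ ds → qintP (suc k) ≡ ds ∷ʳ + 1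
  qint-monic zero    = [] , ≡.refl
  qint-monic (suc k) with qint-monic k
  ... | ds , e = + 1 ∷ ds , ≡.cong (+ 1 ∷_) e

  qfact-monic : ∀ k → ∃ λ ds → qfactP k ≡ ds ∷ʳ + 1
  qfact-monic zero    = [] , ≡.refl
  qfact-monic (suc k) with qfact-monic k | qint-monic k
  ... | ds , e | es , f with mul-monic ds es
  ...   | s , g , _ = s , ≡.trans (≡.cong₂ mulP e f) g

  qfact-cancel : ∀ k p r → mulP (qfactP k) p ≈P mulP (qfactP k) r → p ≈P r
  qfact-cancel k p r e with qfactP k | qfact-monic k
  ... | _ | ds , ≡.refl = monic-cancel ds p r e

  qfact-divMonic : ∀ k p r → p ≈P mulP (qfactP k) r → divMonic p (qfactP k) ≈P r
  qfact-divMonic k p r e with qfactP k | qfact-monic k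
  ... | _ | ds , ≡.refl = divMonic-exact p ds r e

  -- Evaluation at q as a ring homomorphism

  module Evaluation {c ℓ} (F : Field c ℓ) (q : Field.Carrier F) (q≉0 : ¬ (Field._≈_ F q (Field.0# F))) (n : ℕ) where
    open Field F hiding (zero)
    open HeckeField F q q≉0 n using (fromℕ; fromℤ; evalP)
    open import Relation.Binary.Reasoning.Setoid setoid
    open import Algebra.Properties.Ring (CommutativeRing.ring commutativeRing)
    open import Algebra.Properties.CommutativeSemigroup +-commutativeSemigroup using (interchange)
    open import Algebra.Properties.CommutativeSemigroup *-commutativeSemigroup using () renaming (x∙yz≈y∙xz to *-swap-summands)

    fromℕ-+ : ∀ m k → fromℕ (m +ℕ k) ≈ fromℕ m + fromℕ k
    fromℕ-+ zero    n = sym (+-identityˡ _)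
    fromℕ-+ (suc m) n = trans (+-congˡ (fromℕ-+ m n)) (sym (+-assoc _ _ _))

    fromℕ-* : ∀ m n → fromℕ (m ℕ.* n) ≈ fromℕ m * fromℕ n
    fromℕ-* zero    n = sym (zeroˡ _)
    fromℕ-* (suc m) n = trans (fromℕ-+ n (m ℕ.* n))
      (trans (+-cong (sym (*-identityˡ _)) (fromℕ-* m n)) (sym (distribʳ _ _ _)))

    fromℤ-neg : ∀ a → fromℤ (ℤ.- a) ≈ - fromℤ a
    fromℤ-neg (+ zero)  = sym -0#≈0#
    fromℤ-neg (+ suc m) = refl
    fromℤ-neg -[1+ m ]  = sym (-‿involutive _)

    fromℤ-⊖ : ∀ m n → fromℤ (m ⊖ n) ≈ fromℕ m - fromℕ n
    fromℤ-⊖ m       zero    = sym (trans (+-congˡ -0#≈0#) (+-identityʳ _))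
    fromℤ-⊖ zero    (suc n) = sym (+-identityˡ _)
    fromℤ-⊖ (suc m) (suc n) = begin
      fromℤ (suc m ⊖ suc n)                      ≡⟨ ≡.cong fromℤ (ℤ.[1+m]⊖[1+n]≡m⊖n m n) ⟩
      fromℤ (m ⊖ n)                              ≈⟨ fromℤ-⊖ m n ⟩
      fromℕ m - fromℕ n                          ≈⟨ +-identityˡ _ ⟨
      0# + (fromℕ m - fromℕ n)                   ≈⟨ +-congʳ (-‿inverseʳ 1#) ⟨
      (1# - 1#) + (fromℕ m - fromℕ n)            ≈⟨ interchange _ _ _ _ ⟩
      (1# + fromℕ m) + (- 1# + - fromℕ n)        ≈⟨ +-congˡ (-‿+-comm _ _) ⟩
      (1# + fromℕ m) - (1# + fromℕ n)            ∎

    fromℤ-+ : ∀ a b → fromℤ (a ℤ.+ b) ≈ fromℤ a + fromℤ b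
    fromℤ-+ (+ m)    (+ n)    = fromℕ-+ m n
    fromℤ-+ (+ m)    -[1+ n ] = fromℤ-⊖ m (suc n)
    fromℤ-+ -[1+ m ] (+ n)    = trans (fromℤ-⊖ n (suc m)) (+-comm _ _)
    fromℤ-+ -[1+ m ] -[1+ n ] = trans
      (-‿cong (trans (reflexive (≡.cong (λ k → fromℕ (suc k)) (≡.sym (ℕ.+-suc m n)))) (fromℕ-+ (suc m) (suc n))))
      (sym (-‿+-comm _ _))

    fromℤ-pos : ∀ m n → fromℤ (Sign.+ ◃ m ℕ.* n) ≈ fromℕ m * fromℕ n
    fromℤ-pos m n = trans (reflexive (≡.cong fromℤ (ℤ.+◃n≡+n (m ℕ.* n)))) (fromℕ-* m n)

    fromℤ-minus : ∀ m n → fromℤ (Sign.- ◃ m ℕ.* n) ≈ - (fromℕ m * fromℕ n)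
    fromℤ-minus m n = trans (reflexive (≡.cong fromℤ (ℤ.-◃n≡-n (m ℕ.* n))))
      (trans (fromℤ-neg (+ (m ℕ.* n))) (-‿cong (fromℕ-* m n)))

    fromℤ-* : ∀ a b → fromℤ (a ℤ.* b) ≈ fromℤ a * fromℤ b
    fromℤ-* (+ m)    (+ n)    = fromℤ-pos m n
    fromℤ-* (+ m)    -[1+ n ] = trans (fromℤ-minus m (suc n)) (-‿distribʳ-* _ _)
    fromℤ-* -[1+ m ] (+ n)    = trans (fromℤ-minus (suc m) n) (-‿distribˡ-* _ _)
    fromℤ-* -[1+ m ] -[1+ n ] = trans (fromℤ-pos (suc m) (suc n))
      (trans (sym (-‿involutive _)) (trans (-‿cong (-‿distribʳ-* _ _)) (-‿distribˡ-* _ _)))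

    evalP-zero : ∀ p → p ≈P [] → evalP p ≈ 0#
    evalP-zero []      _ = refl
    evalP-zero (a ∷ p) e = trans (+-cong (reflexive (≡.cong fromℤ (e 0)))
      (trans (*-congˡ (evalP-zero p (λ i → e (suc i)))) (zeroʳ q))) (+-identityˡ 0#)

    evalP-cong : ∀ p r → p ≈P r → evalP p ≈ evalP r
    evalP-cong []      r       e = sym (evalP-zero r (λ i → ≡.sym (e i)))
    evalP-cong (a ∷ p) []      e = evalP-zero (a ∷ p) e
    evalP-cong (a ∷ p) (b ∷ r) e = +-cong (reflexive (≡.cong fromℤ (e 0))) (*-congˡ (evalP-cong p r (λ i → e (suc i))))

    evalP-+ : ∀ p r → evalP (addP p r) ≈ evalP p + evalP r
    evalP-+ []      r       = sym (+-identityˡ _)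
    evalP-+ (a ∷ p) []      = sym (+-identityʳ _)
    evalP-+ (a ∷ p) (b ∷ r) = trans
      (+-cong (fromℤ-+ a b) (trans (*-congˡ (evalP-+ p r)) (distribˡ q _ _))) (interchange _ _ _ _)

    evalP-scale : ∀ a p → evalP (scaleP a p) ≈ fromℤ a * evalP p
    evalP-scale a []      = sym (zeroʳ _)
    evalP-scale a (b ∷ p) = trans (+-cong (fromℤ-* a b)
      (trans (*-congˡ (evalP-scale a p)) (*-swap-summands q (fromℤ a) _))) (sym (distribˡ _ _ _))

    evalP-* : ∀ p r → evalP (mulP p r) ≈ evalP p * evalP r
    evalP-* []      r = sym (zeroˡ _)
    evalP-* (a ∷ p) r = begin
      evalP (addP (scaleP a r) (+ 0 ∷ mulP p r))                 ≈⟨ evalP-+ (scaleP a r) _ ⟩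
      evalP (scaleP a r) + (0# + q * evalP (mulP p r))           ≈⟨ +-cong (evalP-scale a r) (trans (+-identityˡ _) (*-congˡ (evalP-* p r))) ⟩
      fromℤ a * evalP r + q * (evalP p * evalP r)                ≈⟨ +-congˡ (*-assoc _ _ _) ⟨
      fromℤ a * evalP r + q * evalP p * evalP r                  ≈⟨ distribʳ _ _ _ ⟨
      evalP (a ∷ p) * evalP r                                    ∎

    evalP-neg : ∀ p → evalP (negP p) ≈ - evalP p
    evalP-neg []      = sym -0#≈0#
    evalP-neg (a ∷ p) = trans (+-cong (fromℤ-neg a) (trans (*-congˡ (evalP-neg p)) (sym (-‿distribʳ-* q _)))) (-‿+-comm _ _)

    evalP-1 : evalP (+ 1 ∷ []) ≈ 1#
    evalP-1 = trans (+-cong (+-identityʳ 1#) (zeroʳ q)) (+-identityʳ 1#)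

    evalP-Xq : evalP Xq ≈ q
    evalP-Xq = trans (+-identityˡ _) (trans (*-congˡ evalP-1) (*-identityʳ q))

open Polynomials

-- Specialisation at q

-- Applied twice: to the identity from `PolyRaw` to `polyRing`, which have the same operations but
-- different equalities, and to evaluation into the field. The first use is the reason why the
-- source is only a raw ring.
module Specialisation {a ℓa c ℓ} (S : RawRing a ℓa) (R : CommutativeRing c ℓ)
  (s : RawRing.Carrier S) (q : CommutativeRing.Carrier R) (n : ℕ)
  (f : RawRing.Carrier S → CommutativeRing.Carrier R)
  (f-hom : IsRingHomomorphism S (CommutativeRing.rawRing R) f)
  (f-q : CommutativeRing._≈_ R (f s) q) where
  open CommutativeRing R hiding (ring; zero)
  open IsRingHomomorphism f-hom using (+-homo; *-homo; 0#-homo; 1#-homo; -‿homo)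
  private module S = Hecke S s n
  open Hecke rawRing q n
  open HeckeRing R q n using (Tl-cong; ⊗-cong)

  spec-Tl : ∀ i x → f ∘ S.Tl i x ≈H Tl i (f ∘ x)
  spec-Tl i x w with asc i w
  ... | true  = trans (*-homo _ _) (*-congʳ f-q)
  ... | false = trans (+-homo _ _) (+-congˡ (trans (*-homo _ _)
                  (*-congʳ (trans (+-homo _ _) (+-cong f-q (trans (-‿homo _) (-‿cong 1#-homo)))))))

  spec-Lword : ∀ is x → f ∘ S.Lword is x ≈H Lword is (f ∘ x)
  spec-Lword []       x w = refl
  spec-Lword (i ∷ is) x w = trans (spec-Tl i (S.Lword is x) w) (Tl-cong i (spec-Lword is x) w)

  spec-⊗ : ∀ x y → f ∘ (x S.⊗ y) ≈H (f ∘ x) ⊗ (f ∘ y)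
  spec-⊗ x y u = go (perms n)
    where
    go : ∀ ws → f (S.sumC (map (λ w → RawRing._*_ S (x w) (S.Lword (redWord n w) y u)) ws)) ≈
                sumC (map (λ w → f (x w) * Lword (redWord n w) (f ∘ y) u) ws)
    go []       = 0#-homo
    go (w ∷ ws) = trans (+-homo _ _) (+-cong (trans (*-homo _ _) (*-congˡ (spec-Lword (redWord n w) y u))) (go ws))

  spec-T[] : ∀ v → f ∘ S.T[ v ] ≈H T[ v ]
  spec-T[] v w with v ==L w
  ... | true  = 1#-homo
  ... | false = 0#-homo

  Lword-cong : ∀ is {x y} → x ≈H y → Lword is x ≈H Lword is y
  Lword-cong []       e = e
  Lword-cong (i ∷ is) e = Tl-cong i (Lword-cong is e)

  spec-Tword : ∀ is → f ∘ S.Tword is ≈H Tword is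
  spec-Tword is w = trans (spec-Lword is S.1H w) (Lword-cong is (spec-T[] (idPerm n)) w)

  spec-ΣTword : ∀ (g : ℕ → List ℕ) ts → f ∘ S.ΣH (map (S.Tword ∘ g) ts) ≈H ΣH (map (Tword ∘ g) ts)
  spec-ΣTword g []       w = 0#-homo
  spec-ΣTword g (t ∷ ts) w = trans (+-homo _ _) (+-cong (spec-Tword (g t) w) (spec-ΣTword g ts w))

  spec-B : ∀ m → f ∘ S.B m ≈H B m
  spec-B m = spec-ΣTword (λ t → descRange (suc t) m) (upTo m)

  spec-B* : ∀ m → f ∘ S.B* m ≈H B* m
  spec-B* m = spec-ΣTword (λ t → ascRange (suc t) m) (upTo m)

  spec-product : ∀ {x y x′ y′} → f ∘ x ≈H x′ → f ∘ y ≈H y′ → f ∘ (x S.⊗ y) ≈H x′ ⊗ y′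
  spec-product {x} {y} e e′ w = trans (spec-⊗ x y w) (⊗-cong e e′ w)

  spec-Bk : ∀ m k → f ∘ S.Bk m k ≈H Bk m k
  spec-Bk m       zero    = spec-T[] (idPerm n)
  spec-Bk zero    (suc k) = spec-product (spec-Bk zero k) (spec-B zero)
  spec-Bk (suc m) (suc k) = spec-product (spec-Bk m k) (spec-B (suc m))

  spec-B*k : ∀ m k → f ∘ S.B*k m k ≈H B*k m k
  spec-B*k m       zero    = spec-T[] (idPerm n)
  spec-B*k zero    (suc k) = spec-product (spec-B* zero) (spec-B*k zero k)
  spec-B*k (suc m) (suc k) = spec-product (spec-B* (suc m)) (spec-B*k m k)

  spec-B*k⊗Bk : ∀ m k → f ∘ (S.B*k m k S.⊗ S.Bk m k) ≈H B*k m k ⊗ Bk m k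
  spec-B*k⊗Bk m k = spec-product (spec-B*k m k) (spec-Bk m k)

module TheoryMap {a ℓa c ℓ} (A : Ring a ℓa) (A′ : Ring c ℓ)
  (q : Ring.Carrier A) (q′ : Ring.Carrier A′)
  (T : ℕ → Ring.Carrier A) (T′ : ℕ → Ring.Carrier A′)
  (φ : Ring.Carrier A → Ring.Carrier A′) (φ-hom : IsRingHomomorphism (Ring.rawRing A) (Ring.rawRing A′) φ)
  (φ-q : Ring._≈_ A′ (φ q) q′) (φ-T : ∀ i → Ring._≈_ A′ (φ (T i)) (T′ i)) where
  private
    module Src = Ring A
    module S = HeckeTheory A q T
  open Ring A′ hiding (zero)
  open HeckeTheory A′ q′ T′
  open IsRingHomomorphism φ-hom using (⟦⟧-cong; +-homo; *-homo; 0#-homo; 1#-homo; -‿homo)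
  open import Relation.Binary.Reasoning.Setoid setoid

  φ-* : ∀ {x y x′ y′} → φ x ≈ x′ → φ y ≈ y′ → φ (x Src.* y) ≈ x′ * y′
  φ-* e e′ = trans (*-homo _ _) (*-cong e e′)

  φ-+ : ∀ {x y x′ y′} → φ x ≈ x′ → φ y ≈ y′ → φ (x Src.+ y) ≈ x′ + y′
  φ-+ e e′ = trans (+-homo _ _) (+-cong e e′)

  φ-- : ∀ {x y x′ y′} → φ x ≈ x′ → φ y ≈ y′ → φ (x Src.- y) ≈ x′ - y′
  φ-- e e′ = φ-+ e (trans (-‿homo _) (-‿cong e′))

  φ-B : ∀ m → φ (S.B m) ≈ B m
  φ-B zero    = 0#-homo
  φ-B (suc m) = φ-+ 1#-homo (φ-* (φ-T m) (φ-B m))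

  φ-D : ∀ m → φ (S.D m) ≈ D m
  φ-D zero    = 0#-homo
  φ-D (suc m) = φ-+ (φ-+ 1#-homo (φ-T m)) (φ-* (φ-* (φ-T m) (φ-D m)) (φ-T m))

  φ-qpow : ∀ k → φ (S.qpow k) ≈ qpow k
  φ-qpow zero    = 1#-homo
  φ-qpow (suc k) = φ-* φ-q (φ-qpow k)

  φ-qint : ∀ k → φ (S.qint k) ≈ qint k
  φ-qint zero    = 0#-homo
  φ-qint (suc k) = φ-+ 1#-homo (φ-* φ-q (φ-qint k))

  -- Only B, D and the q-numbers are replaced by their counterparts. The r remain images under φ, in
  -- agreement with the definition of R by specialisation.
  recursion-map : ∀ k m {r₂ r₁ r₀} →
    S.qpow k Src.* (S.B m Src.* r₂) Src.≈
      (S.qpow k Src.* S.qpow k Src.* q Src.* r₁ Src.+ (S.D m Src.- S.qint k) Src.* r₀) Src.* S.B m →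
    qpow k * (B m * φ r₂) ≈
      (qpow k * qpow k * q′ * φ r₁ + (D m - qint k) * φ r₀) * B m
  recursion-map k m {r₂} {r₁} {r₀} e = begin
    qpow k * (B m * φ r₂)                      ≈⟨ φ-* (φ-qpow k) (φ-* (φ-B m) refl) ⟨
    φ (S.qpow k Src.* (S.B m Src.* r₂))            ≈⟨ ⟦⟧-cong e ⟩
    φ ((S.qpow k Src.* S.qpow k Src.* q Src.* r₁ Src.+ (S.D m Src.- S.qint k) Src.* r₀) Src.* S.B m)
      ≈⟨ φ-* (φ-+ (φ-* (φ-* (φ-* (φ-qpow k) (φ-qpow k)) φ-q) refl) (φ-* (φ-- (φ-D m) (φ-qint k)) refl)) (φ-B m) ⟩
    (qpow k * qpow k * q′ * φ r₁ + (D m - qint k) * φ r₀) * B m ∎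

-- The q-numbers as scalar multiples of 1

module Scalars {c ℓ} (R : CommutativeRing c ℓ) (q : CommutativeRing.Carrier R) (n : ℕ) where
  open CommutativeRing R hiding (ring; zero)
  open Hecke rawRing q n using (_^_; [_]q; sumC)
  private module H = Hecke rawRing q n
  open HeckeRing R q n
  open Concrete R q n using (P-concrete)
  open HeckeTheory ring (scalar q) gen
  open Relations n (scalar-central q) (λ _ → refl) gen-quadratic gen-braid gen-comm

  scalar-cong : ∀ {r s} → r ≈ s → scalar r E.≈ scalar s
  scalar-cong e w = *-congʳ e

  scalar-1 : E.1# E.≈ scalar 1#
  scalar-1 w = sym (*-identityˡ _)

  scalar-+ : ∀ r s → scalar (r + s) E.≈ scalar r E.+ scalar s
  scalar-+ r s w = distribʳ _ r s

  scalar-*-homo : ∀ r s → scalar (r * s) E.≈ scalar r E.* scalar s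
  scalar-*-homo r s w = trans (*-assoc r s _) (sym (scalar-* r (scalar s) w))

  qpow-scalar : ∀ k → qpow k E.≈ scalar (q ^ k)
  qpow-scalar zero    = scalar-1
  qpow-scalar (suc k) w = trans (⊗-cong {proj₁ (scalar q)} (λ _ → refl) (qpow-scalar k) w) (sym (scalar-*-homo q (q ^ k) w))

  [suc]q : ∀ k → [ suc k ]q ≈ [ k ]q + q ^ k
  [suc]q k = trans (reflexive (≡.cong (λ ts → sumC (map (q ^_) ts)) (≡.sym (upTo-∷ʳ k)))) (last (upTo k))
    where
    last : ∀ ts → sumC (map (q ^_) (ts ++ k ∷ [])) ≈ sumC (map (q ^_) ts) + q ^ k
    last []       = trans (+-identityʳ _) (sym (+-identityˡ _))
    last (t ∷ ts) = trans (+-congˡ (last ts)) (sym (+-assoc _ _ _))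

  qint-scalar : ∀ k → qint k E.≈ scalar ([ k ]q)
  qint-scalar zero    w = sym (zeroˡ _)
  qint-scalar (suc k) w = trans (qint-suc k w) (trans (+-cong (qint-scalar k w) (qpow-scalar k w))
    (sym (trans (scalar-cong ([suc]q k) w) (scalar-+ _ _ w))))

  qint-scalar-step : ∀ k {c d} → qint k E.≈ scalar c → d ≈ 1# + q * c → qint (suc k) E.≈ scalar d
  qint-scalar-step k {c} e f w = trans
    (+-cong (scalar-1 w) (trans (⊗-cong {proj₁ (scalar q)} (λ _ → refl) e w) (sym (scalar-*-homo q c w))))
    (trans (sym (scalar-+ 1# (q * c) w)) (scalar-cong (sym f) w))

  qfact-scalar-step : ∀ k {c d} → qfact k E.≈ scalar c → qint (suc k) E.≈ scalar d → qfact (suc k) E.≈ scalar (c * d)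
  qfact-scalar-step k {c} {d} e f w = trans (⊗-cong e f w) (sym (scalar-*-homo c d w))

  coeff-central : ∀ x c → x E.≈ scalar c → ∀ y w → proj₁ (x E.* y) w ≈ c * proj₁ y w
  coeff-central x c e y w = trans (⊗-cong {y = proj₁ y} e (λ _ → refl) w) (scalar-* c y w)

  coeff-divisible : ∀ {c} m k → qfact k E.≈ scalar c → m ≤ n → ∀ w → (H.B*k m k H.⊗ H.Bk m k) w ≈ c * proj₁ (r m k) w
  coeff-divisible {c} m k e m≤n w =
    trans (P-concrete m k m≤n w) (trans (P-divisible m k m≤n w) (coeff-central (qfact k) c e (r m k) w))

-- Cancellation of [k]!_q and exact division over ℤ[q]

module Generic (n : ℕ) where
  open CommutativeRing polyRing using (rawRing)
  open HeckeRing polyRing Xq n public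
  open HeckeTheory ring (scalar Xq) gen public
  open Relations n (scalar-central Xq) (λ _ i → ≡.refl) gen-quadratic gen-braid gen-comm public
  open Scalars polyRing Xq n
  private
    module Gen = Hecke PolyRaw Xq n
    module H = Hecke rawRing Xq n

  qintP-horner : ∀ k → qintP (suc k) ≈P addP PR.1# (mulP Xq (qintP k))
  qintP-horner k i = ≡.sym (≡.trans (add-cong {PR.1#} {PR.1#} {mulP Xq (qintP k)} {+ 0 ∷ qintP k} (λ _ → ≡.refl) (Xq-mul (qintP k)) i) (lead i))
    where
    lead : addP PR.1# (+ 0 ∷ qintP k) ≈P qintP (suc k)
    lead zero    = ≡.refl
    lead (suc i) = ≡.refl

  qint-qintP : ∀ k → qint k E.≈ scalar (qintP k)
  qint-qintP zero    w i = ≡.refl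
  qint-qintP (suc k) = qint-scalar-step k {qintP k} {qintP (suc k)} (qint-qintP k) (qintP-horner k)

  qfact-qfactP : ∀ k → qfact k E.≈ scalar (qfactP k)
  qfact-qfactP zero    = scalar-1
  qfact-qfactP (suc k) = qfact-scalar-step k {qfactP k} {qintP (suc k)} (qfact-qfactP k) (qint-qintP (suc k))

  qfact-coeff : ∀ k x w → proj₁ (qfact k E.* x) w ≈P mulP (qfactP k) (proj₁ x w)
  qfact-coeff k = coeff-central (qfact k) (qfactP k) (qfact-qfactP k)

  qfact-cancelˡ : ∀ k x y → qfact k E.* x E.≈ qfact k E.* y → x E.≈ y
  qfact-cancelˡ k x y e w = qfact-cancel k (proj₁ x w) (proj₁ y w) λ i →
    ≡.trans (≡.sym (qfact-coeff k x w i)) (≡.trans (e w i) (qfact-coeff k y w i))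

  PolyRaw-id : IsRingHomomorphism PolyRaw rawRing id
  PolyRaw-id = record
    { isSemiringHomomorphism = record
      { isNearSemiringHomomorphism = record
        { +-isMonoidHomomorphism = record
          { isMagmaHomomorphism = record
            { isRelHomomorphism = record { cong = λ e i → ≡.cong (λ p → coeff p i) e } ; homo = λ _ _ _ → ≡.refl }
          ; ε-homo = λ _ → ≡.refl }
        ; *-homo = λ _ _ _ → ≡.refl }
      ; 1#-homo = λ _ → ≡.refl }
    ; -‿homo = λ _ _ → ≡.refl }

  open Specialisation PolyRaw polyRing Xq Xq n id PolyRaw-id (λ _ → ≡.refl)

  divMonic-r : ∀ m k w → m ≤ n → divMonic ((Gen.B*k m k Gen.⊗ Gen.Bk m k) w) (qfactP k) ≈P proj₁ (r m k) w
  divMonic-r m k w m≤n = qfact-divMonic k ((Gen.B*k m k Gen.⊗ Gen.Bk m k) w) (proj₁ (r m k) w) λ i →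
    ≡.trans (spec-B*k⊗Bk m k w i) (coeff-divisible {qfactP k} m k (qfact-qfactP k) m≤n w i)

-- The identity over the field

module Main {c ℓ} (F : Field c ℓ) (q : Field.Carrier F) (q≉0 : ¬ (Field._≈_ F q (Field.0# F))) (m k : ℕ) where
  n : ℕ
  n = suc m
  open Field F hiding (ring; zero)
  open HeckeField F q q≉0 n using (R; J; q⁻¹; evalP; _^_; [_]q; _≈H_; _⊕_; _·_; _⊗_; 1H; ΣH; T[_])
  private module H = HeckeField F q q≉0 n
  open Evaluation F q q≉0 n
  private module G = Generic n
  open HeckeRing commutativeRing q n
  open HeckeTheory ring (scalar q) gen
  open Relations n (scalar-central q) (λ _ → refl) gen-quadratic gen-braid gen-comm
  open Scalars commutativeRing q n
  open Concrete commutativeRing q n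
  open RingCertificates ring
  open import Relation.Binary.Reasoning.Setoid setoid

  evalP-hom : IsRingHomomorphism (CommutativeRing.rawRing polyRing) rawRing evalP
  evalP-hom = record
    { isSemiringHomomorphism = record
      { isNearSemiringHomomorphism = record
        { +-isMonoidHomomorphism = record
          { isMagmaHomomorphism = record
            { isRelHomomorphism = record { cong = λ {p} {r} → evalP-cong p r } ; homo = evalP-+ }
          ; ε-homo = refl }
        ; *-homo = evalP-* }
      ; 1#-homo = evalP-1 }
    ; -‿homo = evalP-neg }

  open Specialisation (CommutativeRing.rawRing polyRing) commutativeRing Xq q n evalP evalP-hom evalP-Xq

  eval : G.Element → Element
  eval (x , supp) = (λ w → evalP (x w)) , λ w ¬w → evalP-zero (x w) (supp w ¬w)

  eval-hom : IsRingHomomorphism (Ring.rawRing G.ring) (Ring.rawRing ring) eval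
  eval-hom = record
    { isSemiringHomomorphism = record
      { isNearSemiringHomomorphism = record
        { +-isMonoidHomomorphism = record
          { isMagmaHomomorphism = record
            { isRelHomomorphism = record { cong = λ {x} {y} e w → evalP-cong (proj₁ x w) (proj₁ y w) (e w) }
            ; homo = λ x y w → evalP-+ (proj₁ x w) (proj₁ y w) }
          ; ε-homo = λ w → refl }
        ; *-homo = λ x y → spec-⊗ (proj₁ x) (proj₁ y) }
      ; 1#-homo = spec-T[] (idPerm n) }
    ; -‿homo = λ x w → evalP-neg (proj₁ x w) }

  eval-q : eval (G.scalar Xq) E.≈ scalar q
  eval-q w = trans (evalP-* Xq (proj₁ G.E.1# w)) (*-cong evalP-Xq (spec-T[] (idPerm n) w))

  eval-gen : ∀ i → eval (G.gen i) E.≈ gen i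
  eval-gen zero    w = refl
  eval-gen (suc i) w with suc i ℕ.<? n
  ... | yes _ = spec-Tword (suc i ∷ []) w
  ... | no  _ = refl

  open TheoryMap G.ring ring (G.scalar Xq) (scalar q) G.gen gen eval eval-hom eval-q eval-gen

  ρ : ℕ → ℕ → Element
  ρ i j = eval (G.r i j)

  R-ρ : ∀ i j → i ≤ n → R i j ≈H proj₁ (ρ i j)
  R-ρ i j i≤n w = evalP-cong (divMonic ((H.Gen.B*k i j H.Gen.⊗ H.Gen.Bk i j) w) (qfactP j)) (proj₁ (G.r i j) w)
    (G.divMonic-r i j w i≤n)

  specialised : qpow k E.* (B n E.* ρ n (suc k)) E.≈
    (qpow k E.* qpow k E.* scalar q E.* ρ m (suc k) E.+ (D n E.- qint k) E.* ρ m k) E.* B n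
  specialised = recursion-map k n {G.r n (suc k)} {G.r m (suc k)} {G.r m k}
    (G.qfact-cancelˡ (suc k)
      (G.qpow k G.E.* (G.B n G.E.* G.r n (suc k)))
      ((G.qpow k G.E.* G.qpow k G.E.* G.scalar Xq G.E.* G.r m (suc k) G.E.+ (G.D n G.E.- G.qint k) G.E.* G.r m k) G.E.* G.B n)
      (G.recursion-r k m ℕ.≤-refl))

  q*q⁻¹ : q * q⁻¹ ≈ 1#
  q*q⁻¹ = proj₂ (inverse q q≉0)

  q^*q⁻¹^ : ∀ j → q ^ j * q⁻¹ ^ j ≈ 1#
  q^*q⁻¹^ zero    = *-identityˡ 1#
  q^*q⁻¹^ (suc j) = trans (*-interchange q (q ^ j) q⁻¹ (q⁻¹ ^ j)) (trans (*-cong q*q⁻¹ (q^*q⁻¹^ j)) (*-identityˡ 1#))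
    where open import Algebra.Properties.CommutativeSemigroup *-commutativeSemigroup using () renaming (interchange to *-interchange)

  ^-+ : ∀ i j → q ^ (i +ℕ j) ≈ q ^ i * q ^ j
  ^-+ zero    j = sym (*-identityˡ _)
  ^-+ (suc i) j = trans (*-congˡ (^-+ i j)) (sym (*-assoc _ _ _))

  ^-cancel : ∀ {i j} → i ≤ j → q ^ j * q⁻¹ ^ (j ∸ i) ≈ q ^ i
  ^-cancel {i} {j} i≤j = begin
    q ^ j * q⁻¹ ^ (j ∸ i)                  ≡⟨ ≡.cong (λ e → q ^ e * q⁻¹ ^ (j ∸ i)) (ℕ.m+[n∸m]≡n i≤j) ⟨
    q ^ (i +ℕ (j ∸ i)) * q⁻¹ ^ (j ∸ i)     ≈⟨ *-congʳ (^-+ i (j ∸ i)) ⟩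
    q ^ i * q ^ (j ∸ i) * q⁻¹ ^ (j ∸ i)    ≈⟨ *-assoc _ _ _ ⟩
    q ^ i * (q ^ (j ∸ i) * q⁻¹ ^ (j ∸ i))  ≈⟨ *-congˡ (q^*q⁻¹^ (j ∸ i)) ⟩
    q ^ i * 1#                             ≈⟨ *-identityʳ _ ⟩
    q ^ i                                  ∎

  jmTerm : ℕ → H.H
  jmTerm t = (q⁻¹ ^ (n ∸ suc t)) · T[ transp n (suc t) ]

  jucysMurphy : Element
  jucysMurphy = Σ< (λ i → qpow (suc i) E.* τ (suc i) n) m

  -- The coefficient q^(i-n) of (i, n) in J becomes the power q^i with which (i, n) enters D.
  jucysMurphy-J : proj₁ jucysMurphy ≈H (q ^ n) · J
  jucysMurphy-J = partial m ℕ.≤-refl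
    where
    summand : ∀ t → t < m → proj₁ (qpow (suc t) E.* τ (suc t) n) ≈H (q ^ n) · jmTerm t
    summand t t<m w = begin
      proj₁ (qpow (suc t) E.* τ (suc t) n) w                ≈⟨ ⊗-cong (qpow-scalar (suc t)) (λ _ → refl) w ⟩
      proj₁ (scalar (q ^ suc t) E.* τ (suc t) n) w          ≈⟨ scalar-* (q ^ suc t) (τ (suc t) n) w ⟩
      q ^ suc t * proj₁ (τ (suc t) n) w                     ≈⟨ *-congˡ (τ-transp t (m ∸ suc t) (≡.cong suc (ℕ.m+[n∸m]≡n t<m)) w) ⟩
      q ^ suc t * T[ transp n (suc t) ] w                   ≈⟨ *-congʳ (^-cancel (s≤s (ℕ.<⇒≤ t<m))) ⟨
      q ^ n * q⁻¹ ^ (n ∸ suc t) * T[ transp n (suc t) ] w   ≈⟨ *-assoc _ _ _ ⟩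
      q ^ n * jmTerm t w                                    ∎
    partial : ∀ i → i ≤ m → proj₁ (Σ< (λ j → qpow (suc j) E.* τ (suc j) n) i) ≈H (q ^ n) · ΣH (map jmTerm (upTo i))
    partial zero    _   w = sym (zeroʳ _)
    partial (suc i) i<m w = trans (+-cong (partial i (ℕ.<⇒≤ i<m) w) (summand i i<m w))
      (trans (sym (distribˡ _ _ _)) (*-congˡ (sym (ΣH-upTo jmTerm i w))))

  main : k ≤ m →
    H.B n ⊗ R n (suc k) ≈H
      ((q ^ suc k) · R m (suc k) ⊕ ([ suc m ∸ k ]q · 1H ⊕ (q ^ (suc m ∸ k)) · J) ⊗ R m k) ⊗ H.B n
  main k≤m w = begin
    (H.B n ⊗ R n (suc k)) w
      ≈⟨ ⊗-cong (B-concrete n ℕ.≤-refl) (R-ρ n (suc k) ℕ.≤-refl) w ⟩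
    proj₁ (B n E.* ρ n (suc k)) w
      ≈⟨ cancelled w ⟩
    proj₁ ((qpow (suc k) E.* ρ m (suc k) E.+ (qint d E.+ qpow d E.* j) E.* ρ m k) E.* B n) w
      ≈⟨ ⊗-cong (λ v → +-cong (qpow-R v) (⊗-cong (λ u → +-cong (qint-scalar d u) (qpow-J u)) ρ-R v))
                (λ v → sym (B-concrete n ℕ.≤-refl v)) w ⟩
    (((q ^ suc k) · R m (suc k) ⊕ ([ d ]q · 1H ⊕ (q ^ d) · J) ⊗ R m k) ⊗ H.B n) w ∎
    where
    d = suc m ∸ k
    k+d : k +ℕ d ≡ n
    k+d = ℕ.m+[n∸m]≡n (ℕ.m≤n⇒m≤1+n k≤m)
    Q⁻¹ : Central
    Q⁻¹ = scalar (q⁻¹ ^ k) , scalar-central (q⁻¹ ^ k)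
    j : Element
    j = scalar (q⁻¹ ^ n) E.* jucysMurphy
    ρ-R : proj₁ (ρ m k) ≈H R m k
    ρ-R v = sym (R-ρ m k (ℕ.n≤1+n m) v)
    qpow-R : proj₁ (qpow (suc k) E.* ρ m (suc k)) ≈H (q ^ suc k) · R m (suc k)
    qpow-R v = trans (coeff-central (qpow (suc k)) (q ^ suc k) (qpow-scalar (suc k)) (ρ m (suc k)) v)
      (*-congˡ (sym (R-ρ m (suc k) (ℕ.n≤1+n m) v)))
    j-J : proj₁ j ≈H J
    j-J v = begin
      proj₁ j v                       ≈⟨ scalar-* (q⁻¹ ^ n) jucysMurphy v ⟩
      q⁻¹ ^ n * proj₁ jucysMurphy v   ≈⟨ *-congˡ (jucysMurphy-J v) ⟩
      q⁻¹ ^ n * (q ^ n * J v)         ≈⟨ *-assoc _ _ _ ⟨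
      q⁻¹ ^ n * q ^ n * J v           ≈⟨ *-congʳ (trans (*-comm _ _) (q^*q⁻¹^ n)) ⟩
      1# * J v                        ≈⟨ *-identityˡ _ ⟩
      J v                             ∎
    qpow-J : proj₁ (qpow d E.* j) ≈H (q ^ d) · J
    qpow-J v = trans (coeff-central (qpow d) (q ^ d) (qpow-scalar d) j v) (*-congˡ (j-J v))
    inverse-qpow : scalar (q⁻¹ ^ k) E.* qpow k E.≈ E.1#
    inverse-qpow v = begin
      proj₁ (scalar (q⁻¹ ^ k) E.* qpow k) v  ≈⟨ scalar-* (q⁻¹ ^ k) (qpow k) v ⟩
      q⁻¹ ^ k * proj₁ (qpow k) v             ≈⟨ *-congˡ (qpow-scalar k v) ⟩
      q⁻¹ ^ k * (q ^ k * 1H v)               ≈⟨ *-assoc _ _ _ ⟨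
      q⁻¹ ^ k * q ^ k * 1H v                 ≈⟨ *-congʳ (trans (*-comm _ _) (q^*q⁻¹^ k)) ⟩
      1# * 1H v                              ≈⟨ *-identityˡ _ ⟩
      1H v                                   ∎
    jucysMurphy-j : jucysMurphy E.≈ qpow n E.* j
    jucysMurphy-j v = begin
      proj₁ jucysMurphy v        ≈⟨ jucysMurphy-J v ⟩
      q ^ n * J v                ≈⟨ *-congˡ (j-J v) ⟨
      q ^ n * proj₁ j v          ≈⟨ coeff-central (qpow n) (q ^ n) (qpow-scalar n) j v ⟨
      proj₁ (qpow n E.* j) v     ∎
    cancelled : B n E.* ρ n (suc k) E.≈
      (qpow (suc k) E.* ρ m (suc k) E.+ (qint d E.+ qpow d E.* j) E.* ρ m k) E.* B n
    cancelled = certify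
      ((scalar q , scalar-central q) ∷ qpowᶜ k ∷ Q⁻¹ ∷ qpowᶜ d ∷ qintᶜ d ∷ qintᶜ k ∷ qintᶜ n ∷ qpowᶜ n ∷ [])
      (B n ∷ ρ n (suc k) ∷ ρ m (suc k) ∷ ρ m k ∷ j ∷ jucysMurphy ∷ D n ∷ [])
      (b :* r₂) rhs
      -- The goal is q^(-k) times the recursion. With d = n - k, the splittings [n]_q = [k]_q + q^k
      -- [d]_q and q^n = q^k q^d turn D_n - [k]_q into q^k ([d]_q + q^d J_n).
      ( (:0 :- :1) ⟪ Qi :* Q ≣ :1 ⟫ (b :* r₂ :- rhs)
      ∷ Qi ⟪ Q :* (b :* r₂) ≣ (Q :* Q :* u :* r₁ :+ (D′ :- K₀) :* r₀) :* b ⟫ :1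
      ∷ Qi ⟪ D′ ≣ Kₙ :+ S ⟫ (r₀ :* b)
      ∷ Qi ⟪ S ≣ Qₙ :* J′ ⟫ (r₀ :* b)
      ∷ Qi ⟪ Qₙ ≣ Q :* Qd ⟫ (J′ :* r₀ :* b)
      ∷ Qi ⟪ Kₙ ≣ K₀ :+ Q :* Kd ⟫ (r₀ :* b)
      ∷ [])
      ( inverse-qpow , specialised , D-jucysMurphy m ℕ.≤-refl , jucysMurphy-j
      , ≡.subst (λ i → qpow i E.≈ qpow k E.* qpow d) k+d (qpow-+ k d)
      , ≡.subst (λ i → qint i E.≈ qint k E.+ qpow k E.* qint d) k+d (qint-+ k d) , tt) ≡.refl
      where
      u = cvar 0
      Q = cvar 1
      Qi = cvar 2
      Qd = cvar 3
      Kd = cvar 4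
      K₀ = cvar 5
      Kₙ = cvar 6
      Qₙ = cvar 7
      b = var 0
      r₂ = var 1
      r₁ = var 2
      r₀ = var 3
      J′ = var 4
      S = var 5
      D′ = var 6
      rhs = (u :* Q :* r₁ :+ (Kd :+ Qd :* J′) :* r₀) :* b

open import Data.Nat using (_+_)

theorem3p6 : ∀ {c ℓ} (F : Field c ℓ) (q : Field.Carrier F)
    (q≉0 : ¬ (Field._≈_ F q (Field.0# F))) (n k : ℕ) →
    1 ≤ k → k ≤ n →
    let open HeckeField F q q≉0 n in
    B n ⊗ R n k
    ≈H ((q ^ k) · R (n ∸ 1) k
    ⊕ ([ n + 1 ∸ k ]q · 1H ⊕ (q ^ (n + 1 ∸ k)) · J) ⊗ R (n ∸ 1) (k ∸ 1))
    ⊗ B n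
-- For these arguments `n + 1 ∸ k` reduces to `m + 1 ∸ k`, with the smaller k; the rewrite turns it
-- into the `suc m ∸ k` of `main`.
theorem3p6 F q q≉0 (suc m) (suc k) _ (s≤s k≤m) rewrite ℕ.+-comm m 1 = Main.main F q q≉0 m k k≤m
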